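{- There is an algorithm for \textsc{Edge Clique Cover} with parameter $k$ which can handle edge insertions or edge deletions in $2^{2^{O(g(k))}}$ time, under the promise that the graph always has an edge clique cover of size $g(k)$ for some computable function $g$, which maintains an edge clique cover in the sense that any of the following queries can be supported: \begin{itemize} \item Given a clique name $C$, return the set of nodes in $C$ in time linear in the size of $C$. \item Given a node $v$, return the names of all cliques (of the maintained cover) that $v$ is contained in, in time linear in the size of the output. \end{itemize}
   Context: For an undirected graph $G$, an edge clique cover of size $s$ is a family $\{C_1,\dots,C_s\}$ of vertex subsets of $G$ such that each $C_i$ induces a clique in $G$ and every edge of $G$ has both endpoints in some $C_i$. \textsc{Edge Clique Cover} (parameter $k$): given $G$ and $k\in\mathbb N$, find an edge clique cover of $G$ of size at most $k$ (or report that none exists). In the dynamic problem, $k$ is fixed and each update inserts or deletes a single edge of $G$. The function $g:\mathbb N\to\mathbb N$ is computable; the guarantees are only required as long as, throughout the sequence of updates, the current graph has an edge clique cover of size at most $g(k)$. Each clique of the maintained cover is identified by a name (an identifier). -}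

module Defs where

open import Data.Bool using (Bool; true; false; if_then_else_)
open import Data.Fin using (Fin; toℕ)
open import Data.Fin.Subset using (Subset; _∈_; ∣_∣)
open import Data.List using (List; []; _∷_; [_]; _∷ʳ_; length)
import Data.List.Membership.Propositional as List
open import Data.List.Relation.Unary.Unique.Propositional using (Unique)
open import Data.Maybe using (Maybe; just; nothing)
open import Data.Nat using (ℕ; suc; _+_; _*_; _∸_; _≤_; _<_; _≡ᵇ_)
open import Data.Product using (_×_; ∃-syntax)
open import Data.Sum using (_⊎_)
open import Data.Unit using (⊤)
open import Function.Bundles using (_⇔_)
open import Function.Definitions using (Injective)
open import Relation.Binary.PropositionalEquality using (_≡_; _≢_)
open import Relation.Nullary using (¬_)

record Graph (n : ℕ) : Set where
  field
    adj    : Fin n → Fin n → Bool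
    sym    : ∀ u v → adj u v ≡ adj v u
    irrefl : ∀ v → adj v v ≡ false

open Graph public using (adj)

Adj : ∀ {n} → Graph n → Fin n → Fin n → Set
Adj G u v = adj G u v ≡ true

IsClique : ∀ {n} → Graph n → Subset n → Set
IsClique G C = ∀ u v → u ∈ C → v ∈ C → u ≢ v → Adj G u v

IsEdgeCliqueCover : ∀ {n s} → Graph n → (Fin s → Subset n) → Set
IsEdgeCliqueCover G C =
  (∀ i → IsClique G (C i)) ×
  (∀ u v → Adj G u v → ∃[ i ] (u ∈ C i × v ∈ C i))

HasEdgeCliqueCover : ∀ {n} → Graph n → ℕ → Set
HasEdgeCliqueCover {n} G k =
  ∃[ s ] ∃[ C ] (s ≤ k × IsEdgeCliqueCover {n} {s} G C)

-- Inserted G u v G′ : the edge uv is absent from G, and G′ = G + uv.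
-- (u ≢ v is forced by irreflexivity of G′.)
record Inserted {n} (G : Graph n) (u v : Fin n) (G′ : Graph n) : Set where
  field
    absent  : adj G u v ≡ false
    present : adj G′ u v ≡ true
    others  : ∀ x y → ¬ ((x ≡ u × y ≡ v) ⊎ (x ≡ v × y ≡ u)) →
              adj G′ x y ≡ adj G x y

Deleted : ∀ {n} → Graph n → Fin n → Fin n → Graph n → Set
Deleted G u v G′ = Inserted G′ u v G

-- A word RAM.  Words are the naturals below W.  Memory consists of registers and arrays,
-- both named by numerals occurring in the program text, so that a program has
-- access to a fixed number of registers and a fixed number of arrays.
-- Programs are structured; every expression node and every command executed
-- costs one unit of time.  A program that produces a number ≥ W is stuck.

record State : Set where
  constructor state
  field
    reg : ℕ → ℕ
    arr : ℕ → ℕ → ℕ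
    out : List ℕ

open State public

infix 9 _[_↦_]

_[_↦_] : {A : Set} → (ℕ → A) → ℕ → A → ℕ → A
(f [ i ↦ a ]) j = if i ≡ᵇ j then a else f j

infixl 6 _⊕_ _⊖_
infixl 7 _⊗_

data Expr : Set where
  lit         : ℕ → Expr
  var         : ℕ → Expr
  cell        : ℕ → Expr → Expr
  _⊕_ _⊖_ _⊗_ : Expr → Expr → Expr

⟦_⟧ : Expr → State → ℕ
⟦ lit c    ⟧ σ = c
⟦ var x    ⟧ σ = reg σ x
⟦ cell a e ⟧ σ = arr σ a (⟦ e ⟧ σ)
⟦ e ⊕ f    ⟧ σ = ⟦ e ⟧ σ + ⟦ f ⟧ σ
⟦ e ⊖ f    ⟧ σ = ⟦ e ⟧ σ ∸ ⟦ f ⟧ σ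
⟦ e ⊗ f    ⟧ σ = ⟦ e ⟧ σ * ⟦ f ⟧ σ

NoOverflow : ℕ → Expr → State → Set
NoOverflow W (lit c)    σ = c < W
NoOverflow W (var x)    σ = ⊤
NoOverflow W (cell a e) σ = NoOverflow W e σ
NoOverflow W (e ⊕ f)    σ = NoOverflow W e σ × NoOverflow W f σ × ⟦ e ⊕ f ⟧ σ < W
NoOverflow W (e ⊖ f)    σ = NoOverflow W e σ × NoOverflow W f σ
NoOverflow W (e ⊗ f)    σ = NoOverflow W e σ × NoOverflow W f σ × ⟦ e ⊗ f ⟧ σ < W

cost : Expr → ℕ
cost (lit c)    = 1
cost (var x)    = 1
cost (cell a e) = suc (cost e)
cost (e ⊕ f)    = suc (cost e + cost f)
cost (e ⊖ f)    = suc (cost e + cost f)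
cost (e ⊗ f)    = suc (cost e + cost f)

infix  5 _≔_ _⟨_⟩≔_
infixr 4 _⨾_

data Cmd : Set where
  skip   : Cmd
  _≔_    : ℕ → Expr → Cmd
  _⟨_⟩≔_ : ℕ → Expr → Expr → Cmd
  emit   : Expr → Cmd
  _⨾_    : Cmd → Cmd → Cmd
  ifnz   : Expr → Cmd → Cmd → Cmd
  while  : Expr → Cmd → Cmd

-- Exec W p σ σ′ t : started in σ, program p halts in σ′ after t time units.
-- Conditions hold when their value is non-zero.
data Exec (W : ℕ) : Cmd → State → State → ℕ → Set where
  skip : ∀ {σ} → Exec W skip σ σ 1
  assign : ∀ {x e σ} → NoOverflow W e σ →
    Exec W (x ≔ e) σ
      (record σ { reg = reg σ [ x ↦ ⟦ e ⟧ σ ] }) (suc (cost e))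
  store : ∀ {a e f σ} → NoOverflow W e σ → NoOverflow W f σ →
    Exec W (a ⟨ e ⟩≔ f) σ
      (record σ { arr = arr σ [ a ↦ arr σ a [ ⟦ e ⟧ σ ↦ ⟦ f ⟧ σ ] ] })
      (suc (cost e + cost f))
  emit : ∀ {e σ} → NoOverflow W e σ →
    Exec W (emit e) σ (record σ { out = out σ ∷ʳ ⟦ e ⟧ σ }) (suc (cost e))
  seq : ∀ {p q σ₁ σ₂ σ₃ s t} → Exec W p σ₁ σ₂ s → Exec W q σ₂ σ₃ t →
    Exec W (p ⨾ q) σ₁ σ₃ (s + t)
  if-nonzero : ∀ {e p q σ σ′ t} → NoOverflow W e σ → ⟦ e ⟧ σ ≢ 0 →
    Exec W p σ σ′ t → Exec W (ifnz e p q) σ σ′ (suc (cost e + t))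
  if-zero : ∀ {e p q σ σ′ t} → NoOverflow W e σ → ⟦ e ⟧ σ ≡ 0 →
    Exec W q σ σ′ t → Exec W (ifnz e p q) σ σ′ (suc (cost e + t))
  while-stop : ∀ {e p σ} → NoOverflow W e σ → ⟦ e ⟧ σ ≡ 0 →
    Exec W (while e p) σ σ (suc (cost e))
  while-step : ∀ {e p σ₁ σ₂ σ₃ s t} → NoOverflow W e σ₁ → ⟦ e ⟧ σ₁ ≢ 0 →
    Exec W p σ₁ σ₂ s → Exec W (while e p) σ₂ σ₃ t →
    Exec W (while e p) σ₁ σ₃ (suc (cost e + (s + t)))

Terminates : ℕ → Cmd → State → (State → ℕ → Set) → Set
Terminates W p σ Q = ∃[ σ′ ] ∃[ t ] (Exec W p σ σ′ t × Q σ′ t)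

-- Arguments are passed in registers 0 and 1; each call starts with no output
-- and otherwise keeps the memory left behind by the previous one.
call₁ : ℕ → State → State
call₁ x σ = record σ { reg = reg σ [ 0 ↦ x ] ; out = [] }

call₂ : ℕ → ℕ → State → State
call₂ x y σ = record σ { reg = reg σ [ 0 ↦ x ] [ 1 ↦ y ] ; out = [] }

blank : State
blank = state (λ _ → 0) (λ _ _ → 0) []

-- As the run of a program does not depend on W unless it gets stuck, the
-- word bound may be chosen after the argument.
Computable : (ℕ → ℕ) → Set
Computable f = ∃[ p ] ∀ x → ∃[ W ]
  Terminates W p (call₁ x blank) λ σ _ → out σ ≡ [ f x ]

record Algorithm : Set where
  field
    initialise  : Cmd
    insertEdge  : Cmd
    deleteEdge  : Cmd
    listClique  : Cmd
    listCliques : Cmd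

bit : Bool → ℕ
bit b = if b then 1 else 0

-- The memory before initialisation: n and k in registers 0 and 1, the
-- adjacency matrix of G row by row in array 0, zero everywhere else.
record IsInput {n} (G : Graph n) (k : ℕ) (σ : State) : Set where
  field
    vertices    : reg σ 0 ≡ n
    parameter   : reg σ 1 ≡ k
    matrix      : ∀ u v → arr σ 0 (toℕ u * n + toℕ v) ≡ bit (adj G u v)
    zero-reg    : ∀ x → 2 ≤ x → reg σ x ≡ 0
    zero-matrix : ∀ i → n * n ≤ i → arr σ 0 i ≡ 0
    zero-arr    : ∀ a i → 1 ≤ a → arr σ a i ≡ 0
    no-output   : out σ ≡ []

record NamedFamily (n : ℕ) : Set where
  field
    size   : ℕ
    clique : Fin size → Subset n
    name   : Fin size → ℕ

open NamedFamily public

-- What is maintained is either a cover of size at most k or the information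
-- that there is none.
Correct : ∀ {n} → ℕ → ℕ → Graph n → Maybe (NamedFamily n) → Set
Correct W k G nothing  = ¬ HasEdgeCliqueCover G k
Correct W k G (just 𝒞) =
  size 𝒞 ≤ k × IsEdgeCliqueCover G (clique 𝒞) ×
  Injective _≡_ _≡_ (name 𝒞) × (∀ i → name 𝒞 i < W)

report : ∀ {n} → Maybe (NamedFamily n) → List ℕ
report nothing  = [ 0 ]
report (just _) = [ 1 ]

Enumerates : List ℕ → (ℕ → Set) → Set
Enumerates xs P = Unique xs × (∀ x → (x List.∈ xs) ⇔ P x)

-- Started on the input (G₀ , k) in σ₀, the algorithm correctly serves every
-- sequence of updates and queries for which all graphs have an edge clique
-- cover of size at most s.  Updates take time at most T, queries time at most
-- c · (1 + output size).
--
-- Serves G 𝒞 σ says that in memory state σ all future operations are handled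
-- correctly, the current graph being G and the current answer 𝒞.  This is a
-- coinductive predicate, given here by its closure properties: the largest
-- relation with the fields below is the coinductive one.  Queries leave 𝒞
-- unchanged, so all queries between two updates refer to the same cover.
record Maintains (A : Algorithm) (W k s T c : ℕ) {n : ℕ}
                 (G₀ : Graph n) (σ₀ : State) : Set₁ where
  open Algorithm A
  field
    Serves : Graph n → Maybe (NamedFamily n) → State → Set

    correct : ∀ {G 𝒞 σ} → Serves G 𝒞 σ → Correct W k G 𝒞

    on-initialise :
      Terminates W initialise σ₀ λ σ _ →
        ∃[ 𝒞 ] (out σ ≡ report 𝒞 × Serves G₀ 𝒞 σ)

    on-insert : ∀ {G 𝒞 σ} → Serves G 𝒞 σ →
      ∀ u v G′ → Inserted G u v G′ → HasEdgeCliqueCover G′ s →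
      Terminates W insertEdge (call₂ (toℕ u) (toℕ v) σ) λ σ′ t →
        t ≤ T × ∃[ 𝒞′ ] (out σ′ ≡ report 𝒞′ × Serves G′ 𝒞′ σ′)

    on-delete : ∀ {G 𝒞 σ} → Serves G 𝒞 σ →
      ∀ u v G′ → Deleted G u v G′ → HasEdgeCliqueCover G′ s →
      Terminates W deleteEdge (call₂ (toℕ u) (toℕ v) σ) λ σ′ t →
        t ≤ T × ∃[ 𝒞′ ] (out σ′ ≡ report 𝒞′ × Serves G′ 𝒞′ σ′)

    on-listClique : ∀ {G 𝒞 σ} → Serves G (just 𝒞) σ → ∀ i →
      Terminates W listClique (call₁ (name 𝒞 i) σ) λ σ′ t →
        t ≤ c * suc ∣ clique 𝒞 i ∣ ×
        Enumerates (out σ′) (λ x → ∃[ v ] (v ∈ clique 𝒞 i × x ≡ toℕ v)) ×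
        Serves G (just 𝒞) σ′

    on-listCliques : ∀ {G 𝒞 σ} → Serves G (just 𝒞) σ → ∀ v →
      Terminates W listCliques (call₁ (toℕ v) σ) λ σ′ t →
        t ≤ c * suc (length (out σ′)) ×
        Enumerates (out σ′) (λ x → ∃[ i ] (v ∈ clique 𝒞 i × x ≡ name 𝒞 i)) ×
        Serves G (just 𝒞) σ′

{-# OPTIONS --safe #-}
module Submission where

-- Let B be the adjacency matrix of the graph, with diagonal entry 1 at the vertices that have a neighbour.  Up to
-- isolated vertices, the edge clique covers are the families C with B = ⋃ C i × C i.  Hence vertices lying in the
-- same cliques have equal rows in B, and if there is a cover of size s then B has at most 2 ^ s different rows.
-- Inserting or deleting the edge uv changes the rows of u and v only, so all other vertices keep their class of
-- vertices with the same row.  Since B is symmetric, comparing the rows of u and v with those of the class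
-- representatives can be restricted to the columns of the representatives and of u and v.  A cover of the graph
-- induces one of the same size on the representatives and conversely, so a cover of least size is found by
-- trying all 0-1 tables of cliques against classes, for K = 0 , 1 , 2 , … cliques; the promise stops this at K ≤ s.
-- A clique is stored as its list of non-empty classes, and is thus listed in time linear in its size.

open import Defs
open import Data.Bool using (Bool; true; false; T; not; _∧_; _∨_)
open import Data.Bool.Properties using (T-∧; T-not-≡)
open import Data.Empty using (⊥-elim)
open import Data.Fin using (Fin; zero; suc; toℕ; fromℕ<; funToFin; finToFun)
import Data.Fin.Properties as Fin
open import Data.Fin.Subset using (Subset; _∈_; ∣_∣; _-_)
open import Data.Fin.Subset.Properties using (_∈?_; x∈p⇒∣p-x∣<∣p∣; x∈p∧x≢y⇒x∈p-y)
open import Data.List using (List; []; _∷_; [_]; _∷ʳ_; length)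
import Data.List.Membership.Propositional as List
open import Data.List.Membership.Propositional.Properties using (∈-++⁺ˡ; ∈-++⁺ʳ; ∈-++⁻)
open import Data.List.Properties using (length-++)
import Data.List.Relation.Unary.All as All
open import Data.List.Relation.Unary.AllPairs using ([]; _∷_)
open import Data.List.Relation.Unary.Any using (here; there)
open import Data.List.Relation.Unary.Unique.Propositional using (Unique)
import Data.List.Relation.Unary.Unique.Propositional.Properties as Unique
open import Data.Maybe using (Maybe; just; nothing)
open import Data.Nat using (ℕ; zero; suc; _+_; _*_; _∸_; _^_; _⊓_; _/_; _%_; _≤_; _<_; _≤ᵇ_; _≡ᵇ_; z≤n; s≤s; s≤s⁻¹; NonZero; >-nonZero)
open import Data.Nat.DivMod using (m≡m%n+[m/n]*n; m%n<n; m<n*o⇒m/o<n)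
open import Data.Nat.Properties
open import Data.Nat.Solver using (module +-*-Solver)
open import Data.Product using (Σ; ∃-syntax; _×_; _,_; proj₁; proj₂)
open import Data.Sum using (_⊎_; inj₁; inj₂)
open import Data.Unit using (tt)
open import Data.Vec using (tabulate)
open import Data.Vec.Properties using (lookup∘tabulate; lookup⇒[]=; []=⇒lookup)
open import Function using (_∘_; _$_)
open import Function.Bundles using (mk⇔; Equivalence)
open import Relation.Binary using (tri<; tri≈; tri>)
open import Relation.Binary.PropositionalEquality using (_≡_; _≢_; refl; sym; trans; cong; cong₂; subst; subst₂; ≢-sym)
open import Relation.Nullary using (¬_; yes; no; contradiction)
open import Relation.Nullary.Decidable using (_×-dec_; ¬?; decidable-stable)

open +-*-Solver using (solve; con; _:+_; _:*_; _:=_)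

-- Writing to memory

-- Running times are not counted command by command. All loops of an update make at most Z = 2 ^ (2
-- ^ (s + s)) iterations, so an update takes at most Z ^ e steps, where e is computed from the
-- program text; a fixed power of Z is still doubly exponential in O(s). Only the queries, whose
-- time must be linear, are counted exactly. Overflow is settled once as well: stored numbers are
-- bounded by a polynomial in n and k, and expressions are small.
--
-- The diagonal is what gives adjacent vertices of the same cliques equal rows. As an update spoils
-- the rows of u and v, both leave the partition before the matrix is touched and return when it is
-- finished. An emptied class keeps its number and is used again; a new number is issued only when
-- all classes are occupied, and then the vertex to be placed and the representatives have different
-- rows in the current matrix. So the count of class numbers is bounded by the number of different
-- rows of some promised graph, whatever the history.

update-same : ∀ {A : Set} (f : ℕ → A) i a → (f [ i ↦ a ]) i ≡ a
update-same f i a with i ≡ᵇ i in eq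
... | true  = refl
... | false = ⊥-elim (subst T eq (≡⇒≡ᵇ i i refl))

update-other : ∀ {A : Set} (f : ℕ → A) {i j} a → i ≢ j → (f [ i ↦ a ]) j ≡ f j
update-other f {i} {j} a i≢j with i ≡ᵇ j in eq
... | true  = ⊥-elim (i≢j (≡ᵇ⇒≡ i j (subst T (sym eq) tt)))
... | false = refl

update-skip : ∀ {A : Set} (f : ℕ → A) i j a → (i ≡ᵇ j) ≡ false → (f [ i ↦ a ]) j ≡ f j
update-skip f i j a eq rewrite eq = refl

setReg : State → ℕ → ℕ → State
setReg σ x v = record σ { reg = reg σ [ x ↦ v ] }

setCell : State → ℕ → ℕ → ℕ → State
setCell σ a i v = record σ { arr = arr σ [ a ↦ arr σ a [ i ↦ v ] ] }

-- Which memory a command may change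

∨-falseˡ : ∀ {x y} → x ∨ y ≡ false → x ≡ false
∨-falseˡ {false} _ = refl

∨-falseʳ : ∀ {x y} → x ∨ y ≡ false → y ≡ false
∨-falseʳ {false} eq = eq

writesReg : Cmd → ℕ → Bool
writesReg skip         y = false
writesReg (x ≔ e)      y = x ≡ᵇ y
writesReg (a ⟨ e ⟩≔ f) y = false
writesReg (emit e)     y = false
writesReg (p ⨾ q)      y = writesReg p y ∨ writesReg q y
writesReg (ifnz e p q) y = writesReg p y ∨ writesReg q y
writesReg (while e p)  y = writesReg p y

writesArr : Cmd → ℕ → Bool
writesArr skip         b = false
writesArr (x ≔ e)      b = false
writesArr (a ⟨ e ⟩≔ f) b = a ≡ᵇ b
writesArr (emit e)     b = false
writesArr (p ⨾ q)      b = writesArr p b ∨ writesArr q b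
writesArr (ifnz e p q) b = writesArr p b ∨ writesArr q b
writesArr (while e p)  b = writesArr p b

emits : Cmd → Bool
emits skip         = false
emits (x ≔ e)      = false
emits (a ⟨ e ⟩≔ f) = false
emits (emit e)     = true
emits (p ⨾ q)      = emits p ∨ emits q
emits (ifnz e p q) = emits p ∨ emits q
emits (while e p)  = emits p

-- The side conditions are syntactic and Boolean: for a concrete program they compute, so that each
-- later use is discharged by `refl`.
record Frame (p : Cmd) (σ σ′ : State) : Set where
  field
    reg-eq : ∀ x → writesReg p x ≡ false → reg σ′ x ≡ reg σ x
    arr-eq : ∀ a → writesArr p a ≡ false → arr σ′ a ≡ arr σ a
    out-eq : emits p ≡ false → out σ′ ≡ out σ

open Frame

frame-refl : ∀ {p σ} → Frame p σ σ
frame-refl = record { reg-eq = λ _ _ → refl ; arr-eq = λ _ _ → refl ; out-eq = λ _ → refl }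

frame-trans : ∀ {p σ₁ σ₂ σ₃} → Frame p σ₁ σ₂ → Frame p σ₂ σ₃ → Frame p σ₁ σ₃
frame-trans f g = record
  { reg-eq = λ x h → trans (reg-eq g x h) (reg-eq f x h)
  ; arr-eq = λ a h → trans (arr-eq g a h) (arr-eq f a h)
  ; out-eq = λ h → trans (out-eq g h) (out-eq f h)
  }

frame-seqˡ : ∀ {p q σ σ′} → Frame p σ σ′ → Frame (p ⨾ q) σ σ′
frame-seqˡ f = record
  { reg-eq = λ x h → reg-eq f x (∨-falseˡ h)
  ; arr-eq = λ a h → arr-eq f a (∨-falseˡ h)
  ; out-eq = λ h → out-eq f (∨-falseˡ h)
  }

frame-seqʳ : ∀ {p q σ σ′} → Frame q σ σ′ → Frame (p ⨾ q) σ σ′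
frame-seqʳ {p} f = record
  { reg-eq = λ x h → reg-eq f x (∨-falseʳ {writesReg p x} h)
  ; arr-eq = λ a h → arr-eq f a (∨-falseʳ {writesArr p a} h)
  ; out-eq = λ h → out-eq f (∨-falseʳ {emits p} h)
  }

frame-if : ∀ {e p q σ σ′} → Frame (p ⨾ q) σ σ′ → Frame (ifnz e p q) σ σ′
frame-if f = record { reg-eq = reg-eq f ; arr-eq = arr-eq f ; out-eq = out-eq f }

frame-while : ∀ {e p σ σ′} → Frame p σ σ′ → Frame (while e p) σ σ′
frame-while f = record { reg-eq = reg-eq f ; arr-eq = arr-eq f ; out-eq = out-eq f }

exec-frame : ∀ {W p σ σ′ t} → Exec W p σ σ′ t → Frame p σ σ′
exec-frame skip = frame-refl
exec-frame (assign {x} {e} {σ} _) = record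
  { reg-eq = λ y → update-skip (reg σ) x y (⟦ e ⟧ σ) ; arr-eq = λ _ _ → refl ; out-eq = λ _ → refl }
exec-frame (store {a} {e} {f} {σ} _ _) = record
  { reg-eq = λ _ _ → refl ; arr-eq = λ b → update-skip (arr σ) a b _ ; out-eq = λ _ → refl }
exec-frame (emit _) = record
  { reg-eq = λ _ _ → refl ; arr-eq = λ _ _ → refl ; out-eq = λ () }
exec-frame (seq {p} d d′) = frame-trans (frame-seqˡ (exec-frame d)) (frame-seqʳ {p} (exec-frame d′))
exec-frame (if-nonzero _ _ d) = frame-if (frame-seqˡ (exec-frame d))
exec-frame (if-zero {p = p} _ _ d) = frame-if (frame-seqʳ {p} (exec-frame d))
exec-frame (while-stop _ _) = frame-refl
exec-frame (while-step _ _ d d′) = frame-trans (frame-while (exec-frame d)) (exec-frame d′)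

stable : Cmd → Expr → Bool
stable p (lit c)    = true
stable p (var x)    = not (writesReg p x)
stable p (cell a e) = not (writesArr p a) ∧ stable p e
stable p (e ⊕ f)    = stable p e ∧ stable p f
stable p (e ⊖ f)    = stable p e ∧ stable p f
stable p (e ⊗ f)    = stable p e ∧ stable p f

∧-left : ∀ {x y} → T (x ∧ y) → T x
∧-left = proj₁ ∘ Equivalence.to T-∧

∧-right : ∀ {x y} → T (x ∧ y) → T y
∧-right {x} = proj₂ ∘ Equivalence.to (T-∧ {x})

not-T : ∀ {x} → T (not x) → x ≡ false
not-T = Equivalence.to T-not-≡

stable-eval : ∀ {p σ σ′} → Frame p σ σ′ → ∀ e → T (stable p e) → ⟦ e ⟧ σ′ ≡ ⟦ e ⟧ σ
stable-eval fr (lit c) s = refl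
stable-eval fr (var x) s = reg-eq fr x (not-T s)
stable-eval {p} fr (cell a e) s
  rewrite arr-eq fr a (not-T (∧-left s)) | stable-eval fr e (∧-right {not (writesArr p a)} s) = refl
stable-eval {p} fr (e ⊕ f) s = cong₂ _+_ (stable-eval fr e (∧-left s)) (stable-eval fr f (∧-right {stable p e} s))
stable-eval {p} fr (e ⊖ f) s = cong₂ _∸_ (stable-eval fr e (∧-left s)) (stable-eval fr f (∧-right {stable p e} s))
stable-eval {p} fr (e ⊗ f) s = cong₂ _*_ (stable-eval fr e (∧-left s)) (stable-eval fr f (∧-right {stable p e} s))

-- Absence of overflow

Bounded : ℕ → State → Set
Bounded P σ = (∀ x → reg σ x ≤ P) × (∀ a i → arr σ a i ≤ P)

literals≤2 : Expr → Bool
literals≤2 (lit c)    = c ≤ᵇ 2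
literals≤2 (var x)    = true
literals≤2 (cell a e) = literals≤2 e
literals≤2 (e ⊕ f)    = literals≤2 e ∧ literals≤2 f
literals≤2 (e ⊖ f)    = literals≤2 e ∧ literals≤2 f
literals≤2 (e ⊗ f)    = literals≤2 e ∧ literals≤2 f

-- If P ≥ 2 bounds all stored numbers and literals are at most 2, then the value of an expression is
-- at most P to the power of its cost. Capping the cost at 16 thus fixes one power of P that words
-- have to exceed.
admissible : Expr → Bool
admissible e = literals≤2 e ∧ (cost e ≤ᵇ 16)

-- The value is at most a stored number or a literal, so it may be stored again without exceeding P.
-- Sums and products need a bound of their own before they are stored.
atomic : Expr → Bool
atomic (lit c)    = true
atomic (var x)    = true
atomic (cell a e) = true
atomic (e ⊕ f)    = false
atomic (e ⊖ f)    = atomic e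
atomic (e ⊗ f)    = false

a<2^a : ∀ a → a < 2 ^ a
a<2^a zero = s≤s z≤n
a<2^a (suc a) = begin
  1 + suc a         ≤⟨ +-mono-≤ (m^n>0 2 a) (a<2^a a) ⟩
  2 ^ a + 2 ^ a     ≡⟨ cong (2 ^ a +_) (sym (+-identityʳ (2 ^ a))) ⟩
  2 ^ suc a         ∎
  where open ≤-Reasoning

a≤2^a : ∀ a → a ≤ 2 ^ a
a≤2^a a = <⇒≤ (a<2^a a)

module Powers (Z : ℕ) (2≤Z : 2 ≤ Z) where

  instance
    nonZero : NonZero Z
    nonZero = >-nonZero (≤-trans (s≤s z≤n) 2≤Z)

  a≤Z^a : ∀ a → a ≤ Z ^ a
  a≤Z^a a = ≤-trans (a≤2^a a) (^-monoˡ-≤ a 2≤Z)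

  sum≤power : ∀ {x y} a b → x ≤ Z ^ a → y ≤ Z ^ b → x + y ≤ Z ^ suc (a + b)
  sum≤power {x} {y} a b x≤ y≤ = begin
    x + y                     ≤⟨ +-mono-≤ (≤-trans x≤ (^-monoʳ-≤ Z (m≤m+n a b))) (≤-trans y≤ (^-monoʳ-≤ Z (m≤n+m b a))) ⟩
    Z ^ (a + b) + Z ^ (a + b) ≡⟨ cong (Z ^ (a + b) +_) (sym (+-identityʳ _)) ⟩
    2 * Z ^ (a + b)           ≤⟨ *-monoˡ-≤ (Z ^ (a + b)) 2≤Z ⟩
    Z ^ suc (a + b)           ∎
    where open ≤-Reasoning

  product≤power : ∀ {x y} a b → x ≤ Z ^ a → y ≤ Z ^ b → x * y ≤ Z ^ (a + b)
  product≤power {x} {y} a b x≤ y≤ = begin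
    x * y         ≤⟨ *-mono-≤ x≤ y≤ ⟩
    Z ^ a * Z ^ b ≡⟨ sym (^-distribˡ-+-* Z a b) ⟩
    Z ^ (a + b)   ∎
    where open ≤-Reasoning

-- No number stored exceeds P, so that a small expression has a value of at most P ^ 16, which is a word.

module Run (W P : ℕ) (2≤P : 2 ≤ P) (P^16<W : P ^ 16 < W) where

  open Powers P 2≤P

  value≤power : ∀ {σ} → Bounded P σ → ∀ e → T (literals≤2 e) → ⟦ e ⟧ σ ≤ P ^ cost e
  value≤power (r , m) (lit c) l = ≤-trans (≤-trans (≤ᵇ⇒≤ c 2 l) 2≤P) (≤-reflexive (sym (*-identityʳ P)))
  value≤power (r , m) (var x) l = ≤-trans (r x) (≤-reflexive (sym (*-identityʳ P)))
  value≤power {σ} (r , m) (cell a e) l = ≤-trans (m a (⟦ e ⟧ σ)) (m≤m*n P (P ^ cost e) {{m^n≢0 P (cost e)}})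
  value≤power bd (e ⊕ f) l =
    sum≤power (cost e) (cost f) (value≤power bd e (∧-left l)) (value≤power bd f (∧-right {literals≤2 e} l))
  value≤power {σ} bd (e ⊖ f) l = ≤-trans (m∸n≤m (⟦ e ⟧ σ) (⟦ f ⟧ σ))
    (≤-trans (value≤power bd e (∧-left l)) (^-monoʳ-≤ P (≤-trans (m≤m+n (cost e) (cost f)) (n≤1+n (cost e + cost f)))))
  value≤power bd (e ⊗ f) l = ≤-trans
    (product≤power (cost e) (cost f) (value≤power bd e (∧-left l)) (value≤power bd f (∧-right {literals≤2 e} l)))
    (^-monoʳ-≤ P (n≤1+n (cost e + cost f)))

  no-overflow′ : ∀ {σ} → Bounded P σ → ∀ e → T (literals≤2 e) → cost e ≤ 16 → NoOverflow W e σ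
  value<W : ∀ {σ} → Bounded P σ → ∀ e → T (literals≤2 e) → cost e ≤ 16 → ⟦ e ⟧ σ < W

  value<W bd e l c≤ = ≤-<-trans (≤-trans (value≤power bd e l) (^-monoʳ-≤ P {cost e} {16} c≤)) P^16<W

  no-overflow′ {σ} bd (lit c) l c≤ = value<W {σ} bd (lit c) l c≤
  no-overflow′ bd (var x) l c≤ = tt
  no-overflow′ bd (cell a e) l c≤ = no-overflow′ bd e l (≤-trans (n≤1+n (cost e)) c≤)
  no-overflow′ bd (e ⊕ f) l c≤ =
    no-overflow′ bd e (∧-left l) (≤-trans (m≤m+n _ _) (≤-trans (n≤1+n _) c≤)) ,
    no-overflow′ bd f (∧-right {literals≤2 e} l) (≤-trans (m≤n+m _ (cost e)) (≤-trans (n≤1+n _) c≤)) ,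
    value<W bd (e ⊕ f) l c≤
  no-overflow′ bd (e ⊖ f) l c≤ =
    no-overflow′ bd e (∧-left l) (≤-trans (m≤m+n _ _) (≤-trans (n≤1+n _) c≤)) ,
    no-overflow′ bd f (∧-right {literals≤2 e} l) (≤-trans (m≤n+m _ (cost e)) (≤-trans (n≤1+n _) c≤))
  no-overflow′ bd (e ⊗ f) l c≤ =
    no-overflow′ bd e (∧-left l) (≤-trans (m≤m+n _ _) (≤-trans (n≤1+n _) c≤)) ,
    no-overflow′ bd f (∧-right {literals≤2 e} l) (≤-trans (m≤n+m _ (cost e)) (≤-trans (n≤1+n _) c≤)) ,
    value<W bd (e ⊗ f) l c≤

  no-overflow : ∀ {σ} → Bounded P σ → ∀ e → T (admissible e) → NoOverflow W e σ
  no-overflow bd e h = no-overflow′ bd e (∧-left h) (≤ᵇ⇒≤ (cost e) 16 (∧-right {literals≤2 e} h))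

  atomic≤P : ∀ {σ} → Bounded P σ → ∀ e → T (admissible e) → T (atomic e) → ⟦ e ⟧ σ ≤ P
  atomic≤P bd e h = go e (∧-left h)
    where
    go : ∀ e → T (literals≤2 e) → T (atomic e) → ⟦ e ⟧ _ ≤ P
    go (lit c) l a = ≤-trans (≤ᵇ⇒≤ c 2 l) 2≤P
    go (var x) l a = proj₁ bd x
    go (cell b e) l a = proj₂ bd b _
    go (e ⊖ f) l a = ≤-trans (m∸n≤m _ (⟦ f ⟧ _)) (go e (∧-left l) a)

  bounded-setReg : ∀ {σ x v} → v ≤ P → Bounded P σ → Bounded P (setReg σ x v)
  bounded-setReg {σ} {x} {v} v≤ (r , m) = go , m
    where
    go : ∀ y → (reg σ [ x ↦ v ]) y ≤ P
    go y with x ≡ᵇ y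
    ... | true  = v≤
    ... | false = r y

  bounded-setCell : ∀ {σ a i v} → v ≤ P → Bounded P σ → Bounded P (setCell σ a i v)
  bounded-setCell {σ} {a} {i} {v} v≤ (r , m) = r , go
    where
    go : ∀ b j → (arr σ [ a ↦ arr σ a [ i ↦ v ] ]) b j ≤ P
    go b j with a ≡ᵇ b
    ... | false = m b j
    ... | true with i ≡ᵇ j
    ...   | true  = v≤
    ...   | false = m a j

  -- A Hoare triple for total correctness whose postcondition also sees the time. The bound on the
  -- memory is threaded through here, so that specifications need not mention overflow.
  Run : Cmd → State → (State → ℕ → Set) → Set
  Run p σ Q = Bounded P σ → ∃[ σ′ ] ∃[ t ] (Exec W p σ σ′ t × Bounded P σ′ × Q σ′ t)

  run-weaken : ∀ {p σ Q R} → (∀ {σ′ t} → Frame p σ σ′ → Q σ′ t → R σ′ t) → Run p σ Q → Run p σ R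
  run-weaken f r bd with r bd
  ... | σ′ , t , ex , bd′ , q = σ′ , t , ex , bd′ , f (exec-frame ex) q

  run-bounded : ∀ {p σ Q} → (Bounded P σ → Run p σ Q) → Run p σ Q
  run-bounded f bd = f bd bd

  run-skip : ∀ {σ Q} → Q σ 1 → Run skip σ Q
  run-skip q bd = _ , _ , skip , bd , q

  run-assign≤ : ∀ {x e σ Q} {h : T (admissible e)} → ⟦ e ⟧ σ ≤ P →
    Q (setReg σ x (⟦ e ⟧ σ)) (suc (cost e)) → Run (x ≔ e) σ Q
  run-assign≤ {x} {e} {σ} {h = h} v≤ q bd = _ , _ , assign (no-overflow bd e h) , bounded-setReg {σ} {x} v≤ bd , q

  run-assign : ∀ {x e σ Q} {h : T (admissible e)} {a : T (atomic e)} →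
    Q (setReg σ x (⟦ e ⟧ σ)) (suc (cost e)) → Run (x ≔ e) σ Q
  run-assign {x} {e} {h = h} {a = a} q bd = run-assign≤ {x} {e} {_} {_} {h} (atomic≤P bd e h a) q bd

  run-store≤ : ∀ {a e f σ Q} {h : T (admissible e)} {h′ : T (admissible f)} → ⟦ f ⟧ σ ≤ P →
    Q (setCell σ a (⟦ e ⟧ σ) (⟦ f ⟧ σ)) (suc (cost e + cost f)) → Run (a ⟨ e ⟩≔ f) σ Q
  run-store≤ {a} {e} {f} {σ} {h = h} {h′ = h′} v≤ q bd =
    _ , _ , store (no-overflow bd e h) (no-overflow bd f h′) , bounded-setCell {σ} {a} {⟦ e ⟧ σ} v≤ bd , q

  run-store : ∀ {a e f σ Q} {h : T (admissible e)} {h′ : T (admissible f)} {i : T (atomic f)} →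
    Q (setCell σ a (⟦ e ⟧ σ) (⟦ f ⟧ σ)) (suc (cost e + cost f)) → Run (a ⟨ e ⟩≔ f) σ Q
  run-store {a} {e} {f} {h = h} {h′ = h′} {i = i} q bd =
    run-store≤ {a} {e} {f} {_} {_} {h} {h′} (atomic≤P bd f h′ i) q bd

  run-emit : ∀ {e σ Q} {h : T (admissible e)} →
    Q (record σ { out = out σ ∷ʳ ⟦ e ⟧ σ }) (suc (cost e)) → Run (emit e) σ Q
  run-emit {e} {h = h} q bd = _ , _ , emit (no-overflow bd e h) , bd , q

  run-seq : ∀ {p q σ Q} → Run p σ (λ σ′ s → Run q σ′ (λ σ″ t → Q σ″ (s + t))) → Run (p ⨾ q) σ Q
  run-seq r bd with r bd
  ... | σ′ , s , ex , bd′ , r′ with r′ bd′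
  ...   | σ″ , t , ex′ , bd″ , q = σ″ , s + t , seq ex ex′ , bd″ , q

  run-if : ∀ {e p q σ Q} {h : T (admissible e)} →
    (⟦ e ⟧ σ ≢ 0 → Run p σ (λ σ′ t → Q σ′ (suc (cost e + t)))) →
    (⟦ e ⟧ σ ≡ 0 → Run q σ (λ σ′ t → Q σ′ (suc (cost e + t)))) →
    Run (ifnz e p q) σ Q
  run-if {e} {σ = σ} {h = h} r₁ r₂ bd with ⟦ e ⟧ σ ≟ 0
  ... | no ≢0 with r₁ ≢0 bd
  ...   | σ′ , t , ex , bd′ , q = σ′ , _ , if-nonzero (no-overflow bd e h) ≢0 ex , bd′ , q
  run-if {e} {σ = σ} {h = h} r₁ r₂ bd | yes ≡0 with r₂ ≡0 bd
  ...   | σ′ , t , ex , bd′ , q = σ′ , _ , if-zero (no-overflow bd e h) ≡0 ex , bd′ , q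

  -- I m σ t : at most m iterations are left in σ, and t time units have passed.
  run-while : ∀ {e p σ₀} {_ : T (admissible e)} (I : ℕ → State → ℕ → Set) →
    (∀ {σ t} → I 0 σ t → ⟦ e ⟧ σ ≡ 0) →
    (∀ {m σ t} → Frame (while e p) σ₀ σ → I (suc m) σ t → ⟦ e ⟧ σ ≢ 0 →
      Run p σ (λ σ′ s → I m σ′ (t + suc (cost e + s)))) →
    ∀ m → I m σ₀ 0 →
    Run (while e p) σ₀ (λ σ s → ∃[ m′ ] ∃[ t ] (I m′ σ t × ⟦ e ⟧ σ ≡ 0 × s ≡ t + suc (cost e)))
  run-while {e} {p} {σ₀} {h} I stop step m i = go m 0 frame-refl i
    where
    go : ∀ m {σ} t → Frame (while e p) σ₀ σ → I m σ t →
      Run (while e p) σ (λ σ′ s → ∃[ m′ ] ∃[ t′ ] (I m′ σ′ t′ × ⟦ e ⟧ σ′ ≡ 0 × t + s ≡ t′ + suc (cost e)))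
    go m {σ} t fr i bd with ⟦ e ⟧ σ ≟ 0
    ... | yes ≡0 = σ , _ , while-stop (no-overflow bd e h) ≡0 , bd , m , t , i , ≡0 , refl
    go zero t fr i bd | no ≢0 = ⊥-elim (≢0 (stop i))
    go (suc m) t fr i bd | no ≢0 with step fr i ≢0 bd
    ... | σ′ , s , ex , bd′ , i′ with go m _ (frame-trans fr (frame-while (exec-frame ex))) i′ bd′
    ... | σ″ , s′ , ex′ , bd″ , m′ , t′ , i″ , ≡0 , eq =
      σ″ , _ , while-step (no-overflow bd e h) ≢0 ex ex′ , bd″ , m′ , t′ , i″ , ≡0 , trans assoc eq
      where
      assoc : t + suc (cost e + (s + s′)) ≡ t + suc (cost e + s) + s′
      assoc = solve 4 (λ t c s s′ → t :+ (con 1 :+ (c :+ (s :+ s′))) := t :+ (con 1 :+ (c :+ s)) :+ s′) refl t (cost e) s s′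

-- The bound is evaluated anew in each iteration, and truncated subtraction makes the guard zero
-- once the counter reaches it. Hence the rules for this loop demand that e be stable under it.
for : ℕ → Expr → Cmd → Cmd
for x e p = x ≔ lit 0 ⨾ while (e ⊖ var x) (p ⨾ x ≔ var x ⊕ lit 1)

-- The time of one iteration of a for-loop in addition to that of its body.
overhead : Expr → ℕ
overhead e = cost e + 7

module For (W P : ℕ) (2≤P : 2 ≤ P) (P^16<W : P ^ 16 < W) where

  open Run W P 2≤P P^16<W

  run-for : ∀ {x e p σ} (I : ℕ → State → ℕ → Set)
    {h₁ : T (admissible (e ⊖ var x))} {h₂ : T (admissible e)} {h₃ : T (atomic e)}
    {h₄ : T (stable (for x e p) e)} {h₅ : T (not (writesReg p x))} →
    I 0 (setReg σ x 0) 0 →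
    (∀ {i σ′ t} → i < ⟦ e ⟧ σ → Frame (for x e p) σ σ′ → reg σ′ x ≡ i → I i σ′ t →
      Run p σ′ (λ σ″ s → I (suc i) (setReg σ″ x (suc i)) (t + (overhead e + s)))) →
    Run (for x e p) σ (λ σ′ s → Frame (for x e p) σ σ′ × ∃[ t ] (I (⟦ e ⟧ σ) σ′ t × s ≤ t + overhead e))
  run-for {x} {e} {p} {σ} I {h₁} {h₂} {h₃} {h₄} {h₅} base step =
    run-bounded λ bd →
    run-seq (run-assign {x} {lit 0} (run-weaken
      (λ { _ (m , t , (i , i+m , (xi , inv) , fr) , ≡0 , refl) →
        fr , t , subst (λ i → I i _ t) (finished fr i+m xi ≡0) inv , shuffle t })
      (run-while {e ⊖ var x} {p ⨾ x ≔ var x ⊕ lit 1} {_} {h₁} J stop (body (atomic≤P bd e h₂ h₃)) N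
        (0 , refl , (update-same (reg σ) x 0 , base) , frame₀))))
    where
    N = ⟦ e ⟧ σ
    loop = while (e ⊖ var x) (p ⨾ x ≔ var x ⊕ lit 1)

    J : ℕ → State → ℕ → Set
    J m σ′ t = ∃[ i ] (i + m ≡ N × (reg σ′ x ≡ i × I i σ′ t) × Frame (for x e p) σ σ′)

    frame₀ : Frame (for x e p) σ (setReg σ x 0)
    frame₀ = frame-seqˡ {x ≔ lit 0} {loop} (record
      { reg-eq = λ y → update-skip (reg σ) x y 0 ; arr-eq = λ _ _ → refl ; out-eq = λ _ → refl })

    remaining : ∀ {i m σ′} → Frame (for x e p) σ σ′ → i + m ≡ N → reg σ′ x ≡ i → ⟦ e ⊖ var x ⟧ σ′ ≡ m
    remaining {i} {m} {σ′} fr i+m xi = trans (cong₂ _∸_ (trans (stable-eval fr e h₄) (sym i+m)) xi) (m+n∸m≡n i m)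

    stop : ∀ {σ′ t} → J 0 σ′ t → ⟦ e ⊖ var x ⟧ σ′ ≡ 0
    stop (i , i+0 , (xi , _) , fr) = remaining fr i+0 xi

    finished : ∀ {i m σ′} → Frame (for x e p) σ σ′ → i + m ≡ N → reg σ′ x ≡ i → ⟦ e ⊖ var x ⟧ σ′ ≡ 0 → i ≡ N
    finished {i} fr i+m xi ≡0 with trans (sym (remaining fr i+m xi)) ≡0
    ... | refl = trans (sym (+-identityʳ i)) i+m

    shuffle : ∀ t → 2 + (t + suc (cost (e ⊖ var x))) ≤ t + overhead e
    shuffle t = begin
      2 + (t + (2 + (cost e + 1))) ≡⟨ solve 2 (λ t c → con 2 :+ (t :+ (con 2 :+ (c :+ con 1))) := t :+ (c :+ con 5)) refl t (cost e) ⟩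
      t + (cost e + 5)             ≤⟨ +-monoʳ-≤ t (+-monoʳ-≤ (cost e) (≤ᵇ⇒≤ 5 7 tt)) ⟩
      t + overhead e               ∎
      where
      open ≤-Reasoning

    body : N ≤ P → ∀ {m σ′ t} → Frame loop (setReg σ x 0) σ′ → J (suc m) σ′ t →
      ⟦ e ⊖ var x ⟧ σ′ ≢ 0 → Run (p ⨾ x ≔ var x ⊕ lit 1) σ′ (λ σ″ s → J m σ″ (t + suc (cost (e ⊖ var x) + s)))
    body N≤P {m} {σ′} {t} _ (i , i+sm , (xi , inv) , fr) _ = run-bounded λ bd →
      run-seq (run-weaken next (step i<N fr xi inv))
      where
      i<N : i < N
      i<N = ≤-trans (m≤m+n (suc i) m) (≤-reflexive (trans (sym (+-suc i m)) i+sm))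

      time : ∀ s → t + suc (cost (e ⊖ var x) + (s + 4)) ≡ t + (overhead e + s)
      time s = solve 3 (λ t c s → t :+ (con 1 :+ ((con 1 :+ (c :+ con 1)) :+ (s :+ con 4))) := t :+ (c :+ con 7 :+ s)) refl t (cost e) s

      next : ∀ {σ″ s} → Frame p σ′ σ″ → I (suc i) (setReg σ″ x (suc i)) (t + (overhead e + s)) →
        Run (x ≔ var x ⊕ lit 1) σ″ (λ σ‴ s′ → J m σ‴ (t + suc (cost (e ⊖ var x) + (s + s′))))
      next {σ″} {s} fr′ inv′ = run-assign≤ {x} {var x ⊕ lit 1} (subst (_≤ P) (sym x+1) (≤-trans i<N N≤P))
        (suc i , trans (sym (+-suc i m)) i+sm ,
         (trans (update-same (reg σ″) x _) x+1 ,
          subst₂ (λ v t → I (suc i) (setReg σ″ x v) t) (sym x+1) (sym (time s)) inv′) ,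
         frame-trans fr (frame-seqʳ {x ≔ lit 0} {loop} (frame-while (frame-trans (frame-seqˡ fr′)
           (frame-seqʳ {p} {x ≔ var x ⊕ lit 1} (record
             { reg-eq = λ y → update-skip (reg σ″) x y (reg σ″ x + 1) ; arr-eq = λ _ _ → refl ; out-eq = λ _ → refl }))))))
        where
        x+1 : reg σ″ x + 1 ≡ suc i
        x+1 = trans (+-comm (reg σ″ x) 1) (cong suc (trans (reg-eq fr′ x (not-T h₅)) xi))

-- The clauses mirror estimates for powers of Z ≥ 2: a constant c is at most Z ^ c, a sum of two
-- powers adds one to the sum of the exponents, and a loop of at most Z iterations adds three.
exponent : Cmd → ℕ
exponent skip         = 1
exponent (x ≔ e)      = suc (cost e)
exponent (a ⟨ e ⟩≔ f) = suc (cost e + cost f)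
exponent (emit e)     = suc (cost e)
exponent (p ⨾ q)      = suc (exponent p + exponent q)
exponent (ifnz e p q) = suc (suc (cost e) + (exponent p + exponent q))
exponent (while e p)  = 3 + (suc (cost e) + exponent p)

-- The outcome of searching the numbers below N for one satisfying H, where r is
-- set to v i when i is found and keeps its value r₀ when there is none.
Searched : ℕ → (ℕ → Set) → (ℕ → ℕ) → ℕ → ℕ → Set
Searched N H v r r₀ = (∃[ i ] (i < N × H i × r ≡ v i)) ⊎ ((∀ i → i < N → ¬ H i) × r ≡ r₀)

-- A command p whose loops make at most Z iterations each takes time at most Z ^ exponent p.
module Poly (W P : ℕ) (2≤P : 2 ≤ P) (P^16<W : P ^ 16 < W) (Z : ℕ) (2≤Z : 2 ≤ Z) where

  open Run W P 2≤P P^16<W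
  open For W P 2≤P P^16<W
  open Powers Z 2≤Z

  Poly : Cmd → State → (State → Set) → Set
  Poly p σ Q = Run p σ (λ σ′ t → t ≤ Z ^ exponent p × Q σ′)

  poly-weaken : ∀ {p σ Q R} → (∀ {σ′} → Frame p σ σ′ → Q σ′ → R σ′) → Poly p σ Q → Poly p σ R
  poly-weaken f = run-weaken (λ { fr (t≤ , q) → t≤ , f fr q })

  poly-skip : ∀ {σ} {Q : State → Set} → Q σ → Poly skip σ Q
  poly-skip q = run-skip (a≤Z^a 1 , q)

  poly-assign≤ : ∀ {x e σ} {Q : State → Set} {h : T (admissible e)} → ⟦ e ⟧ σ ≤ P →
    Q (setReg σ x (⟦ e ⟧ σ)) → Poly (x ≔ e) σ Q
  poly-assign≤ {x} {e} {h = h} v≤ q = run-assign≤ {x} {e} {h = h} v≤ (a≤Z^a (suc (cost e)) , q)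

  poly-assign : ∀ {x e σ} {Q : State → Set} {h : T (admissible e)} {a : T (atomic e)} →
    Q (setReg σ x (⟦ e ⟧ σ)) → Poly (x ≔ e) σ Q
  poly-assign {x} {e} {h = h} {a = a} q = run-assign {x} {e} {h = h} {a = a} (a≤Z^a (suc (cost e)) , q)

  poly-store≤ : ∀ {a e f σ} {Q : State → Set} {h : T (admissible e)} {h′ : T (admissible f)} → ⟦ f ⟧ σ ≤ P →
    Q (setCell σ a (⟦ e ⟧ σ) (⟦ f ⟧ σ)) → Poly (a ⟨ e ⟩≔ f) σ Q
  poly-store≤ {a} {e} {f} {h = h} {h′ = h′} v≤ q =
    run-store≤ {a} {e} {f} {h = h} {h′ = h′} v≤ (a≤Z^a (suc (cost e + cost f)) , q)

  poly-store : ∀ {a e f σ} {Q : State → Set} {h : T (admissible e)} {h′ : T (admissible f)} {i : T (atomic f)} →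
    Q (setCell σ a (⟦ e ⟧ σ) (⟦ f ⟧ σ)) → Poly (a ⟨ e ⟩≔ f) σ Q
  poly-store {a} {e} {f} {h = h} {h′ = h′} {i = i} q =
    run-store {a} {e} {f} {h = h} {h′ = h′} {i = i} (a≤Z^a (suc (cost e + cost f)) , q)

  poly-emit : ∀ {e σ} {Q : State → Set} {h : T (admissible e)} →
    Q (record σ { out = out σ ∷ʳ ⟦ e ⟧ σ }) → Poly (emit e) σ Q
  poly-emit {e} {h = h} q = run-emit {e} {h = h} (a≤Z^a (suc (cost e)) , q)

  poly-seq : ∀ {p q σ} {Q : State → Set} → Poly p σ (λ σ′ → Poly q σ′ Q) → Poly (p ⨾ q) σ Q
  poly-seq {p} {q} {Q = Q} r = run-seq (run-weaken (λ { _ (s≤ , r′) →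
    run-weaken (λ { _ (t≤ , h) → sum≤power (exponent p) (exponent q) s≤ t≤ , h }) r′ }) r)

  poly-if : ∀ {e p q σ} {Q : State → Set} {h : T (admissible e)} →
    (⟦ e ⟧ σ ≢ 0 → Poly p σ Q) → (⟦ e ⟧ σ ≡ 0 → Poly q σ Q) → Poly (ifnz e p q) σ Q
  poly-if {e} {p} {q} {h = h} r₁ r₂ = run-if {e} {h = h}
    (λ ≢0 → run-weaken (λ { _ (t≤ , h) → bound (≤-trans t≤ (^-monoʳ-≤ Z (m≤m+n (exponent p) (exponent q)))) , h }) (r₁ ≢0))
    (λ ≡0 → run-weaken (λ { _ (t≤ , h) → bound (≤-trans t≤ (^-monoʳ-≤ Z (m≤n+m (exponent q) (exponent p)))) , h }) (r₂ ≡0))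
    where
    bound : ∀ {t} → t ≤ Z ^ (exponent p + exponent q) → suc (cost e + t) ≤ Z ^ suc (suc (cost e) + (exponent p + exponent q))
    bound = sum≤power (suc (cost e)) (exponent p + exponent q) (a≤Z^a (suc (cost e)))

  -- The last, failing test is charged as one more full iteration. There are then `suc m` ≤ Z ^ 2
  -- rounds, each of length at most Z ^ suc (a + b).
  loop≤power : ∀ m a b → m ≤ Z → m * (a + Z ^ b) + a ≤ Z ^ (3 + (a + b))
  loop≤power m a b m≤ = begin
    m * (a + Z ^ b) + a             ≤⟨ +-monoʳ-≤ (m * (a + Z ^ b)) (m≤m+n a (Z ^ b)) ⟩
    m * (a + Z ^ b) + (a + Z ^ b)   ≡⟨ +-comm (m * (a + Z ^ b)) (a + Z ^ b) ⟩
    suc m * (a + Z ^ b)             ≤⟨ product≤power 2 (suc (a + b)) sm≤ (sum≤power a b (a≤Z^a a) ≤-refl) ⟩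
    Z ^ (3 + (a + b))               ∎
    where
    open ≤-Reasoning
    sm≤ : suc m ≤ Z ^ 2
    sm≤ = ≤-trans (s≤s m≤) (sum≤power {1} {Z} 0 1 ≤-refl (≤-reflexive (sym (*-identityʳ Z))))

  poly-while : ∀ {e p σ₀} {h : T (admissible e)} (I : ℕ → State → Set) →
    (∀ {σ} → I 0 σ → ⟦ e ⟧ σ ≡ 0) →
    (∀ {m σ} → Frame (while e p) σ₀ σ → I (suc m) σ → ⟦ e ⟧ σ ≢ 0 → Poly p σ (I m)) →
    ∀ m → m ≤ Z → I m σ₀ →
    Poly (while e p) σ₀ (λ σ → ∃[ m′ ] (I m′ σ × ⟦ e ⟧ σ ≡ 0))
  poly-while {e} {p} {σ₀} {h} I stop step m m≤ i =
    run-weaken (λ { _ (m′ , t , (i′ , t≤) , ≡0 , refl) → total m′ t≤ , m′ , i′ , ≡0 })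
      -- Amortisation: the time spent plus D for every iteration still allowed never exceeds m * D.
      (run-while {e} {p} {σ₀} {h} (λ m′ σ t → I m′ σ × t + m′ * D ≤ m * D) (λ (i , _) → stop i)
        (λ { {m′} {σ} {t} fr (i , t≤) ≢0 →
          run-weaken (λ { {_} {s} _ (s≤ , i′) → i′ , later m′ s≤ t≤ }) (step fr i ≢0) })
        m (i , ≤-refl))
    where
    c = suc (cost e)
    D = c + Z ^ exponent p
    total : ∀ m′ {t} → t + m′ * D ≤ m * D → t + c ≤ Z ^ (3 + (c + exponent p))
    total m′ {t} t≤ = ≤-trans (+-monoˡ-≤ c (≤-trans (m≤m+n t (m′ * D)) t≤)) (loop≤power m c (exponent p) m≤)
    later : ∀ m′ {s t} → s ≤ Z ^ exponent p → t + suc m′ * D ≤ m * D → t + (c + s) + m′ * D ≤ m * D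
    later m′ {s} {t} s≤ t≤ = ≤-trans (≤-reflexive (+-assoc t (c + s) (m′ * D)))
      (≤-trans (+-monoʳ-≤ t (+-monoˡ-≤ (m′ * D) (+-monoʳ-≤ c s≤))) t≤)

  poly-for : ∀ {x e p σ} (I : ℕ → State → Set)
    {h₁ : T (admissible (e ⊖ var x))} {h₂ : T (admissible e)} {h₃ : T (atomic e)}
    {h₄ : T (stable (for x e p) e)} {h₅ : T (not (writesReg p x))} →
    ⟦ e ⟧ σ ≤ Z → I 0 (setReg σ x 0) →
    (∀ {i σ′} → i < ⟦ e ⟧ σ → Frame (for x e p) σ σ′ → reg σ′ x ≡ i → I i σ′ →
      Poly p σ′ (λ σ″ → I (suc i) (setReg σ″ x (suc i)))) →
    Poly (for x e p) σ (λ σ′ → Frame (for x e p) σ σ′ × I (⟦ e ⟧ σ) σ′)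
  poly-for {x} {e} {p} {σ} I {h₁} {h₂} {h₃} {h₄} {h₅} N≤Z base step =
    run-weaken (λ { _ (fr , t , (i , t≤) , s≤) → total t≤ s≤ , fr , i })
      (run-for {x} {e} {p} {σ} (λ i σ t → I i σ × t ≤ i * D) {h₁} {h₂} {h₃} {h₄} {h₅} (base , z≤n)
        (λ { {i} i<N fr xi (inv , t≤) →
          run-weaken (λ { _ (s≤ , inv′) → inv′ , later i t≤ s≤ }) (step i<N fr xi inv) }))
    where
    c = overhead e
    D = c + Z ^ exponent p
    later : ∀ i {s t} → t ≤ i * D → s ≤ Z ^ exponent p → t + (c + s) ≤ suc i * D
    later i t≤ s≤ = ≤-trans (+-mono-≤ t≤ (+-monoʳ-≤ c s≤)) (≤-reflexive (+-comm (i * D) D))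
    total : ∀ {s t} → t ≤ ⟦ e ⟧ σ * D → s ≤ t + c → s ≤ Z ^ exponent (for x e p)
    total t≤ s≤ = ≤-trans s≤ (≤-trans (+-monoˡ-≤ c t≤)
      (≤-trans (loop≤power (⟦ e ⟧ σ) c (exponent p) N≤Z) (^-monoʳ-≤ Z larger)))
      where
      larger : 3 + (c + exponent p) ≤ exponent (for x e p)
      larger = ≤-trans (m≤n+m _ 4) (≤-reflexive
        (solve 2 (λ c b → con 4 :+ (con 3 :+ (c :+ con 7 :+ b)) :=
           con 3 :+ (con 3 :+ (con 1 :+ (con 1 :+ (c :+ con 1)) :+ (con 1 :+ (b :+ con 4))))) refl (cost e) (exponent p)))

  -- The common pattern of all scans in the program. The loop does not stop at a hit; a later hit
  -- overwrites an earlier one, and it is enough that the body decides H for the current index.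
  poly-search : ∀ {x e p σ} f (v : ℕ → ℕ) (H : ℕ → Set)
    {h₁ : T (admissible (e ⊖ var x))} {h₂ : T (admissible e)} {h₃ : T (atomic e)}
    {h₄ : T (stable (for x e p) e)} {h₅ : T (not (writesReg p x))} {h₆ : T (not (x ≡ᵇ f))} →
    ⟦ e ⟧ σ ≤ Z →
    (∀ {i σ′} → i < ⟦ e ⟧ σ → Frame (for x e p) σ σ′ → reg σ′ x ≡ i →
      Poly p σ′ (λ σ″ → (H i × reg σ″ f ≡ v i) ⊎ (¬ H i × reg σ″ f ≡ reg σ′ f))) →
    Poly (for x e p) σ (λ σ′ → Searched (⟦ e ⟧ σ) H v (reg σ′ f) (reg σ f))
  poly-search {x} {e} {p} {σ} f v H {h₁} {h₂} {h₃} {h₄} {h₅} {h₆} N≤Z step =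
    poly-weaken (λ { _ (_ , i) → i })
      (poly-for {x} {e} {p} {σ} (λ i σ′ → Searched i H v (reg σ′ f) (reg σ f)) {h₁} {h₂} {h₃} {h₄} {h₅} N≤Z
        (inj₂ ((λ _ ()) , unchanged σ 0))
        (λ {i} {σ′} i<N fr xi inv → poly-weaken (λ {σ″} _ → next i σ′ σ″ inv) (step i<N fr xi)))
    where
    unchanged : ∀ σ i → reg (setReg σ x i) f ≡ reg σ f
    unchanged σ i = update-skip (reg σ) x f i (not-T h₆)
    next : ∀ i σ′ σ″ → Searched i H v (reg σ′ f) (reg σ f) →
      (H i × reg σ″ f ≡ v i) ⊎ (¬ H i × reg σ″ f ≡ reg σ′ f) →
      Searched (suc i) H v (reg (setReg σ″ x (suc i)) f) (reg σ f)
    next i σ′ σ″ inv (inj₁ (hi , eq)) = inj₁ (i , ≤-refl , hi , trans (unchanged σ″ _) eq)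
    next i σ′ σ″ (inj₁ (j , j<i , hj , eq′)) (inj₂ (_ , eq)) =
      inj₁ (j , m<n⇒m<1+n j<i , hj , trans (unchanged σ″ _) (trans eq eq′))
    next i σ′ σ″ (inj₂ (none , eq′)) (inj₂ (¬hi , eq)) = inj₂ (none′ , trans (unchanged σ″ _) (trans eq eq′))
      where
      none′ : ∀ j → j < suc i → ¬ H j
      none′ j j<si with m≤n⇒m<n∨m≡n (s≤s⁻¹ j<si)
      ... | inj₁ j<i = none j j<i
      ... | inj₂ refl = ¬hi

-- Arithmetic

flat-< : ∀ {i j m n} → i < m → j < n → i * n + j < m * n
flat-< {i} {j} {m} {n} i<m j<n = begin-strict
  i * n + j <⟨ +-monoʳ-< (i * n) j<n ⟩
  i * n + n ≡⟨ +-comm (i * n) n ⟩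
  suc i * n ≤⟨ *-monoˡ-≤ n i<m ⟩
  m * n     ∎
  where open ≤-Reasoning

flat-injective : ∀ {n} i j i′ j′ → j < n → j′ < n → i * n + j ≡ i′ * n + j′ → i ≡ i′ × j ≡ j′
flat-injective {n} i j i′ j′ j<n j′<n eq with <-cmp i i′
... | tri< i<i′ _ _ = ⊥-elim (<⇒≢ (≤-trans (flat-< i<i′ j<n) (m≤m+n (i′ * n) j′)) eq)
... | tri≈ _ refl _ = refl , +-cancelˡ-≡ (i * n) j j′ eq
... | tri> _ _ i′<i = ⊥-elim (<⇒≢ (≤-trans (flat-< i′<i j′<n) (m≤m+n (i * n) j)) (sym eq))

module _ {A : Set} (f : ℕ → A) {n} (i j i′ j′ : ℕ) (a : A) (j<n : j < n) (j′<n : j′ < n) where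

  update-otherRow : i ≢ i′ → (f [ i * n + j ↦ a ]) (i′ * n + j′) ≡ f (i′ * n + j′)
  update-otherRow i≢i′ = update-other f a (i≢i′ ∘ proj₁ ∘ flat-injective i j i′ j′ j<n j′<n)

  update-otherCol : j ≢ j′ → (f [ i * n + j ↦ a ]) (i′ * n + j′) ≡ f (i′ * n + j′)
  update-otherCol j≢j′ = update-other f a (j≢j′ ∘ proj₂ ∘ flat-injective i j i′ j′ j<n j′<n)

unflatten : (f : ℕ → ℕ → ℕ) (M : ℕ) → (∀ i j → f i j ≡ 0 ⊎ f i j ≡ 1) →
  Σ (ℕ → ℕ) λ g → (∀ q → g q ≡ 0 ⊎ g q ≡ 1) × (∀ i {j} → j < M → g (i * M + j) ≡ f i j)
unflatten f zero bits = (λ _ → 0) , (λ _ → inj₁ refl) , λ _ ()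
unflatten f M@(suc _) bits = (λ q → f (q / M) (q % M)) , (λ q → bits (q / M) (q % M)) , λ i {j} j<M →
  let eq = flat-injective ((i * M + j) / M) ((i * M + j) % M) i j (m%n<n (i * M + j) M) j<M
             (trans (+-comm ((i * M + j) / M * M) _) (sym (m≡m%n+[m/n]*n (i * M + j) M)))
  in cong₂ f (proj₁ eq) (proj₂ eq)

flat-surjective : ∀ {n} (Q : ℕ → Set) → (∀ {i j} → i < n → j < n → Q (i * n + j)) → ∀ {q} → q < n * n → Q q
flat-surjective {n@(suc _)} Q h {q} q< = subst Q (trans (+-comm (q / n * n) (q % n)) (sym (m≡m%n+[m/n]*n q n)))
  (h (m<n*o⇒m/o<n {q} {n} {n} q<) (m%n<n q n))

bounded-injection : ∀ {m n} (f : ℕ → ℕ) → (∀ {i} → i < m → f i < n) →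
  (∀ {i j} → i < m → j < m → f i ≡ f j → i ≡ j) → m ≤ n
bounded-injection {m} {n} f f< inj = Fin.injective⇒≤ {f = λ i → fromℕ< (f< (Fin.toℕ<n i))} λ {i} {j} eq →
  Fin.toℕ-injective (inj (Fin.toℕ<n i) (Fin.toℕ<n j)
    (trans (sym (Fin.toℕ-fromℕ< (f< (Fin.toℕ<n i)))) (trans (cong toℕ eq) (Fin.toℕ-fromℕ< (f< (Fin.toℕ<n j))))))

below-suc : ∀ {i m} → i < suc m → i < m ⊎ i ≡ m
below-suc = m≤n⇒m<n∨m≡n ∘ s≤s⁻¹

extend-below : ∀ {m} (Q : ℕ → ℕ → Set) f y → (∀ {i} → i < m → Q i (f i)) → Q m y →
  ∀ {i} → i < suc m → Q i ((f [ m ↦ y ]) i)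
extend-below {m} Q f y old new {i} i< with below-suc i<
... | inj₁ i<m  = subst (Q i) (sym (update-other f y (≢-sym (<⇒≢ i<m)))) (old i<m)
... | inj₂ refl = subst (Q i) (sym (update-same f m y)) new

-- R is equality of vertices in `size<n` and equality of rows in `suc-M≤β`.
extend-injective : ∀ {m} (R : ℕ → ℕ → Set) f y →
  (∀ {i j} → i < m → j < m → R (f i) (f j) → i ≡ j) →
  (∀ {i} → i < m → ¬ R (f i) y) → (∀ {i} → i < m → ¬ R y (f i)) →
  ∀ {i j} → i < suc m → j < suc m → R ((f [ m ↦ y ]) i) ((f [ m ↦ y ]) j) → i ≡ j
extend-injective {m} R f y inj ¬l ¬r {i} {j} i< j< r with below-suc i< | below-suc j<
... | inj₁ i<m  | inj₁ j<m  = inj i<m j<m (subst₂ R (update-other f y (≢-sym (<⇒≢ i<m))) (update-other f y (≢-sym (<⇒≢ j<m))) r)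
... | inj₁ i<m  | inj₂ refl = ⊥-elim (¬l i<m (subst₂ R (update-other f y (≢-sym (<⇒≢ i<m))) (update-same f m y) r))
... | inj₂ refl | inj₁ j<m  = ⊥-elim (¬r j<m (subst₂ R (update-same f m y) (update-other f y (≢-sym (<⇒≢ j<m))) r))
... | inj₂ refl | inj₂ refl = refl

-- Binary counters

value : ℕ → (ℕ → ℕ) → ℕ
value zero    X = 0
value (suc L) X = value L X + X L * 2 ^ L

Bits : ℕ → (ℕ → ℕ) → Set
Bits L X = ∀ i → i < L → X i ≡ 0 ⊎ X i ≡ 1

bits-pred : ∀ {L X} → Bits (suc L) X → Bits L X
bits-pred b i i<L = b i (m<n⇒m<1+n i<L)

double : ∀ L → 2 ^ L + 2 ^ L ≡ 2 ^ suc L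
double L = cong (2 ^ L +_) (sym (+-identityʳ (2 ^ L)))

value-0 : ∀ {X} L → X L ≡ 0 → value (suc L) X ≡ value L X
value-0 {X} L eq = trans (cong (λ b → value L X + b * 2 ^ L) eq) (+-identityʳ _)

value-1 : ∀ {X} L → X L ≡ 1 → value (suc L) X ≡ value L X + 2 ^ L
value-1 {X} L eq = cong (value L X +_) (trans (cong (_* 2 ^ L) eq) (*-identityˡ (2 ^ L)))

value<2^L : ∀ L {X} → Bits L X → value L X < 2 ^ L
value<2^L zero b = s≤s z≤n
value<2^L (suc L) {X} b with b L (n<1+n L) | value<2^L L (bits-pred b)
... | inj₁ eq | ih = ≤-trans (subst (_< 2 ^ L) (sym (value-0 L eq)) ih) (≤-trans (m≤m+n _ _) (≤-reflexive (double L)))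
... | inj₂ eq | ih = subst₂ _<_ (sym (value-1 L eq)) (double L) (+-monoˡ-< (2 ^ L) ih)

value-injective : ∀ L {X Y} → Bits L X → Bits L Y → value L X ≡ value L Y → ∀ {i} → i < L → X i ≡ Y i
value-injective (suc L) {X} {Y} bX bY eq {i} i<
  with bX L (n<1+n L) | bY L (n<1+n L) | value<2^L L (bits-pred bX) | value<2^L L (bits-pred bY) | below-suc i<
... | inj₁ x | inj₁ y | _ | _ | inj₂ refl = trans x (sym y)
... | inj₂ x | inj₂ y | _ | _ | inj₂ refl = trans x (sym y)
... | inj₁ x | inj₁ y | _ | _ | inj₁ i<L = value-injective L (bits-pred bX) (bits-pred bY)
      (trans (sym (value-0 L x)) (trans eq (value-0 L y))) i<L
... | inj₂ x | inj₂ y | _ | _ | inj₁ i<L = value-injective L (bits-pred bX) (bits-pred bY)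
      (+-cancelʳ-≡ (2 ^ L) _ _ (trans (sym (value-1 L x)) (trans eq (value-1 L y)))) i<L
-- If the top digits differ, one value is below 2 ^ L and the other is at least 2 ^ L.
... | inj₁ x | inj₂ y | <X | _ | _ = ⊥-elim (<-irrefl
      (trans (sym (value-0 L x)) (trans eq (value-1 L y))) (≤-trans <X (m≤n+m _ _)))
... | inj₂ x | inj₁ y | _ | <Y | _ = ⊥-elim (<-irrefl
      (trans (sym (value-0 L y)) (trans (sym eq) (value-1 L x))) (≤-trans <Y (m≤n+m _ _)))

-- The digits below p contribute 2 ^ p - 1 before and 0 after, while digit p gains 2 ^ p: the net
-- change is 1.
value-carry : ∀ {X X′ p} → (∀ {i} → i < p → X i ≡ 1) → (∀ {i} → i < p → X′ i ≡ 0) →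
  X p ≡ 0 → X′ p ≡ 1 → (∀ {i} → p < i → X′ i ≡ X i) → ∀ {L} → p < L → value L X′ ≡ suc (value L X)
value-carry {X} {X′} {p} ones zeros Xp X′p above = go
  where
  low : ∀ m → m ≤ p → value m X′ ≡ 0 × suc (value m X) ≡ 2 ^ m
  low zero m≤ = refl , refl
  low (suc m) m≤ with low m (≤-trans (n≤1+n m) m≤)
  ... | z , f = trans (value-0 m (zeros m≤)) z ,
    trans (cong suc (value-1 m (ones m≤))) (trans (cong (_+ 2 ^ m) f) (double m))
  go : ∀ {L} → p < L → value L X′ ≡ suc (value L X)
  go {suc L} p<sL with below-suc p<sL
  ... | inj₁ p<L  = cong₂ (λ v b → v + b * 2 ^ L) (go p<L) (above p<L)
  ... | inj₂ refl with low p ≤-refl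
  ...   | z , f = trans (value-1 p X′p) (trans (cong (_+ 2 ^ p) z) (trans (sym f) (cong suc (sym (value-0 p Xp)))))

value-zero : ∀ L {X} → (∀ {i} → i < L → X i ≡ 0) → value L X ≡ 0
value-zero zero z = refl
value-zero (suc L) z = trans (value-0 L (z (n<1+n L))) (value-zero L (z ∘ m<n⇒m<1+n))

-- Selections: seg 0 , … , seg (sz ∸ 1) lists the numbers below m satisfying H.

record Selection (H : ℕ → Set) (m sz : ℕ) (seg : ℕ → ℕ) : Set where
  field
    size≤     : sz ≤ m
    entry<    : ∀ {j} → j < sz → seg j < m
    selected  : ∀ {j} → j < sz → H (seg j)
    injective : ∀ {j j′} → j < sz → j′ < sz → seg j ≡ seg j′ → j ≡ j′
    complete  : ∀ {i} → i < m → H i → ∃[ j ] (j < sz × seg j ≡ i)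

open Selection

selection-empty : ∀ {H seg} → Selection H 0 0 seg
selection-empty = record { size≤ = z≤n ; entry< = λ () ; selected = λ () ; injective = λ () ; complete = λ () }

selection-skip : ∀ {H m sz seg} → Selection H m sz seg → ¬ H m → Selection H (suc m) sz seg
selection-skip s ¬h = record
  { size≤ = m≤n⇒m≤1+n (size≤ s) ; entry< = m<n⇒m<1+n ∘ entry< s ; selected = selected s ; injective = injective s
  ; complete = λ i< h → case i< h (below-suc i<) }
  where
  case : ∀ {i} → i < suc _ → _ → _ → _
  case i< h (inj₁ i<m) = complete s i<m h
  case i< h (inj₂ refl) = ⊥-elim (¬h h)

selection-ext : ∀ {H m sz seg seg′} → (∀ {j} → j < sz → seg′ j ≡ seg j) → Selection H m sz seg → Selection H m sz seg′
selection-ext {H} eq s = record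
  { size≤ = size≤ s
  ; entry< = λ j< → subst (_< _) (sym (eq j<)) (entry< s j<)
  ; selected = λ j< → subst H (sym (eq j<)) (selected s j<)
  ; injective = λ j< j′< e → injective s j< j′< (trans (sym (eq j<)) (trans e (eq j′<)))
  ; complete = λ i< h → let (j , j< , e) = complete s i< h in j , j< , trans (eq j<) e
  }

selection-push : ∀ {H m sz seg seg′} → Selection H m sz seg → H m →
  (∀ {j} → j < sz → seg′ j ≡ seg j) → seg′ sz ≡ m → Selection H (suc m) (suc sz) seg′
selection-push {H} {m} {sz} {seg} {seg′} s h old new = record
  { size≤ = s≤s (size≤ s)
  ; entry< = entry<′
  ; selected = selected′
  ; injective = injective′
  ; complete = complete′
  }
  where
  s′ = selection-ext old s
  entry<′ : ∀ {j} → j < suc sz → seg′ j < suc m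
  entry<′ j< with below-suc j<
  ... | inj₁ j<sz = m<n⇒m<1+n (entry< s′ j<sz)
  ... | inj₂ refl = s≤s (≤-reflexive new)
  selected′ : ∀ {j} → j < suc sz → H (seg′ j)
  selected′ j< with below-suc j<
  ... | inj₁ j<sz = selected s′ j<sz
  ... | inj₂ refl = subst H (sym new) h
  injective′ : ∀ {j j′} → j < suc sz → j′ < suc sz → seg′ j ≡ seg′ j′ → j ≡ j′
  injective′ j< j′< eq with below-suc j< | below-suc j′<
  ... | inj₁ p    | inj₁ q    = injective s′ p q eq
  ... | inj₁ p    | inj₂ refl = ⊥-elim (<⇒≢ (entry< s′ p) (trans eq new))
  ... | inj₂ refl | inj₁ q    = ⊥-elim (<⇒≢ (entry< s′ q) (trans (sym eq) new))
  ... | inj₂ refl | inj₂ refl = refl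
  complete′ : ∀ {i} → i < suc m → H i → ∃[ j ] (j < suc sz × seg′ j ≡ i)
  complete′ i< hi with below-suc i<
  ... | inj₂ refl = sz , n<1+n sz , new
  ... | inj₁ i<m  = let (j , j< , e) = complete s′ i<m hi in j , m<n⇒m<1+n j< , e

-- Twin classes

Row : ℕ → (ℕ → ℕ) → ℕ → ℕ → Set
Row n B x y = ∀ {z} → z < n → B (x * n + z) ≡ B (y * n + z)

row-refl : ∀ {n B x} → Row n B x x
row-refl _ = refl

row-sym : ∀ {n B x y} → Row n B x y → Row n B y x
row-sym r z< = sym (r z<)

row-trans : ∀ {n B x y z} → Row n B x y → Row n B y z → Row n B x z
row-trans r r′ z< = trans (r z<) (r′ z<)

-- The vertices in S are partitioned into classes of equal rows of B.  Class c < M,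
-- possibly empty, consists of memb (c * n + j) for j < size c.
record Classes (n : ℕ) (B : ℕ → ℕ) (S : ℕ → Set) (M : ℕ) (cls pos memb size : ℕ → ℕ) : Set where
  field
    vertex<  : ∀ {x} → S x → x < n
    cls<     : ∀ {x} → S x → cls x < M
    pos<     : ∀ {x} → S x → pos x < size (cls x)
    memb-pos : ∀ {x} → S x → memb (cls x * n + pos x) ≡ x
    placed   : ∀ {c j} → c < M → j < size c → S (memb (c * n + j))
    cls-memb : ∀ {c j} → c < M → j < size c → cls (memb (c * n + j)) ≡ c
    pos-memb : ∀ {c j} → c < M → j < size c → pos (memb (c * n + j)) ≡ j
    same-row : ∀ {x y} → S x → S y → cls x ≡ cls y → Row n B x y
    same-cls : ∀ {x y} → S x → S y → Row n B x y → cls x ≡ cls y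

  memb-injective : ∀ {c j j′} → c < M → j < size c → j′ < size c → memb (c * n + j) ≡ memb (c * n + j′) → j ≡ j′
  memb-injective c< j< j′< eq = trans (sym (pos-memb c< j<)) (trans (cong pos eq) (pos-memb c< j′<))

  size≤n : ∀ {c} → c < M → size c ≤ n
  size≤n {c} c< = bounded-injection (λ j → memb (c * n + j)) (vertex< ∘ placed c<) (memb-injective c<)

  -- The members of c together with y are `suc (size c)` different numbers below n. This guarantees
  -- a free cell for y in the row of `members` that belongs to c.
  size<n : ∀ {c y} → c < M → y < n → ¬ S y → size c < n
  size<n {c} {y} c< y< ¬Sy = bounded-injection ((λ j → memb (c * n + j)) [ size c ↦ y ])
    (extend-below (λ _ x → x < n) (λ j → memb (c * n + j)) y (vertex< ∘ placed c<) y<)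
    (extend-injective _≡_ (λ j → memb (c * n + j)) y (memb-injective c<)
      (λ j< eq → ¬Sy (subst S eq (placed c< j<))) (λ j< eq → ¬Sy (subst S (sym eq) (placed c< j<))))

  rep : ℕ → ℕ
  rep c = memb (c * n)

  module _ {c} (c< : c < M) (≢0 : size c ≢ 0) where

    rep-placed : S (rep c)
    rep-placed = subst (S ∘ memb) (+-identityʳ (c * n)) (placed c< (n≢0⇒n>0 ≢0))

    rep< : rep c < n
    rep< = vertex< rep-placed

    cls-rep : cls (rep c) ≡ c
    cls-rep = subst (λ i → cls (memb i) ≡ c) (+-identityʳ (c * n)) (cls-memb c< (n≢0⇒n>0 ≢0))

  nonempty : ∀ {x} → S x → size (cls x) ≢ 0
  nonempty Sx = m<n⇒n≢0 (pos< Sx)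

  row-rep : ∀ {x} → (Sx : S x) → Row n B x (rep (cls x))
  row-rep Sx = same-row Sx (rep-placed (cls< Sx) (nonempty Sx)) (sym (cls-rep (cls< Sx) (nonempty Sx)))

open Classes

module _ {n : ℕ} {B : ℕ → ℕ} {S : ℕ → Set} {M : ℕ} {cls pos memb size : ℕ → ℕ} where

  classes-set : ∀ {S′} → (∀ {x} → S x → S′ x) → (∀ {x} → S′ x → S x) →
    Classes n B S M cls pos memb size → Classes n B S′ M cls pos memb size
  classes-set to from C = record
    { vertex< = vertex< C ∘ from ; cls< = cls< C ∘ from ; pos< = pos< C ∘ from ; memb-pos = memb-pos C ∘ from
    ; placed = λ c< j< → to (placed C c< j<) ; cls-memb = cls-memb C ; pos-memb = pos-memb C
    ; same-row = λ x y → same-row C (from x) (from y) ; same-cls = λ x y → same-cls C (from x) (from y) }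

  classes-rows : ∀ {B′} → (∀ {x z} → S x → z < n → B′ (x * n + z) ≡ B (x * n + z)) →
    Classes n B S M cls pos memb size → Classes n B′ S M cls pos memb size
  classes-rows eq C = record
    { vertex< = vertex< C ; cls< = cls< C ; pos< = pos< C ; memb-pos = memb-pos C
    ; placed = placed C ; cls-memb = cls-memb C ; pos-memb = pos-memb C
    ; same-row = λ x y e z< → trans (eq x z<) (trans (same-row C x y e z<) (sym (eq y z<)))
    ; same-cls = λ x y r → same-cls C x y (λ z< → trans (sym (eq x z<)) (trans (r z<) (eq y z<))) }

  classes-new : Classes n B S M cls pos memb size → Classes n B S (suc M) cls pos memb (size [ M ↦ 0 ])
  classes-new C = record
    { vertex< = vertex< C ; cls< = m<n⇒m<1+n ∘ cls< C
    ; pos< = λ Sx → subst (_ <_) (sym (update-other size 0 (≢-sym (<⇒≢ (cls< C Sx))))) (pos< C Sx)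
    ; memb-pos = memb-pos C
    ; placed = λ c< j< → let (c<′ , j<′) = old c< j< in placed C c<′ j<′
    ; cls-memb = λ c< j< → let (c<′ , j<′) = old c< j< in cls-memb C c<′ j<′
    ; pos-memb = λ c< j< → let (c<′ , j<′) = old c< j< in pos-memb C c<′ j<′
    ; same-row = same-row C ; same-cls = same-cls C }
    where
    old : ∀ {c j} → c < suc M → j < (size [ M ↦ 0 ]) c → c < M × j < size c
    old {c} {j} c< j< with below-suc c<
    ... | inj₁ c<M  = c<M , subst (j <_) (update-other size 0 (≢-sym (<⇒≢ c<M))) j<
    ... | inj₂ refl with () ← subst (j <_) (update-same size M 0) j<

  -- The last vertex w of the class of u takes the place of u.
  module Remove (C : Classes n B S M cls pos memb size) {u} (Su : S u) where

    private
      c = cls u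
      p = pos u
      l = size c ∸ 1
      w = memb (c * n + l)
      c< = cls< C Su
      sl : suc l ≡ size c
      sl = trans (+-comm 1 l) (m∸n+n≡m (≤-trans (s≤s z≤n) (pos< C Su)))
      l< : l < size c
      l< = ≤-reflexive sl
      Sw = placed C c< l<
      l<n = ≤-trans l< (size≤n C c<)
      p<n = ≤-trans (pos< C Su) (size≤n C c<)
      memb′ = memb [ c * n + p ↦ w ]
      pos′ = pos [ w ↦ p ]
      size′ = size [ c ↦ l ]
      size-c = update-same size c l
      size-other : ∀ {d} → c ≢ d → size′ d ≡ size d
      size-other = update-other size l

      -- The case that u is itself the last vertex needs no test in the program: then w = u and p =
      -- l, the two writes change nothing, and lowering the size discards u.
      w≡u⇒p≡l : w ≡ u → p ≡ l
      w≡u⇒p≡l eq = trans (cong pos (sym eq)) (pos-memb C c< l<)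

      p≡l⇒w≡u : p ≡ l → w ≡ u
      p≡l⇒w≡u eq = trans (cong (λ j → memb (c * n + j)) (sym eq)) (memb-pos C Su)

      posCase : ∀ {x} → S x → x ≢ u → pos′ x < size′ (cls x) × memb′ (cls x * n + pos′ x) ≡ x
      posCase {x} Sx x≢u with w ≟ x
      ... | yes refl rewrite update-same pos w p | cls-memb C c< l< | size-c =
        ≤∧≢⇒< (s≤s⁻¹ (subst (p <_) (sym sl) (pos< C Su))) (x≢u ∘ p≡l⇒w≡u) , update-same memb (c * n + p) w
      ... | no w≢x rewrite update-other pos p w≢x with c ≟ cls x
      ...   | no c≢ = subst (pos x <_) (sym (size-other c≢)) (pos< C Sx) ,
                trans (update-otherRow memb c p (cls x) (pos x) w p<n (≤-trans (pos< C Sx) (size≤n C (cls< C Sx))) c≢) (memb-pos C Sx)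
      ...   | yes c≡ = subst (pos x <_) (sym (trans (cong size′ (sym c≡)) size-c))
                  (≤∧≢⇒< (s≤s⁻¹ (subst (pos x <_) (trans (cong size (sym c≡)) (sym sl)) (pos< C Sx))) pos≢l) ,
                trans (update-otherCol memb c p (cls x) (pos x) w p<n (≤-trans (pos< C Sx) (size≤n C (cls< C Sx))) pos≢p) (memb-pos C Sx)
        where
        pos≢l : pos x ≢ l
        pos≢l eq = w≢x (trans (sym (cong₂ (λ c j → memb (c * n + j)) (sym c≡) eq)) (memb-pos C Sx))
        pos≢p : p ≢ pos x
        pos≢p eq = x≢u (trans (sym (memb-pos C Sx)) (trans (cong₂ (λ c j → memb (c * n + j)) (sym c≡) (sym eq)) (memb-pos C Su)))

      membCase : ∀ {d j} → d < M → j < size′ d →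
        (S (memb′ (d * n + j)) × memb′ (d * n + j) ≢ u) × cls (memb′ (d * n + j)) ≡ d × pos′ (memb′ (d * n + j)) ≡ j
      membCase {d} {j} d< j< with c ≟ d
      ... | no c≢d rewrite update-otherRow memb c p d j w p<n (≤-trans (subst (j <_) (size-other c≢d) j<) (size≤n C d<)) c≢d =
        (placed C d< j<′ , λ eq → c≢d (trans (cong cls (sym eq)) (cls-memb C d< j<′))) , cls-memb C d< j<′ ,
        trans (update-other pos p (λ eq → c≢d (trans (sym (cls-memb C c< l<)) (trans (cong cls eq) (cls-memb C d< j<′))))) (pos-memb C d< j<′)
        where j<′ = subst (j <_) (size-other c≢d) j<
      ... | yes refl with p ≟ j
      ...   | yes refl rewrite update-same memb (c * n + p) w =
        (Sw , λ eq → <⇒≢ (subst (p <_) size-c j<) (w≡u⇒p≡l eq)) , cls-memb C c< l< , update-same pos w p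
      ...   | no p≢j rewrite update-otherCol memb c p c j w p<n (≤-trans (subst (j <_) size-c j<) (<⇒≤ l<n)) p≢j =
        (placed C c< j<′ , λ eq → p≢j (trans (cong pos (sym eq)) (pos-memb C c< j<′))) , cls-memb C c< j<′ ,
        trans (update-other pos p (λ eq → <⇒≢ (subst (j <_) size-c j<) (trans (sym (pos-memb C c< j<′)) (trans (cong pos (sym eq)) (pos-memb C c< l<))))) (pos-memb C c< j<′)
        where j<′ = <-trans (subst (j <_) size-c j<) l<

    classes-remove : Classes n B (λ x → S x × x ≢ u) M cls pos′ memb′ size′
    classes-remove = record
      { vertex< = vertex< C ∘ proj₁ ; cls< = cls< C ∘ proj₁
      ; pos< = λ (Sx , x≢u) → proj₁ (posCase Sx x≢u)
      ; memb-pos = λ (Sx , x≢u) → proj₂ (posCase Sx x≢u)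
      ; placed = λ c< j< → proj₁ (membCase c< j<)
      ; cls-memb = λ c< j< → proj₁ (proj₂ (membCase c< j<))
      ; pos-memb = λ c< j< → proj₂ (proj₂ (membCase c< j<))
      ; same-row = λ x y → same-row C (proj₁ x) (proj₁ y) ; same-cls = λ x y → same-cls C (proj₁ x) (proj₁ y) }

  -- The conditions `to` and `from` hold for the class of the twins of u, and vacuously for an empty
  -- class if u has no twin. One argument serves both ways of placing u.
  module Push (C : Classes n B S M cls pos memb size) {u e} (u<n : u < n) (¬Su : ¬ S u) (e< : e < M)
              (to : ∀ {x} → S x → cls x ≡ e → Row n B x u) (from : ∀ {x} → S x → Row n B x u → cls x ≡ e) where

    private
      l = size e
      l<n = size<n C e< u<n ¬Su
      cls′ = cls [ u ↦ e ]
      pos′ = pos [ u ↦ l ]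
      memb′ = memb [ e * n + l ↦ u ]
      size′ = size [ e ↦ suc l ]
      S′ : ℕ → Set
      S′ x = S x ⊎ x ≡ u
      size-e = update-same size e (suc l)

      cls-old : ∀ {x} → S x → cls′ x ≡ cls x
      cls-old Sx = update-other cls e (λ eq → ¬Su (subst S (sym eq) Sx))

      pos-old : ∀ {x} → S x → pos′ x ≡ pos x
      pos-old Sx = update-other pos l (λ eq → ¬Su (subst S (sym eq) Sx))

      size-mono : ∀ d {j} → j < size d → j < size′ d
      size-mono d j< with e ≟ d
      ... | yes refl = subst (_ <_) (sym size-e) (m<n⇒m<1+n j<)
      ... | no e≢d   = subst (_ <_) (sym (update-other size (suc l) e≢d)) j<

      memb-old : ∀ {d j} → d < M → j < size d → memb′ (d * n + j) ≡ memb (d * n + j)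
      memb-old {d} {j} d< j< with e ≟ d
      ... | no e≢d   = update-otherRow memb e l d j u l<n (≤-trans j< (size≤n C d<)) e≢d
      ... | yes refl = update-otherCol memb e l d j u l<n (≤-trans j< (size≤n C d<)) (≢-sym (<⇒≢ j<))

      vertexCase : ∀ {x} → S′ x → x < n × cls′ x < M × pos′ x < size′ (cls′ x) × memb′ (cls′ x * n + pos′ x) ≡ x
      vertexCase {x} (inj₁ Sx) rewrite cls-old Sx | pos-old Sx =
        vertex< C Sx , cls< C Sx , size-mono (cls x) (pos< C Sx) , trans (memb-old (cls< C Sx) (pos< C Sx)) (memb-pos C Sx)
      vertexCase (inj₂ refl) rewrite update-same cls u e | update-same pos u l | size-e =
        u<n , e< , n<1+n l , update-same memb (e * n + l) u

      new-or-old : ∀ {d j} → j < size′ d → j < size d ⊎ (d ≡ e × j ≡ l)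
      new-or-old {d} {j} j< with e ≟ d
      ... | no e≢d = inj₁ (subst (j <_) (update-other size (suc l) e≢d) j<)
      ... | yes refl with below-suc (subst (j <_) size-e j<)
      ...   | inj₁ j<l  = inj₁ j<l
      ...   | inj₂ refl = inj₂ (refl , refl)

      membCase : ∀ {d j} → d < M → j < size′ d →
        S′ (memb′ (d * n + j)) × cls′ (memb′ (d * n + j)) ≡ d × pos′ (memb′ (d * n + j)) ≡ j
      membCase {d} {j} d< j< with new-or-old {d} j<
      ... | inj₂ (refl , refl) rewrite update-same memb (e * n + l) u = inj₂ refl , update-same cls u e , update-same pos u l
      ... | inj₁ j<′ rewrite memb-old d< j<′ =
        inj₁ (placed C d< j<′) , trans (cls-old (placed C d< j<′)) (cls-memb C d< j<′) ,
        trans (pos-old (placed C d< j<′)) (pos-memb C d< j<′)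

      rowCase : ∀ {x y} → S′ x → S′ y → cls′ x ≡ cls′ y → Row n B x y
      rowCase (inj₁ Sx) (inj₁ Sy) eq = same-row C Sx Sy (trans (sym (cls-old Sx)) (trans eq (cls-old Sy)))
      rowCase (inj₁ Sx) (inj₂ refl) eq = to Sx (trans (sym (cls-old Sx)) (trans eq (update-same cls u e)))
      rowCase {_} {y} (inj₂ refl) (inj₁ Sy) eq = row-sym {n} {B} {y} {u} (to Sy (trans (sym (cls-old Sy)) (trans (sym eq) (update-same cls u e))))
      rowCase (inj₂ refl) (inj₂ refl) eq = row-refl {n} {B} {u}

      clsCase : ∀ {x y} → S′ x → S′ y → Row n B x y → cls′ x ≡ cls′ y
      clsCase (inj₁ Sx) (inj₁ Sy) r = trans (cls-old Sx) (trans (same-cls C Sx Sy r) (sym (cls-old Sy)))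
      clsCase (inj₁ Sx) (inj₂ refl) r = trans (cls-old Sx) (trans (from Sx r) (sym (update-same cls u e)))
      clsCase {_} {y} (inj₂ refl) (inj₁ Sy) r = trans (update-same cls u e) (sym (trans (cls-old Sy) (from Sy (row-sym {n} {B} {u} {y} r))))
      clsCase (inj₂ refl) (inj₂ refl) r = refl

    classes-push : Classes n B S′ M cls′ pos′ memb′ size′
    classes-push = record
      { vertex< = proj₁ ∘ vertexCase ; cls< = proj₁ ∘ proj₂ ∘ vertexCase
      ; pos< = proj₁ ∘ proj₂ ∘ proj₂ ∘ vertexCase ; memb-pos = proj₂ ∘ proj₂ ∘ proj₂ ∘ vertexCase
      ; placed = λ c< j< → proj₁ (membCase c< j<)
      ; cls-memb = λ c< j< → proj₁ (proj₂ (membCase c< j<))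
      ; pos-memb = λ c< j< → proj₂ (proj₂ (membCase c< j<))
      ; same-row = rowCase ; same-cls = clsCase }

-- Edge clique covers as factorisations of matrices

-- For u in D the diagonal entry tells whether u has a neighbour.  With this
-- convention an edge clique cover is a family C with B = ⋃ C i × C i.
record Matrix {n} (G : Graph n) (B : ℕ → ℕ) (D : ℕ → Set) : Set where
  field
    off-diagonal : ∀ u v → u ≢ v → B (toℕ u * n + toℕ v) ≡ bit (adj G u v)
    diagonal     : ∀ u → D (toℕ u) →
      (B (toℕ u * n + toℕ u) ≡ 1 × ∃[ v ] Adj G u v) ⊎ (B (toℕ u * n + toℕ u) ≡ 0 × (∀ v → ¬ Adj G u v))

open Matrix

bit≢0 : ∀ {b} → bit b ≢ 0 → b ≡ true
bit≢0 {true} _ = refl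
bit≢0 {false} ≢0 = ⊥-elim (≢0 refl)

bit-cases : ∀ b → bit b ≡ 0 ⊎ bit b ≡ 1
bit-cases true = inj₂ refl
bit-cases false = inj₁ refl

adj⇒≢ : ∀ {n} (G : Graph n) {u v} → Adj G u v → u ≢ v
adj⇒≢ G {u} a refl with () ← trans (sym a) (Graph.irrefl G u)

below₁ : ∀ {n} (Q : ℕ → Set) → (∀ (u : Fin n) → Q (toℕ u)) → ∀ {u} → u < n → Q u
below₁ Q h u< = subst Q (Fin.toℕ-fromℕ< u<) (h (fromℕ< u<))

below₂ : ∀ {n} (Q : ℕ → ℕ → Set) → (∀ (u v : Fin n) → Q (toℕ u) (toℕ v)) → ∀ {u v} → u < n → v < n → Q u v
below₂ Q h u< v< = subst₂ Q (Fin.toℕ-fromℕ< u<) (Fin.toℕ-fromℕ< v<) (h (fromℕ< u<) (fromℕ< v<))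

module FullMatrix {n} {G : Graph n} {B : ℕ → ℕ} (mx : Matrix G B (_< n)) where

  diag : ∀ u → (B (toℕ u * n + toℕ u) ≡ 1 × ∃[ v ] Adj G u v) ⊎ (B (toℕ u * n + toℕ u) ≡ 0 × (∀ v → ¬ Adj G u v))
  diag u = diagonal mx u (Fin.toℕ<n u)

  entry-fin : ∀ (u v : Fin n) → B (toℕ u * n + toℕ v) ≡ 0 ⊎ B (toℕ u * n + toℕ v) ≡ 1
  entry-fin u v with u Fin.≟ v
  ... | no u≢v rewrite off-diagonal mx u v u≢v = bit-cases (adj G u v)
  ... | yes refl with diag u
  ...   | inj₁ (eq , _) = inj₂ eq
  ...   | inj₂ (eq , _) = inj₁ eq

  entry : ∀ {u v} → u < n → v < n → B (u * n + v) ≡ 0 ⊎ B (u * n + v) ≡ 1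
  entry = below₂ (λ u v → B (u * n + v) ≡ 0 ⊎ B (u * n + v) ≡ 1) entry-fin

  symmetric : ∀ {u v} → u < n → v < n → B (u * n + v) ≡ B (v * n + u)
  symmetric = below₂ (λ u v → B (u * n + v) ≡ B (v * n + u)) go
    where
    go : ∀ (u v : Fin n) → B (toℕ u * n + toℕ v) ≡ B (toℕ v * n + toℕ u)
    go u v with u Fin.≟ v
    ... | yes refl = refl
    ... | no u≢v = trans (off-diagonal mx u v u≢v) (trans (cong bit (Graph.sym G u v)) (sym (off-diagonal mx v u (≢-sym u≢v))))

  adj⇒entry : ∀ {u v} → Adj G u v → B (toℕ u * n + toℕ v) ≢ 0
  adj⇒entry {u} {v} a eq with () ← trans (sym eq) (trans (off-diagonal mx u v (adj⇒≢ G a)) (cong bit a))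

  entry⇒adj : ∀ {u v} → u ≢ v → B (toℕ u * n + toℕ v) ≢ 0 → Adj G u v
  entry⇒adj {u} {v} u≢v b = bit≢0 (b ∘ trans (off-diagonal mx u v u≢v))

  adj⇒diag : ∀ {u v} → Adj G u v → B (toℕ u * n + toℕ u) ≡ 1
  adj⇒diag {u} {v} a with diag u
  ... | inj₁ (eq , _) = eq
  ... | inj₂ (_ , none) = ⊥-elim (none v a)

-- This is B = ⋃ C i × C i, with `sound` for one inclusion and `covers` for the other. Both include
-- u = v, so a vertex without neighbours, having diagonal entry 0, must lie in no C i, and every
-- other vertex in at least one.
record Factor (n : ℕ) (B : ℕ → ℕ) (s : ℕ) (x : ℕ → ℕ → ℕ) : Set where
  field
    bits   : ∀ i u → x i u ≡ 0 ⊎ x i u ≡ 1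
    sound  : ∀ {i u v} → i < s → u < n → v < n → x i u ≢ 0 → x i v ≢ 0 → B (u * n + v) ≢ 0
    covers : ∀ {u v} → u < n → v < n → B (u * n + v) ≢ 0 → ∃[ i ] (i < s × x i u ≢ 0 × x i v ≢ 0)

module _ {s n : ℕ} (y : Fin s → Fin n → ℕ) where

  -- Programs index by natural numbers. The value 0 outside the range makes the extension a table of
  -- bits everywhere.
  lift : ℕ → ℕ → ℕ
  lift i u with i <? s | u <? n
  ... | yes p | yes q = y (fromℕ< p) (fromℕ< q)
  ... | yes p | no q  = 0
  ... | no p  | _     = 0

  lift-toℕ : ∀ i u → lift (toℕ i) (toℕ u) ≡ y i u
  lift-toℕ i u with toℕ i <? s | toℕ u <? n
  ... | yes p | yes q = cong₂ y (Fin.fromℕ<-toℕ i p) (Fin.fromℕ<-toℕ u q)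
  ... | yes p | no q  = ⊥-elim (q (Fin.toℕ<n u))
  ... | no p  | _     = ⊥-elim (p (Fin.toℕ<n i))

  lift-bits : (∀ i u → y i u ≡ 0 ⊎ y i u ≡ 1) → ∀ i u → lift i u ≡ 0 ⊎ lift i u ≡ 1
  lift-bits b i u with i <? s | u <? n
  ... | yes p | yes q = b (fromℕ< p) (fromℕ< q)
  ... | yes p | no q  = inj₁ refl
  ... | no p  | _     = inj₁ refl

-- Isolated vertices are dropped from the cliques.
cover⇒factor : ∀ {n k} {G : Graph n} {B} → Matrix G B (_< n) → HasEdgeCliqueCover G k →
  ∃[ s ] (s ≤ k × Σ (ℕ → ℕ → ℕ) (Factor n B s))
cover⇒factor {n} {k} {G} {B} mx (s , C , s≤k , clique , cover) = s , s≤k , lift y , record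
  { bits = lift-bits y y-bits
  ; sound = λ {i} {u} {v} i< u< v< → below₁ (λ i → lift y i u ≢ 0 → lift y i v ≢ 0 → B (u * n + v) ≢ 0)
      (λ i → below₂ (λ u v → lift y (toℕ i) u ≢ 0 → lift y (toℕ i) v ≢ 0 → B (u * n + v) ≢ 0) (sound′ i) u< v<) i<
  ; covers = below₂ (λ u v → B (u * n + v) ≢ 0 → ∃[ i ] (i < s × lift y i u ≢ 0 × lift y i v ≢ 0)) covers′
  }
  where
  open FullMatrix mx

  y : Fin s → Fin n → ℕ
  y i u with u ∈? C i
  -- The diagonal entry is 1 exactly if u has a neighbour, and so decides whether u stays in the
  -- clique.
  ... | yes _ = B (toℕ u * n + toℕ u)
  ... | no _  = 0

  y-bits : ∀ i u → y i u ≡ 0 ⊎ y i u ≡ 1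
  y-bits i u with u ∈? C i
  ... | yes _ = entry-fin u u
  ... | no _  = inj₁ refl

  y-∈ : ∀ {i u} → y i u ≢ 0 → u ∈ C i × B (toℕ u * n + toℕ u) ≢ 0
  y-∈ {i} {u} ≢0 with u ∈? C i
  ... | yes u∈ = u∈ , ≢0
  ... | no _   = ⊥-elim (≢0 refl)

  ∈-lift : ∀ {i u} → u ∈ C i → B (toℕ u * n + toℕ u) ≡ 1 → lift y (toℕ i) (toℕ u) ≢ 0
  ∈-lift {i} {u} u∈ d rewrite lift-toℕ y i u with u ∈? C i
  ... | yes _ = λ eq → contradiction (trans (sym d) eq) λ ()
  ... | no u∉ = ⊥-elim (u∉ u∈)

  sound′ : ∀ i u v → lift y (toℕ i) (toℕ u) ≢ 0 → lift y (toℕ i) (toℕ v) ≢ 0 → B (toℕ u * n + toℕ v) ≢ 0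
  sound′ i u v p q rewrite lift-toℕ y i u | lift-toℕ y i v with u Fin.≟ v
  ... | yes refl = proj₂ (y-∈ {i} {u} p)
  ... | no u≢v   = adj⇒entry (clique i u v (proj₁ (y-∈ {i} p)) (proj₁ (y-∈ {i} q)) u≢v)

  covers-edge : ∀ {u v} → Adj G u v → ∃[ i ] (i < s × lift y i (toℕ u) ≢ 0 × lift y i (toℕ v) ≢ 0)
  covers-edge {u} {v} a = let (i , u∈ , v∈) = cover u v a in
    toℕ i , Fin.toℕ<n i , ∈-lift u∈ (adj⇒diag a) , ∈-lift v∈ (adj⇒diag (trans (Graph.sym G v u) a))

  covers′ : ∀ u v → B (toℕ u * n + toℕ v) ≢ 0 → ∃[ i ] (i < s × lift y i (toℕ u) ≢ 0 × lift y i (toℕ v) ≢ 0)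
  covers′ u v b with u Fin.≟ v
  ... | no u≢v = covers-edge (entry⇒adj u≢v b)
  ... | yes refl with diag u
  ...   | inj₂ (eq , _) = ⊥-elim (b eq)
  -- A diagonal entry 1 comes with a neighbour z, and the clique that covers the edge uz contains u.
  ...   | inj₁ (_ , z , a) = let (i , i< , p , _) = covers-edge a in i , i< , p , p

bits≡ : ∀ {a b} → a ≡ 0 ⊎ a ≡ 1 → b ≡ 0 ⊎ b ≡ 1 → (a ≢ 0 → b ≢ 0) → (b ≢ 0 → a ≢ 0) → a ≡ b
bits≡ (inj₁ p) (inj₁ q) f g = trans p (sym q)
bits≡ (inj₂ p) (inj₂ q) f g = trans p (sym q)
bits≡ (inj₁ p) (inj₂ q) f g = ⊥-elim (g (λ e → contradiction (trans (sym q) e) λ ()) p)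
bits≡ (inj₂ p) (inj₁ q) f g = ⊥-elim (f (λ e → contradiction (trans (sym p) e) λ ()) q)

-- Vertices contained in the same members of a factorisation have equal rows.
rows≤2^s : ∀ {n s B x m} (f : ℕ → ℕ) → (∀ {u v} → u < n → v < n → B (u * n + v) ≡ 0 ⊎ B (u * n + v) ≡ 1) →
  Factor n B s x → (∀ {c} → c < m → f c < n) →
  (∀ {c d} → c < m → d < m → Row n B (f c) (f d) → c ≡ d) → m ≤ 2 ^ s
rows≤2^s {n} {s} {B} {x} f entry F f< inj = bounded-injection code (λ _ → Fin.toℕ<n _) λ {c} {d} c< d< eq →
  inj c< d< λ {z} z< → bits≡ (entry (f< c<) z<) (entry (f< d<) z<)
    (transfer (f< c<) (f< d<) z< (same-bits {c} {d} eq)) (transfer (f< d<) (f< c<) z< (same-bits {d} {c} (sym eq)))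
  where
  signature : ℕ → Fin s → Fin 2
  signature u i with x (toℕ i) u ≟ 0
  ... | yes _ = zero
  ... | no _  = suc zero

  code : ℕ → ℕ
  code c = toℕ (funToFin (signature (f c)))

  signature-≢0 : ∀ u v i → signature u i ≡ signature v i → x (toℕ i) u ≢ 0 → x (toℕ i) v ≢ 0
  signature-≢0 u v i eq ≢0 ≡0 with x (toℕ i) u ≟ 0 | x (toℕ i) v ≟ 0
  ... | yes ≡0′ | _      = ≢0 ≡0′
  ... | no _    | no ≢0′ = ≢0′ ≡0
  signature-≢0 u v i () ≢0 ≡0 | no _ | yes _

  same-bits : ∀ {c d} → code c ≡ code d → ∀ {i} → i < s → x i (f c) ≢ 0 → x i (f d) ≢ 0
  same-bits {c} {d} eq = below₁ (λ i → x i (f c) ≢ 0 → x i (f d) ≢ 0) λ i → signature-≢0 (f c) (f d) i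
    (trans (sym (Fin.finToFun-funToFin (signature (f c)) i))
      (trans (cong (λ q → finToFun q i) (Fin.toℕ-injective eq)) (Fin.finToFun-funToFin (signature (f d)) i)))

  transfer : ∀ {u v z} → u < n → v < n → z < n → (∀ {i} → i < s → x i u ≢ 0 → x i v ≢ 0) →
    B (u * n + z) ≢ 0 → B (v * n + z) ≢ 0
  transfer u< v< z< same b = let (i , i< , p , q) = Factor.covers F u< z< b in Factor.sound F i< v< z< (same i< p) q

-- X (i * M + c) ≢ 0 means that class c is contained in clique i.
module Quotient (n : ℕ) (B : ℕ → ℕ) (M : ℕ) (memb size : ℕ → ℕ) where

  Both : (X : ℕ → ℕ) (c d i : ℕ) → Set
  Both X c d i = X (i * M + c) * X (i * M + d) ≢ 0

  -- Empty classes are exempt, as `memb (c * n)` then represents nothing. The pair c = d is included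
  -- and tests the diagonal: a class of vertices with neighbours must lie in some clique, a class of
  -- isolated vertices in none.
  Bad : (K : ℕ) (X : ℕ → ℕ) (c d : ℕ) → Set
  Bad K X c d = size c ≢ 0 × size d ≢ 0 ×
    ((B (memb (c * n) * n + memb (d * n)) ≢ 0 × (∀ i → i < K → ¬ Both X c d i)) ⊎
     (B (memb (c * n) * n + memb (d * n)) ≡ 0 × ∃[ i ] (i < K × Both X c d i)))

  -- Stated row by row as an absence of bad pairs, the form in which the nested scans of
  -- `checkTable` report it.
  Good : ℕ → (ℕ → ℕ) → Set
  Good K X = ∀ c → c < M → ¬ (∃[ d ] (d < M × Bad K X c d))

  good-ext : ∀ {K X Y} → (∀ {q} → q < K * M → X q ≡ Y q) → Good K X → Good K Y
  good-ext {K} {X} {Y} eq good c c< (d , d< , sc , sd , bad) = good c c< (d , d< , sc , sd , bad′ bad)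
    where
    both : ∀ {i} → i < K → X (i * M + c) * X (i * M + d) ≡ Y (i * M + c) * Y (i * M + d)
    both i< = cong₂ _*_ (eq (flat-< i< c<)) (eq (flat-< i< d<))
    bad′ : _ → _
    bad′ (inj₁ (b , none)) = inj₁ (b , λ i i< h → none i i< (subst (_≢ 0) (both i<) h))
    bad′ (inj₂ (b , i , i< , h)) = inj₂ (b , i , i< , subst (_≢ 0) (sym (both i<)) h)

*-≢0 : ∀ {a b} → a ≢ 0 → b ≢ 0 → a * b ≢ 0
*-≢0 {a} p q eq with m*n≡0⇒m≡0∨n≡0 a eq
... | inj₁ e = p e
... | inj₂ e = q e

*-≢0ˡ : ∀ {a b} → a * b ≢ 0 → a ≢ 0
*-≢0ˡ p refl = p refl

*-≢0ʳ : ∀ a {b} → a * b ≢ 0 → b ≢ 0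
*-≢0ʳ a p refl = p (*-zeroʳ a)

family : (n K M : ℕ) (X cls : ℕ → ℕ) → NamedFamily n
family n K M X cls = record
  { size   = K
  ; clique = λ i → tabulate λ v → not (X (toℕ i * M + cls (toℕ v)) ≡ᵇ 0)
  ; name   = toℕ
  }

module Membership (n K M : ℕ) (X cls : ℕ → ℕ) where

  private 𝒞 = family n K M X cls

  ∈-family : ∀ i v → X (toℕ i * M + cls (toℕ v)) ≢ 0 → v ∈ clique 𝒞 i
  ∈-family i v ≢0 = lookup⇒[]= v (clique 𝒞 i) (trans (lookup∘tabulate _ v) (go _ ≢0))
    where
    go : ∀ a → a ≢ 0 → not (a ≡ᵇ 0) ≡ true
    go zero p = ⊥-elim (p refl)
    go (suc a) p = refl

  family-∈ : ∀ i v → v ∈ clique 𝒞 i → X (toℕ i * M + cls (toℕ v)) ≢ 0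
  family-∈ i v v∈ = go _ (trans (sym (lookup∘tabulate _ v)) ([]=⇒lookup v∈))
    where
    go : ∀ a → not (a ≡ᵇ 0) ≡ true → a ≢ 0
    go zero () _
    go (suc a) _ ()

module CoverQuotient {n} {G : Graph n} {B : ℕ → ℕ} (mx : Matrix G B (_< n))
  {M : ℕ} {cls pos memb size : ℕ → ℕ} (C : Classes n B (_< n) M cls pos memb size) where

  open Quotient n B M memb size
  open FullMatrix mx

  -- Class c joins clique i if its representative does; the two kinds of bad pair then contradict
  -- `covers` and `sound` at the representatives.
  factor⇒good : ∀ {s x} → Factor n B s x → Σ (ℕ → ℕ) λ X → (∀ L → Bits L X) × Good s X
  factor⇒good {s} {x} F = X , (λ L q _ → X-bits q) , good
    where
    flat = unflatten (λ i c → x i (rep C c)) M (λ i c → Factor.bits F i (rep C c))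
    X = proj₁ flat
    X-bits = proj₁ (proj₂ flat)
    X-eq = proj₂ (proj₂ flat)
    good : Good s X
    good c c< (d , d< , sc , sd , inj₁ (b , none)) =
      let (i , i< , p , q) = Factor.covers F (rep< C c< sc) (rep< C d< sd) b
      in none i i< (*-≢0 (p ∘ trans (sym (X-eq i c<))) (q ∘ trans (sym (X-eq i d<))))
    good c c< (d , d< , sc , sd , inj₂ (b , i , i< , h)) =
      Factor.sound F i< (rep< C c< sc) (rep< C d< sd)
        (*-≢0ˡ h ∘ trans (X-eq i c<)) (*-≢0ʳ (X (i * M + c)) h ∘ trans (X-eq i d<)) b

  -- The row of u is exchanged for that of its representative; symmetry turns the column v into a
  -- row, which is exchanged likewise.
  entry-rep : ∀ {u v} → u < n → v < n → B (u * n + v) ≡ B (rep C (cls u) * n + rep C (cls v))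
  entry-rep {u} {v} u< v< =
    trans (row-rep C u< v<) (trans (symmetric ru< v<) (trans (row-rep C v< ru<) (symmetric rv< ru<)))
    where
    ru< = rep< C (cls< C u<) (nonempty C u<)
    rv< = rep< C (cls< C v<) (nonempty C v<)

  good⇒cover : ∀ {K X} → Good K X → IsEdgeCliqueCover G (clique (family n K M X cls))
  good⇒cover {K} {X} good = cliques , edges
    where
    open Membership n K M X cls
    cliques : ∀ i → IsClique G (clique (family n K M X cls) i)
    cliques i u v u∈ v∈ u≢v = entry⇒adj u≢v λ ≡0 → good _ (cls< C u<)
      (_ , cls< C v< , nonempty C u< , nonempty C v< , inj₂ (trans (sym (entry-rep u< v<)) ≡0 , toℕ i , Fin.toℕ<n i ,
        *-≢0 (family-∈ i u u∈) (family-∈ i v v∈)))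
      where
      u< = Fin.toℕ<n u
      v< = Fin.toℕ<n v
    edges : ∀ u v → Adj G u v → ∃[ i ] (u ∈ clique (family n K M X cls) i × v ∈ clique (family n K M X cls) i)
    -- `Good` only refutes the absence of a clique; deciding the bounded search produces the clique
    -- itself.
    edges u v a with anyUpTo? (λ i → ¬? (X (i * M + cls (toℕ u)) * X (i * M + cls (toℕ v)) ≟ 0)) K
    ... | yes (i , i< , h) = fromℕ< i< , ∈-family (fromℕ< i<) u (*-≢0ˡ h′) ,
      ∈-family (fromℕ< i<) v (*-≢0ʳ (X (toℕ (fromℕ< i<) * M + cls (toℕ u))) h′)
      where
      h′ : Both X (cls (toℕ u)) (cls (toℕ v)) (toℕ (fromℕ< i<))
      h′ = subst (Both X (cls (toℕ u)) (cls (toℕ v))) (sym (Fin.toℕ-fromℕ< i<)) h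
    ... | no none = ⊥-elim (good _ (cls< C u<) (_ , cls< C v< , nonempty C u< , nonempty C v< ,
        inj₁ ((λ ≡0 → adj⇒entry a (trans (entry-rep u< v<) ≡0)) , λ i i< h → none (i , i< , h))))
      where
      u< = Fin.toℕ<n u
      v< = Fin.toℕ<n v

stableBut : ℕ → Cmd → Expr → Bool
stableBut x p (lit c)    = true
stableBut x p (var y)    = (x ≡ᵇ y) ∨ not (writesReg p y)
stableBut x p (cell a e) = not (writesArr p a) ∧ stableBut x p e
stableBut x p (e ⊕ f)    = stableBut x p e ∧ stableBut x p f
stableBut x p (e ⊖ f)    = stableBut x p e ∧ stableBut x p f
stableBut x p (e ⊗ f)    = stableBut x p e ∧ stableBut x p f

-- In iteration i of a loop with counter x, expressions have the same value as
-- in the state σ before the loop with i assigned to x.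
eval-at : ∀ {x p σ σ′ i} → Frame p σ σ′ → reg σ′ x ≡ i → ∀ e {h : T (stableBut x p e)} →
  ⟦ e ⟧ σ′ ≡ ⟦ e ⟧ (setReg σ x i)
eval-at fr xi (lit c) = refl
eval-at {x} {p} {σ} {σ′} {i} fr xi (var y) {h} with x ≡ᵇ y in eq
... | true  = trans (cong (reg σ′) (sym (≡ᵇ⇒≡ x y (subst T (sym eq) tt)))) xi
... | false = reg-eq fr y (not-T h)
eval-at {x} {p} {σ} {σ′} {i} fr xi (cell a e) {h}
  rewrite arr-eq fr a (not-T (∧-left h)) | eval-at fr xi e {∧-right {not (writesArr p a)} h} = refl
eval-at {x} {p} fr xi (e ⊕ f) {h} = cong₂ _+_ (eval-at fr xi e {∧-left h}) (eval-at fr xi f {∧-right {stableBut x p e} h})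
eval-at {x} {p} fr xi (e ⊖ f) {h} = cong₂ _∸_ (eval-at fr xi e {∧-left h}) (eval-at fr xi f {∧-right {stableBut x p e} h})
eval-at {x} {p} fr xi (e ⊗ f) {h} = cong₂ _*_ (eval-at fr xi e {∧-left h}) (eval-at fr xi f {∧-right {stableBut x p e} h})

-- Registers 0 and 1 hold the arguments of a call.

vertex found class other flag index left right order param classes columns covers bad solved tableSize limit : ℕ
vertex  = 2
found   = 3
class   = 4
other   = 5
flag    = 6
index   = 7
left    = 8
right   = 9
order   = 10
param   = 11
classes = 12
columns = 13
covers  = 14
bad     = 15
solved  = 16
tableSize = 17
limit   = 18

-- Arrays; matrix and members have rows of length n, and table has rows of length M.

matrix clsOf posOf members sizes cols table : ℕ
matrix  = 0
clsOf   = 1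
posOf   = 2
members = 3
sizes   = 4
cols    = 5
table   = 6

record Store (n k M : ℕ) (B : ℕ → ℕ) (S : ℕ → Set) (σ : State) : Set where
  field
    order≡   : reg σ order ≡ n
    param≡   : reg σ param ≡ k
    classes≡ : reg σ classes ≡ M
    matrix≡  : arr σ matrix ≡ B
    partition : Classes n B S M (arr σ clsOf) (arr σ posOf) (arr σ members) (arr σ sizes)

open Store

keepsPartition : Cmd → Bool
keepsPartition p = not (writesReg p order) ∧ not (writesReg p param) ∧ not (writesReg p classes)
  ∧ not (writesArr p clsOf) ∧ not (writesArr p posOf) ∧ not (writesArr p members) ∧ not (writesArr p sizes)

-- The partition depends only on the rows of the vertices in S. Entries in the rows of vertices that
-- have been taken out may change without harm.
store-matrix : ∀ {n k M B B′ S p σ σ′} {h : T (keepsPartition p)} → Frame p σ σ′ → arr σ′ matrix ≡ B′ →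
  (∀ {x z} → S x → z < n → B′ (x * n + z) ≡ B (x * n + z)) → Store n k M B S σ → Store n k M B′ S σ′
store-matrix {n} {k} {M} {B} {B′} {S} {p} {σ} {σ′} {h} fr eq rows st
  with (h₁ , h) ← Equivalence.to (T-∧ {not (writesReg p order)}) h
  with (h₂ , h) ← Equivalence.to (T-∧ {not (writesReg p param)}) h
  with (h₃ , h) ← Equivalence.to (T-∧ {not (writesReg p classes)}) h
  with (h₄ , h) ← Equivalence.to (T-∧ {not (writesArr p clsOf)}) h
  with (h₅ , h) ← Equivalence.to (T-∧ {not (writesArr p posOf)}) h
  with (h₆ , h₇) ← Equivalence.to (T-∧ {not (writesArr p members)}) h = record
    { order≡ = trans (reg-eq fr order (not-T h₁)) (order≡ st)
    ; param≡ = trans (reg-eq fr param (not-T h₂)) (param≡ st)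
    ; classes≡ = trans (reg-eq fr classes (not-T h₃)) (classes≡ st)
    ; matrix≡ = eq
    ; partition = part (arr-eq fr clsOf (not-T h₄)) (arr-eq fr posOf (not-T h₅)) (arr-eq fr members (not-T h₆)) (arr-eq fr sizes (not-T h₇)) }
  where
  part : arr σ′ clsOf ≡ arr σ clsOf → arr σ′ posOf ≡ arr σ posOf → arr σ′ members ≡ arr σ members → arr σ′ sizes ≡ arr σ sizes →
    Classes n B′ S M (arr σ′ clsOf) (arr σ′ posOf) (arr σ′ members) (arr σ′ sizes)
  part e₁ e₂ e₃ e₄ rewrite e₁ | e₂ | e₃ | e₄ = classes-rows rows (partition st)

preserves : Cmd → Bool
preserves p = not (writesArr p matrix) ∧ keepsPartition p

store-frame : ∀ {n k M B S p σ σ′} {h : T (preserves p)} → Frame p σ σ′ → Store n k M B S σ → Store n k M B S σ′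
store-frame {p = p} {h = h} fr st = store-matrix {h = ∧-right {not (writesArr p matrix)} h} fr
  (trans (arr-eq fr matrix (not-T (∧-left h))) (matrix≡ st)) (λ _ _ → refl) st

-- Programs that maintain the partition into twin classes

removeVertex : Cmd
removeVertex =
  found ≔ cell clsOf (var vertex) ⨾
  class ≔ cell sizes (var found) ⊖ lit 1 ⨾
  other ≔ cell members (var found ⊗ var order ⊕ var class) ⨾
  members ⟨ var found ⊗ var order ⊕ cell posOf (var vertex) ⟩≔ var other ⨾
  posOf ⟨ var other ⟩≔ cell posOf (var vertex) ⨾
  sizes ⟨ var found ⟩≔ var class

-- The old entry is cleared first because the vertex may itself be among the columns scanned; after
-- that a non-zero entry can only come from a neighbour.
setDiagonal : Cmd
setDiagonal =
  matrix ⟨ var vertex ⊗ var order ⊕ var vertex ⟩≔ lit 0 ⨾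
  found ≔ lit 0 ⨾
  for index (var columns)
    (ifnz (cell matrix (var vertex ⊗ var order ⊕ cell cols (var index))) (found ≔ lit 1) skip) ⨾
  matrix ⟨ var vertex ⊗ var order ⊕ var vertex ⟩≔ var found

compareRows : Cmd
compareRows =
  flag ≔ lit 0 ⨾
  for index (var columns)
    (left  ≔ cell matrix (var vertex ⊗ var order ⊕ cell cols (var index)) ⨾
     right ≔ cell matrix (var other ⊗ var order ⊕ cell cols (var index)) ⨾
     -- Subtraction is truncated, so this sum of both differences vanishes exactly if the two
     -- entries are equal.
     ifnz ((var left ⊖ var right) ⊕ (var right ⊖ var left)) (flag ≔ lit 1) skip)

findTwin : Cmd
findTwin =
  found ≔ lit 0 ⨾
  for class (var classes)
    (ifnz (cell sizes (var class))
      (other ≔ cell members (var class ⊗ var order) ⨾ compareRows ⨾ ifnz (var flag) skip (found ≔ var class ⊕ lit 1))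
      skip)

findEmpty : Cmd
findEmpty = for class (var classes) (ifnz (cell sizes (var class)) skip (found ≔ var class ⊕ lit 1))

newClass : Cmd
newClass = sizes ⟨ var classes ⟩≔ lit 0 ⨾ classes ≔ var classes ⊕ lit 1 ⨾ found ≔ var classes

-- Emptied classes are reused before a new number is issued. A new number is therefore needed only
-- when every class is occupied, which is what limits `classes`.
chooseClass : Cmd
chooseClass = findTwin ⨾ ifnz (var found) skip findEmpty ⨾ ifnz (var found) skip newClass

pushVertex : Cmd
pushVertex =
  found ≔ var found ⊖ lit 1 ⨾
  posOf ⟨ var vertex ⟩≔ cell sizes (var found) ⨾
  clsOf ⟨ var vertex ⟩≔ var found ⨾
  members ⟨ var found ⊗ var order ⊕ cell sizes (var found) ⟩≔ var vertex ⨾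
  sizes ⟨ var found ⟩≔ cell sizes (var found) ⊕ lit 1

placeVertex : Cmd
placeVertex = chooseClass ⨾ pushVertex

-- One column per class number, followed by the two end points of the edge. An empty class has no
-- representative; the first end point fills its place, so that every column is a vertex.
buildColumns : Cmd
buildColumns =
  for class (var classes)
    (ifnz (cell sizes (var class)) (cols ⟨ var class ⟩≔ cell members (var class ⊗ var order)) (cols ⟨ var class ⟩≔ var 0)) ⨾
  cols ⟨ var classes ⟩≔ var 0 ⨾
  cols ⟨ var classes ⊕ lit 1 ⟩≔ var 1 ⨾
  columns ≔ var classes ⊕ lit 2

m∸n+n∸m≡0⇒m≡n : ∀ m n → (m ∸ n) + (n ∸ m) ≡ 0 → m ≡ n
m∸n+n∸m≡0⇒m≡n m n eq = ≤-antisym (m∸n≡0⇒m≤n (m+n≡0⇒m≡0 (m ∸ n) eq)) (m∸n≡0⇒m≤n (m+n≡0⇒n≡0 (m ∸ n) eq))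

module Procedures (W P : ℕ) (2≤P : 2 ≤ P) (P^16<W : P ^ 16 < W) (Z : ℕ) (2≤Z : 2 ≤ Z) where

  open Run W P 2≤P P^16<W
  open Poly W P 2≤P P^16<W Z 2≤Z

  poly-removeVertex : ∀ {n k M B S σ} → Store n k M B S σ → S (reg σ vertex) →
    Poly removeVertex σ (Store n k M B (λ x → S x × x ≢ reg σ vertex))
  poly-removeVertex {S = S} {σ = σ} record { order≡ = refl ; param≡ = refl ; classes≡ = refl ; matrix≡ = refl ; partition = C } Su =
    poly-seq $ poly-assign $ poly-seq $ poly-assign $ poly-seq $ poly-assign $
    poly-seq $ poly-store $ poly-seq $ poly-store $ poly-store $
    record { order≡ = refl ; param≡ = refl ; classes≡ = refl ; matrix≡ = refl
           ; partition = Remove.classes-remove C Su }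

  poly-setDiagonal : ∀ {n B col L u σ} → reg σ order ≡ n → arr σ matrix ≡ B → arr σ cols ≡ col → reg σ columns ≡ L →
    reg σ vertex ≡ u → L ≤ Z →
    let B₀ = B [ u * n + u ↦ 0 ] in
    Poly setDiagonal σ (λ σ′ → ∃[ b ] (arr σ′ matrix ≡ B₀ [ u * n + u ↦ b ] ×
      (((∃[ j ] (j < L × B₀ (u * n + col j) ≢ 0)) × b ≡ 1) ⊎ ((∀ j → j < L → ¬ (B₀ (u * n + col j) ≢ 0)) × b ≡ 0))))
  poly-setDiagonal {σ = σ} refl refl refl refl refl L≤Z =
    poly-seq (poly-store (poly-seq (poly-assign (poly-seq (poly-weaken after
      (poly-search {index} {var columns} found (λ _ → 1) H L≤Z step))))))
    where
    n = reg σ order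
    u = reg σ vertex
    B₀ = arr σ matrix [ u * n + u ↦ 0 ]
    σ₀ = setReg (setCell σ matrix (u * n + u) 0) found 0
    body = ifnz (cell matrix (var vertex ⊗ var order ⊕ cell cols (var index))) (found ≔ lit 1) skip
    H : ℕ → Set
    H j = B₀ (u * n + arr σ cols j) ≢ 0
    step : ∀ {i σ′} → i < reg σ columns → Frame (for index (var columns) body) σ₀ σ′ → reg σ′ index ≡ i →
      Poly body σ′ (λ σ″ → (H i × reg σ″ found ≡ 1) ⊎ (¬ H i × reg σ″ found ≡ reg σ′ found))
    step {i} {σ′} i< fr xi = poly-if
      (λ ≢0 → poly-assign (inj₁ (≢0 ∘ trans eq , refl)))
      (λ ≡0 → poly-skip (inj₂ ((λ h → h (trans (sym eq) ≡0)) , refl)))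
      where eq = eval-at {index} fr xi (cell matrix (var vertex ⊗ var order ⊕ cell cols (var index)))
    after : ∀ {σ′} → Frame (for index (var columns) body) σ₀ σ′ → Searched (reg σ columns) H (λ _ → 1) (reg σ′ found) 0 →
      Poly (matrix ⟨ var vertex ⊗ var order ⊕ var vertex ⟩≔ var found) σ′ (λ σ″ → ∃[ b ] (arr σ″ matrix ≡ B₀ [ u * n + u ↦ b ] ×
      (((∃[ j ] (j < reg σ columns × H j)) × b ≡ 1) ⊎ ((∀ j → j < reg σ columns → ¬ H j) × b ≡ 0))))
    after {σ′} fr r = poly-store (reg σ′ found , eq , outcome r)
      where
      eq : arr σ′ matrix [ reg σ′ vertex * reg σ′ order + reg σ′ vertex ↦ reg σ′ found ] ≡ B₀ [ u * n + u ↦ reg σ′ found ]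
      eq rewrite arr-eq fr matrix refl | reg-eq fr vertex refl | reg-eq fr order refl = refl
      outcome : _ → _
      outcome (inj₁ (j , j< , h , e)) = inj₁ ((j , j< , h) , e)
      outcome (inj₂ (none , e)) = inj₂ (none , e)

  poly-compareRows : ∀ {n B col L u r σ} → reg σ order ≡ n → arr σ matrix ≡ B → arr σ cols ≡ col → reg σ columns ≡ L →
    reg σ vertex ≡ u → reg σ other ≡ r → L ≤ Z →
    Poly compareRows σ (λ σ′ → Searched L (λ j → B (u * n + col j) ≢ B (r * n + col j)) (λ _ → 1) (reg σ′ flag) 0)
  poly-compareRows {σ = σ} refl refl refl refl refl refl L≤Z =
    poly-seq (poly-assign (poly-search {index} {var columns} flag (λ _ → 1) H L≤Z step))
    where
    H : ℕ → Set
    H j = arr σ matrix (reg σ vertex * reg σ order + arr σ cols j) ≢ arr σ matrix (reg σ other * reg σ order + arr σ cols j)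
    body =
      left  ≔ cell matrix (var vertex ⊗ var order ⊕ cell cols (var index)) ⨾
      right ≔ cell matrix (var other ⊗ var order ⊕ cell cols (var index)) ⨾
      ifnz ((var left ⊖ var right) ⊕ (var right ⊖ var left)) (flag ≔ lit 1) skip
    step : ∀ {i σ′} → i < reg σ columns → Frame (for index (var columns) body) (setReg σ flag 0) σ′ → reg σ′ index ≡ i →
      Poly body σ′ (λ σ″ → (H i × reg σ″ flag ≡ 1) ⊎ (¬ H i × reg σ″ flag ≡ reg σ′ flag))
    step {i} {σ′} i< fr xi = poly-seq (poly-assign (poly-seq (poly-assign (poly-if
      (λ ≢0 → poly-assign (inj₁ ((λ e → ≢0 (same (trans eq₁ (trans e (sym eq₂))))) , refl)))
      (λ ≡0 → poly-skip (inj₂ ((λ h → h (trans (sym eq₁) (trans (m∸n+n∸m≡0⇒m≡n _ _ ≡0) eq₂))) , refl)))))))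
      where
      eq₁ = eval-at {index} fr xi (cell matrix (var vertex ⊗ var order ⊕ cell cols (var index)))
      eq₂ = eval-at {index} fr xi (cell matrix (var other ⊗ var order ⊕ cell cols (var index)))
      same : ∀ {a b} → a ≡ b → (a ∸ b) + (b ∸ a) ≡ 0
      same {a} refl = cong₂ _+_ (n∸n≡0 a) (n∸n≡0 a)

-- Agreement in the listed columns, doubly negated because it is reported as a failed search for a
-- column in which the rows differ.
Twin : ℕ → (ℕ → ℕ) → (ℕ → ℕ) → ℕ → ℕ → ℕ → Set
Twin n B col L u r = ∀ j → j < L → ¬ (B (u * n + col j) ≢ B (r * n + col j))

module Placing (W P : ℕ) (2≤P : 2 ≤ P) (P^16<W : P ^ 16 < W) (Z : ℕ) (2≤Z : 2 ≤ Z) where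

  open Run W P 2≤P P^16<W
  open Poly W P 2≤P P^16<W Z 2≤Z
  open Procedures W P 2≤P P^16<W Z 2≤Z

  poly-findTwin : ∀ {n k M B S col L u σ} → Store n k M B S σ → arr σ cols ≡ col → reg σ columns ≡ L →
    reg σ vertex ≡ u → L ≤ Z → M ≤ Z → M ≤ P →
    Poly findTwin σ (λ σ′ → Searched M (λ c → arr σ sizes c ≢ 0 × Twin n B col L u (arr σ members (c * n))) (_+ 1) (reg σ′ found) 0)
  poly-findTwin {σ = σ} record { order≡ = refl ; param≡ = refl ; classes≡ = refl ; matrix≡ = refl } refl refl refl L≤Z M≤Z M≤P =
    poly-seq $ poly-assign $ poly-search {class} {var classes} found (_+ 1) H M≤Z step
    where
    H : ℕ → Set
    H c = arr σ sizes c ≢ 0 × Twin (reg σ order) (arr σ matrix) (arr σ cols) (reg σ columns) (reg σ vertex) (arr σ members (c * reg σ order))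
    body = ifnz (cell sizes (var class))
      (other ≔ cell members (var class ⊗ var order) ⨾ compareRows ⨾ ifnz (var flag) skip (found ≔ var class ⊕ lit 1))
      skip
    step : ∀ {i σ′} → i < reg σ classes → Frame (for class (var classes) body) (setReg σ found 0) σ′ → reg σ′ class ≡ i →
      Poly body σ′ (λ σ″ → (H i × reg σ″ found ≡ i + 1) ⊎ (¬ H i × reg σ″ found ≡ reg σ′ found))
    step {i} {σ′} i< fr xi = poly-if
      (λ ≢0 → poly-seq $ poly-assign $ poly-seq $ poly-weaken (after (≢0 ∘ trans size-eq))
        (poly-compareRows (reg-eq fr order refl) (arr-eq fr matrix refl) (arr-eq fr cols refl) (reg-eq fr columns refl)
          (reg-eq fr vertex refl) (eval-at {class} fr xi (cell members (var class ⊗ var order))) L≤Z))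
      (λ ≡0 → poly-skip (inj₂ ((λ (≢0 , _) → ≢0 (trans (sym size-eq) ≡0)) , refl)))
      where
      size-eq = eval-at {class} fr xi (cell sizes (var class))
      σ₁ = setReg σ′ other (arr σ′ members (reg σ′ class * reg σ′ order))
      after : arr σ sizes i ≢ 0 → ∀ {σ″} → Frame compareRows σ₁ σ″ → Searched (reg σ columns) _ (λ _ → 1) (reg σ″ flag) 0 →
        Poly (ifnz (var flag) skip (found ≔ var class ⊕ lit 1)) σ″
          (λ σ‴ → (H i × reg σ‴ found ≡ i + 1) ⊎ (¬ H i × reg σ‴ found ≡ reg σ′ found))
      after ≢0 {σ″} fr′ r = poly-if (λ f≢0 → poly-skip (inj₂ (different f≢0 r , reg-eq fr′ found refl)))
        (λ f≡0 → poly-assign≤ (subst (_≤ P) (trans (+-comm 1 i) (sym i+1)) (≤-trans i< M≤P)) (inj₁ ((≢0 , equal f≡0 r) , i+1)))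
        where
        i+1 : reg σ″ class + 1 ≡ i + 1
        i+1 = cong (_+ 1) (trans (reg-eq fr′ class refl) xi)
        different : reg σ″ flag ≢ 0 → Searched (reg σ columns) _ (λ _ → 1) (reg σ″ flag) 0 → ¬ H i
        different f≢0 (inj₁ (j , j< , d , _)) (_ , twin) = twin j j< d
        different f≢0 (inj₂ (_ , f≡0)) _ = f≢0 f≡0
        equal : ∀ {Q} → reg σ″ flag ≡ 0 → Searched (reg σ columns) Q (λ _ → 1) (reg σ″ flag) 0 → ∀ j → j < reg σ columns → ¬ Q j
        equal f≡0 (inj₁ (_ , _ , _ , f≡1)) with () ← trans (sym f≡1) f≡0
        equal f≡0 (inj₂ (none , _)) = none

  poly-findEmpty : ∀ {σ M} → reg σ classes ≡ M → M ≤ Z → M ≤ P →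
    Poly findEmpty σ (λ σ′ → Searched M (λ c → arr σ sizes c ≡ 0) (_+ 1) (reg σ′ found) (reg σ found))
  poly-findEmpty {σ} refl M≤Z M≤P = poly-search {class} {var classes} found (_+ 1) (λ c → arr σ sizes c ≡ 0) M≤Z
    λ i< fr xi → let size-eq = eval-at {class} fr xi (cell sizes (var class)) in poly-if
      (λ ≢0 → poly-skip (inj₂ (≢0 ∘ trans size-eq , refl)))
      (λ ≡0 → poly-assign≤ (subst (_≤ P) (trans (+-comm 1 _) (cong (_+ 1) (sym xi))) (≤-trans i< M≤P))
        (inj₁ (trans (sym size-eq) ≡0 , cong (_+ 1) xi)))

  -- The register found contains e + 1, as 0 means that no class has been found.
  record Chosen (n k β : ℕ) (B : ℕ → ℕ) (S : ℕ → Set) (u : ℕ) (σ : State) : Set where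
    field
      {M e}  : ℕ
      stored : Store n k M B S σ
      M≤β    : M ≤ β
      e<M    : e < M
      found≡ : reg σ found ≡ e + 1
      to     : ∀ {x} → S x → arr σ clsOf x ≡ e → Row n B x u
      from   : ∀ {x} → S x → Row n B x u → arr σ clsOf x ≡ e

  -- The placing of u rests on two properties: the listed columns tell rows apart, and at most β
  -- rows are different. Keeping them abstract lets initialisation, with all vertices as columns,
  -- and updates share the argument.
  module _ {n k M β : ℕ} {B : ℕ → ℕ} {S : ℕ → Set} {col : ℕ → ℕ} {L u : ℕ}
    (u<n : u < n) (¬Su : ¬ S u) (L≤Z : L ≤ Z) (β≤Z : β ≤ Z) (β≤P : β ≤ P) (n≤P : n ≤ P) (M≤β : M ≤ β)
    (col< : ∀ {j} → j < L → col j < n)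
    (determined : ∀ {x y} → x < n → y < n → (∀ {j} → j < L → B (x * n + col j) ≡ B (y * n + col j)) → Row n B x y)
    (pigeonhole : ∀ {m} (f : ℕ → ℕ) → (∀ {c} → c < m → f c < n) →
      (∀ {c d} → c < m → d < m → Row n B (f c) (f d) → c ≡ d) → m ≤ β)
    where

    twin⇒row : ∀ {r} → r < n → Twin n B col L u r → Row n B u r
    twin⇒row r< twin = determined u<n r< λ {j} j< → decidable-stable (_ ≟ _) (twin j j<)

    row⇒twin : ∀ {r} → Row n B u r → Twin n B col L u r
    row⇒twin row j j< d = d (row (col< j<))

    chosen-twin : ∀ {σ} (st : Store n k M B S σ) → ∀ {e} → e < M → reg σ found ≡ e + 1 →
      arr σ sizes e ≢ 0 → Twin n B col L u (arr σ members (e * n)) → Chosen n k β B S u σ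
    chosen-twin {σ} st {e} e< fd ≢0 twin = record
      { stored = st ; M≤β = M≤β ; e<M = e< ; found≡ = fd
      ; to = λ {x} Sx eq → row-trans {n} {B} {x} {r} {u} (same-row C Sx Sr (trans eq (sym (cls-rep C e< ≢0)))) (row-sym {n} {B} {u} {r} row)
      ; from = λ {x} Sx x~u → trans (same-cls C Sx Sr (row-trans {n} {B} {x} {u} {r} x~u row)) (cls-rep C e< ≢0) }
      where
      C = partition st
      r = rep C e
      Sr = rep-placed C e< ≢0
      row = twin⇒row (rep< C e< ≢0) twin

    no-twins : ∀ {σ} (st : Store n k M B S σ) →
      (∀ c → c < M → ¬ (arr σ sizes c ≢ 0 × Twin n B col L u (arr σ members (c * n)))) →
      ∀ {x} → S x → ¬ Row n B x u
    no-twins {σ} st none {x} Sx r = none (arr σ clsOf x) (cls< C Sx) (nonempty C Sx ,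
      row⇒twin {rep C (arr σ clsOf x)} (row-trans {n} {B} {u} {x} {rep C (arr σ clsOf x)} (row-sym {n} {B} {x} {u} r) (row-rep C Sx)))
      where C = partition st

    chosen-empty : ∀ {σ} (st : Store n k M B S σ) → (∀ {x} → S x → ¬ Row n B x u) →
      ∀ {e} → e < M → reg σ found ≡ e + 1 → arr σ sizes e ≡ 0 → Chosen n k β B S u σ
    chosen-empty st none e< fd ≡0 = record
      { stored = st ; M≤β = M≤β ; e<M = e< ; found≡ = fd
      ; to = λ { Sx refl → ⊥-elim (nonempty (partition st) Sx ≡0) }
      ; from = λ Sx r → ⊥-elim (none Sx r) }

    -- The representatives of the classes and u have distinct rows.
    suc-M≤β : ∀ {σ} (st : Store n k M B S σ) → (∀ {x} → S x → ¬ Row n B x u) →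
      (∀ c → c < M → arr σ sizes c ≢ 0) → suc M ≤ β
    suc-M≤β {σ} st none full = pigeonhole (rep C [ M ↦ u ])
      (extend-below (λ _ x → x < n) (rep C) u (λ c< → rep< C c< (full _ c<)) u<n)
      (extend-injective (Row n B) (rep C) u
        (λ {c} {d} c< d< r → trans (sym (cls-rep C c< (full c c<)))
          (trans (same-cls C (rep-placed C c< (full c c<)) (rep-placed C d< (full d d<)) r) (cls-rep C d< (full d d<))))
        (λ c< → none (rep-placed C c< (full _ c<)))
        (λ {c} c< → none (rep-placed C c< (full _ c<)) ∘ row-sym {n} {B} {u} {rep C c}))
      where C = partition st

    poly-newClass : ∀ {σ} → Store n k M B S σ → (∀ {x} → S x → ¬ Row n B x u) → suc M ≤ β →
      Poly newClass σ (Chosen n k β B S u)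
    poly-newClass {σ} record { order≡ = refl ; param≡ = refl ; classes≡ = refl ; matrix≡ = refl ; partition = C } none sM≤ =
      poly-seq $ poly-store $ poly-seq $ poly-assign≤ (subst (_≤ P) (+-comm 1 (reg σ classes)) (≤-trans sM≤ β≤P)) $ poly-assign $
      record
        { M = suc M
        ; stored = record { order≡ = refl ; param≡ = refl ; classes≡ = +-comm M 1 ; matrix≡ = refl ; partition = classes-new C }
        ; M≤β = sM≤ ; e<M = n<1+n M ; found≡ = refl
        ; to = λ Sx eq → ⊥-elim (<⇒≢ (cls< C Sx) eq)
        ; from = λ Sx r → ⊥-elim (none Sx r) }

    M≤Z = ≤-trans M≤β β≤Z
    M≤P = ≤-trans M≤β β≤P

    poly-chooseClass : ∀ {σ} → Store n k M B S σ → arr σ cols ≡ col → reg σ columns ≡ L → reg σ vertex ≡ u →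
      Poly chooseClass σ (Chosen n k β B S u)
    poly-chooseClass {σ} st eq₁ eq₂ eq₃ = poly-seq $ poly-weaken afterTwin (poly-findTwin st eq₁ eq₂ eq₃ L≤Z M≤Z M≤P)
      where
      H : ℕ → Set
      H c = arr σ sizes c ≢ 0 × Twin n B col L u (arr σ members (c * n))
      e+1≢0 : ∀ e {r} → r ≡ e + 1 → r ≢ 0
      e+1≢0 e refl eq with () ← trans (+-comm 1 e) eq
      chosen⇒ : ∀ {σ′} → Chosen n k β B S u σ′ → Poly (ifnz (var found) skip newClass) σ′ (Chosen n k β B S u)
      chosen⇒ ch = poly-if (λ _ → poly-skip ch) (λ ≡0 → ⊥-elim (e+1≢0 (Chosen.e ch) (Chosen.found≡ ch) ≡0))
      afterTwin : ∀ {σ′} → Frame findTwin σ σ′ → Searched M H (_+ 1) (reg σ′ found) 0 →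
        Poly (ifnz (var found) skip findEmpty ⨾ ifnz (var found) skip newClass) σ′ (Chosen n k β B S u)
      afterTwin {σ′} fr (inj₁ (e , e< , (≢0 , twin) , eq)) = poly-seq $ poly-if
        (λ _ → poly-skip (chosen⇒ (chosen-twin (store-frame fr st) e< eq
          (≢0 ∘ trans (cong (λ a → a e) (sym (arr-eq fr sizes refl))))
          (subst (λ a → Twin n B col L u (a (e * n))) (sym (arr-eq fr members refl)) twin))))
        (λ ≡0 → ⊥-elim (e+1≢0 e eq ≡0))
      afterTwin {σ′} fr (inj₂ (none , eq)) = poly-seq $ poly-if
        (λ ≢0 → ⊥-elim (≢0 eq))
        (λ _ → poly-weaken afterEmpty (poly-findEmpty (classes≡ st′) M≤Z M≤P))
        where
        st′ = store-frame fr st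
        none′ = no-twins st none
        afterEmpty : ∀ {σ″} → Frame findEmpty σ′ σ″ → Searched M (λ c → arr σ′ sizes c ≡ 0) (_+ 1) (reg σ″ found) (reg σ′ found) →
          Poly (ifnz (var found) skip newClass) σ″ (Chosen n k β B S u)
        afterEmpty fr′ (inj₁ (e , e< , ≡0 , eq′)) =
          chosen⇒ (chosen-empty (store-frame fr′ st′) none′ e< eq′ (trans (cong (λ a → a e) (arr-eq fr′ sizes refl)) ≡0))
        afterEmpty fr′ (inj₂ (full , eq′)) = poly-if
          (λ ≢0 → ⊥-elim (≢0 (trans eq′ eq)))
          (λ _ → poly-newClass (store-frame fr′ st′) none′ (suc-M≤β st′ none′ full))

    poly-pushVertex : ∀ {σ} → Chosen n k β B S u σ → reg σ vertex ≡ u →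
      Poly pushVertex σ (λ σ′ → ∃[ M′ ] (M′ ≤ β × Store n k M′ B (λ x → S x ⊎ x ≡ u) σ′))
    poly-pushVertex {σ} record { M = M′ ; e = e ; stored = record { order≡ = refl ; param≡ = refl ; classes≡ = refl ; matrix≡ = refl ; partition = C }
                               ; M≤β = M′≤ ; e<M = e< ; found≡ = fd ; to = to ; from = from } refl =
      poly-seq $ poly-assign $ poly-seq $ poly-store $ poly-seq $ poly-store $ poly-seq $ poly-store $
      poly-store≤ (subst (λ e → arr σ sizes e + 1 ≤ P) (sym fd-1)
        (≤-trans (≤-reflexive (+-comm (arr σ sizes e) 1)) (≤-trans (size<n C e< u<n ¬Su) n≤P))) $
      M′ , M′≤ , record { order≡ = refl ; param≡ = refl ; classes≡ = refl ; matrix≡ = refl ; partition = part }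
      where
      fd-1 : reg σ found ∸ 1 ≡ e
      fd-1 = trans (cong (_∸ 1) fd) (m+n∸n≡m e 1)
      part : Classes (reg σ order) (arr σ matrix) (λ x → S x ⊎ x ≡ reg σ vertex) M′
        (arr σ clsOf [ reg σ vertex ↦ reg σ found ∸ 1 ]) (arr σ posOf [ reg σ vertex ↦ arr σ sizes (reg σ found ∸ 1) ])
        (arr σ members [ (reg σ found ∸ 1) * reg σ order + arr σ sizes (reg σ found ∸ 1) ↦ reg σ vertex ])
        (arr σ sizes [ reg σ found ∸ 1 ↦ arr σ sizes (reg σ found ∸ 1) + 1 ])
      part rewrite fd-1 | +-comm (arr σ sizes e) 1 = Push.classes-push C u<n ¬Su e< to from

    poly-placeVertex : ∀ {σ} → Store n k M B S σ → arr σ cols ≡ col → reg σ columns ≡ L → reg σ vertex ≡ u →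
      Poly placeVertex σ (λ σ′ → ∃[ M′ ] (M′ ≤ β × Store n k M′ B (λ x → S x ⊎ x ≡ u) σ′))
    poly-placeVertex st eq₁ eq₂ eq₃ = poly-seq $ poly-weaken
      (λ fr ch → poly-pushVertex ch (trans (reg-eq fr vertex refl) eq₃)) (poly-chooseClass st eq₁ eq₂ eq₃)

  poly-buildColumns : ∀ {n k M B S σ} → Store n k M B S σ → M ≤ Z → M + 2 ≤ P →
    Poly buildColumns σ (λ σ′ →
      (∀ c → c < M → arr σ sizes c ≢ 0 → arr σ′ cols c ≡ arr σ members (c * n)) ×
      (∀ c → c < M → arr σ sizes c ≡ 0 → arr σ′ cols c ≡ reg σ 0) ×
      arr σ′ cols M ≡ reg σ 0 × arr σ′ cols (M + 1) ≡ reg σ 1 × reg σ′ columns ≡ M + 2)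
  poly-buildColumns {σ = σ} record { order≡ = refl ; param≡ = refl ; classes≡ = refl ; matrix≡ = refl } M≤Z M+2≤P =
    poly-seq $ poly-weaken (λ _ → after) (poly-for {class} {var classes} I M≤Z (λ _ ()) step)
    where
    M = reg σ classes
    target : ℕ → ℕ
    target c with arr σ sizes c
    ... | zero  = reg σ 0
    ... | suc _ = arr σ members (c * reg σ order)
    target-≢0 : ∀ {c} → arr σ sizes c ≢ 0 → target c ≡ arr σ members (c * reg σ order)
    target-≢0 {c} ≢0 with arr σ sizes c
    ... | zero  = ⊥-elim (≢0 refl)
    ... | suc _ = refl
    target-≡0 : ∀ {c} → arr σ sizes c ≡ 0 → target c ≡ reg σ 0
    target-≡0 {c} ≡0 with arr σ sizes c
    ... | zero  = refl
    I : ℕ → State → Set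
    I i σ′ = ∀ c → c < i → arr σ′ cols c ≡ target c
    body = ifnz (cell sizes (var class)) (cols ⟨ var class ⟩≔ cell members (var class ⊗ var order)) (cols ⟨ var class ⟩≔ var 0)
    extend : ∀ {i σ′ j v} → j ≡ i → v ≡ target i → I i σ′ → ∀ c → c < suc i → (arr σ′ cols [ j ↦ v ]) c ≡ target c
    extend {i} {σ′} {_} {v} refl eq inv _ = extend-below (λ c x → x ≡ target c) (arr σ′ cols) v (inv _) eq
    step : ∀ {i σ′} → i < M → Frame (for class (var classes) body) σ σ′ → reg σ′ class ≡ i → I i σ′ →
      Poly body σ′ (λ σ″ → I (suc i) (setReg σ″ class (suc i)))
    step {i} {σ′} i< fr xi inv = poly-if
      (λ ≢0 → poly-store (extend {i} {σ′} xi (trans (eval-at {class} fr xi (cell members (var class ⊗ var order)))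
        (sym (target-≢0 (≢0 ∘ trans size-eq)))) inv))
      (λ ≡0 → poly-store (extend {i} {σ′} xi (trans (reg-eq fr 0 refl) (sym (target-≡0 (trans (sym size-eq) ≡0)))) inv))
      where size-eq = eval-at {class} fr xi (cell sizes (var class))
    after : ∀ {σ′} → Frame (for class (var classes) body) σ σ′ × I M σ′ → _
    after {σ′} (fr , inv) = poly-seq $ poly-store $ poly-seq $ poly-store $
      poly-assign≤ (subst (λ m → m + 2 ≤ P) (sym m≡) M+2≤P) $
      (λ c c< ≢0 → trans (old c<) (target-≢0 ≢0)) , (λ c c< ≡0 → trans (old c<) (target-≡0 ≡0)) ,
      at-M , at-M+1 , cong (_+ 2) m≡
      where
      m≡ : reg σ′ classes ≡ M
      m≡ = reg-eq fr classes refl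
      m = reg σ′ classes
      A₁ = arr σ′ cols [ m ↦ reg σ′ 0 ]
      A₂ = A₁ [ m + 1 ↦ reg σ′ 1 ]
      m+1≢ : ∀ {c} → c ≤ M → m + 1 ≢ c
      m+1≢ c≤ refl = <⇒≱ (≤-reflexive (+-comm 1 M)) (subst (λ m → m + 1 ≤ M) m≡ c≤)
      old : ∀ {c} → c < M → A₂ c ≡ target c
      old {c} c< = trans (update-other A₁ (reg σ′ 1) (m+1≢ (<⇒≤ c<)))
        (trans (update-other (arr σ′ cols) (reg σ′ 0) (λ eq → <⇒≢ c< (trans (sym eq) m≡))) (inv c c<))
      at-M : A₂ M ≡ reg σ 0
      at-M = trans (update-other A₁ (reg σ′ 1) (m+1≢ ≤-refl))
        (trans (subst (λ c → A₁ c ≡ reg σ′ 0) m≡ (update-same (arr σ′ cols) m (reg σ′ 0))) (reg-eq fr 0 refl))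
      at-M+1 : A₂ (M + 1) ≡ reg σ 1
      at-M+1 = trans (subst (λ c → A₂ (c + 1) ≡ reg σ′ 1) m≡ (update-same A₁ (m + 1) (reg σ′ 1))) (reg-eq fr 1 refl)

-- Exhaustive search for a cover of the representatives

checkPair : Cmd
checkPair =
  ifnz (cell sizes (var class) ⊗ cell sizes (var other))
    (flag ≔ lit 0 ⨾
     for index (var covers)
       (ifnz (cell table (var index ⊗ var classes ⊕ var class) ⊗ cell table (var index ⊗ var classes ⊕ var other))
         (flag ≔ lit 1) skip) ⨾
     left  ≔ cell members (var class ⊗ var order) ⨾
     right ≔ cell members (var other ⊗ var order) ⨾
     ifnz (cell matrix (var left ⊗ var order ⊕ var right))
       (ifnz (var flag) skip (bad ≔ lit 1))
       (ifnz (var flag) (bad ≔ lit 1) skip))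
    skip

checkTable : Cmd
checkTable = bad ≔ lit 0 ⨾ for class (var classes) (for other (var classes) checkPair)

-- The table is read as a binary number, least digit first. The carry turns ones into zeros until it
-- meets a zero; the overflow digit beyond the table is 0 while the search is on, so the carry stops
-- there at the latest.
increment : Cmd
increment =
  class ≔ lit 0 ⨾
  while (cell table (var class)) (table ⟨ var class ⟩≔ lit 0 ⨾ class ≔ var class ⊕ lit 1) ⨾
  table ⟨ var class ⟩≔ lit 1

-- The condition is non-zero only while the overflow digit, stored at `tableSize`, is 0 and no table
-- has been accepted. The digit becomes 1 when all tables have been rejected.
searchLoop : Cmd
searchLoop = while ((lit 1 ⊖ cell table (var tableSize)) ⊖ var solved) (checkTable ⨾ ifnz (var bad) increment (solved ≔ lit 1))

searchCover : Cmd
searchCover =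
  tableSize ≔ var covers ⊗ var classes ⨾
  -- One cell more than the table has entries, to clear the overflow digit as well.
  limit ≔ var tableSize ⊕ lit 1 ⨾
  for class (var limit) (table ⟨ var class ⟩≔ lit 0) ⨾
  searchLoop

-- The product in the condition acts as a conjunction: nothing has been found yet, and `covers` is
-- at most k.
findCover : Cmd
findCover =
  covers ≔ lit 0 ⨾
  solved ≔ lit 0 ⨾
  while ((lit 1 ⊖ var solved) ⊗ ((var param ⊕ lit 1) ⊖ var covers))
    (searchCover ⨾ ifnz (var solved) skip (covers ≔ var covers ⊕ lit 1))

record Env (n k M : ℕ) (B memb size : ℕ → ℕ) (σ : State) : Set where
  field
    env-order   : reg σ order ≡ n
    env-param   : reg σ param ≡ k
    env-classes : reg σ classes ≡ M
    env-matrix  : arr σ matrix ≡ B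
    env-members : arr σ members ≡ memb
    env-sizes   : arr σ sizes ≡ size

open Env

env-frame : ∀ {n k M B memb size p σ σ′} {h₁ : T (not (writesReg p order))} {h₂ : T (not (writesReg p param))}
  {h₃ : T (not (writesReg p classes))} {h₄ : T (not (writesArr p matrix))} {h₅ : T (not (writesArr p members))}
  {h₆ : T (not (writesArr p sizes))} → Frame p σ σ′ → Env n k M B memb size σ → Env n k M B memb size σ′
env-frame {h₁ = h₁} {h₂} {h₃} {h₄} {h₅} {h₆} fr env = record
  { env-order   = trans (reg-eq fr order (not-T h₁)) (env-order env)
  ; env-param   = trans (reg-eq fr param (not-T h₂)) (env-param env)
  ; env-classes = trans (reg-eq fr classes (not-T h₃)) (env-classes env)
  ; env-matrix  = trans (arr-eq fr matrix (not-T h₄)) (env-matrix env)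
  ; env-members = trans (arr-eq fr members (not-T h₅)) (env-members env)
  ; env-sizes   = trans (arr-eq fr sizes (not-T h₆)) (env-sizes env)
  }

record Carry (X : ℕ → ℕ) (i : ℕ) (X′ : ℕ → ℕ) : Set where
  field
    ones  : ∀ {j} → j < i → X j ≡ 1
    zeros : ∀ {j} → j < i → X′ j ≡ 0
    above : ∀ {j} → i ≤ j → X′ j ≡ X j

open Carry

module Search (W P : ℕ) (2≤P : 2 ≤ P) (P^16<W : P ^ 16 < W) (Z : ℕ) (2≤Z : 2 ≤ Z) where

  open Run W P 2≤P P^16<W
  open Poly W P 2≤P P^16<W Z 2≤Z

  poly-checkPair : ∀ {n k M B memb size K X c d σ} → Env n k M B memb size σ → reg σ covers ≡ K → arr σ table ≡ X →
    reg σ class ≡ c → reg σ other ≡ d → K ≤ Z →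
    Poly checkPair σ (λ σ′ → (Quotient.Bad n B M memb size K X c d × reg σ′ bad ≡ 1) ⊎
      (¬ Quotient.Bad n B M memb size K X c d × reg σ′ bad ≡ reg σ bad))
  poly-checkPair {σ = σ} record { env-order = refl ; env-param = refl ; env-classes = refl ; env-matrix = refl ; env-members = refl ; env-sizes = refl }
    refl refl refl refl K≤Z = poly-if
      (λ ≢0 → poly-seq $ poly-assign $ poly-seq $ poly-weaken (λ {σ′} → after (*-≢0ˡ ≢0) (*-≢0ʳ (arr σ sizes (reg σ class)) ≢0) {σ′})
        (poly-search {index} {var covers} flag (λ _ → 1) H K≤Z step))
      (λ ≡0 → poly-skip (inj₂ ((λ (sc , sd , _) → *-≢0 sc sd ≡0) , refl)))
    where
    open Quotient (reg σ order) (arr σ matrix) (reg σ classes) (arr σ members) (arr σ sizes)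
    c = reg σ class
    d = reg σ other
    H : ℕ → Set
    H = Both (arr σ table) c d
    σ₀ = setReg σ flag 0
    test = cell table (var index ⊗ var classes ⊕ var class) ⊗ cell table (var index ⊗ var classes ⊕ var other)
    body = ifnz test (flag ≔ lit 1) skip
    BadPair = Bad (reg σ covers) (arr σ table) c d
    step : ∀ {i σ′} → i < reg σ covers → Frame (for index (var covers) body) σ₀ σ′ → reg σ′ index ≡ i →
      Poly body σ′ (λ σ″ → (H i × reg σ″ flag ≡ 1) ⊎ (¬ H i × reg σ″ flag ≡ reg σ′ flag))
    step {i} {σ′} i< fr xi = poly-if
      (λ ≢0 → poly-assign (inj₁ (≢0 ∘ trans eq , refl)))
      (λ ≡0 → poly-skip (inj₂ ((λ h → h (trans (sym eq) ≡0)) , refl)))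
      where eq = eval-at {index} fr xi test
    after : arr σ sizes c ≢ 0 → arr σ sizes d ≢ 0 → ∀ {σ′} → Frame (for index (var covers) body) σ₀ σ′ →
      Searched (reg σ covers) H (λ _ → 1) (reg σ′ flag) 0 → Poly _ σ′ (λ σ″ → (BadPair × reg σ″ bad ≡ 1) ⊎ (¬ BadPair × reg σ″ bad ≡ reg σ bad))
    after sc sd {σ′} fr r = poly-seq $ poly-assign $ poly-seq $ poly-assign $ poly-if
      (λ b → poly-if (λ f → poly-skip (inj₂ (some b f r , reg-eq fr bad refl))) (λ f → poly-assign (inj₁ ((sc , sd , inj₁ (b ∘ trans entry , none f r)) , refl))))
      (λ b → poly-if (λ f → poly-assign (inj₁ ((sc , sd , inj₂ (trans (sym entry) b , one f r)) , refl))) (λ f → poly-skip (inj₂ (clean b f r , reg-eq fr bad refl))))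
      where
      entry : ⟦ cell matrix (cell members (var class ⊗ var order) ⊗ var order ⊕ cell members (var other ⊗ var order)) ⟧ σ′ ≡
        arr σ matrix (arr σ members (c * reg σ order) * reg σ order + arr σ members (d * reg σ order))
      entry = stable-eval fr (cell matrix (cell members (var class ⊗ var order) ⊗ var order ⊕ cell members (var other ⊗ var order))) tt
      none : reg σ′ flag ≡ 0 → Searched (reg σ covers) H (λ _ → 1) (reg σ′ flag) 0 → ∀ i → i < reg σ covers → ¬ H i
      none f (inj₁ (_ , _ , _ , f′)) with () ← trans (sym f′) f
      none f (inj₂ (none , _)) = none
      one : reg σ′ flag ≢ 0 → Searched (reg σ covers) H (λ _ → 1) (reg σ′ flag) 0 → ∃[ i ] (i < reg σ covers × H i)
      one f (inj₁ (i , i< , h , _)) = i , i< , h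
      one f (inj₂ (_ , f′)) = ⊥-elim (f f′)
      some : _ → reg σ′ flag ≢ 0 → Searched (reg σ covers) H (λ _ → 1) (reg σ′ flag) 0 → ¬ BadPair
      some b f r (_ , _ , inj₁ (_ , none)) = let (i , i< , h) = one f r in none i i< h
      some b f r (_ , _ , inj₂ (b′ , _)) = b (trans entry b′)
      clean : _ → reg σ′ flag ≡ 0 → Searched (reg σ covers) H (λ _ → 1) (reg σ′ flag) 0 → ¬ BadPair
      clean b f r (_ , _ , inj₁ (b′ , _)) = b′ (trans (sym entry) b)
      clean b f r (_ , _ , inj₂ (_ , i , i< , h)) = none f r i i< h

  poly-checkTable : ∀ {n k M B memb size K X σ} → Env n k M B memb size σ → reg σ covers ≡ K → arr σ table ≡ X → K ≤ Z → M ≤ Z →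
    Poly checkTable σ (λ σ′ → Searched M (λ c → ∃[ d ] (d < M × Quotient.Bad n B M memb size K X c d)) (λ _ → 1) (reg σ′ bad) 0)
  poly-checkTable {n} {k} {M} {B} {memb} {size} {K} {X} {σ} env refl refl K≤Z M≤Z =
    poly-seq $ poly-assign $ poly-weaken (λ {σ′} _ → subst (λ m → Searched m BadRow (λ _ → 1) (reg σ′ bad) 0) (env-classes env))
      (poly-search {class} {var classes} bad (λ _ → 1) BadRow (subst (_≤ Z) (sym (env-classes env)) M≤Z) row)
    where
    open Quotient n B M memb size
    BadRow : ℕ → Set
    BadRow c = ∃[ d ] (d < M × Bad K X c d)
    row : ∀ {c σ′} → c < reg σ classes → Frame (for class (var classes) (for other (var classes) checkPair)) (setReg σ bad 0) σ′ →
      reg σ′ class ≡ c → Poly (for other (var classes) checkPair) σ′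
        (λ σ″ → (BadRow c × reg σ″ bad ≡ 1) ⊎ (¬ BadRow c × reg σ″ bad ≡ reg σ′ bad))
    row {c} {σ′} c< fr xc = poly-weaken (λ _ → outcome)
      (poly-search {other} {var classes} bad (λ _ → 1) (Bad K X c) (subst (_≤ Z) (sym (env-classes env′)) M≤Z)
        (λ d< fr′ xd → poly-checkPair (env-frame fr′ env′) (trans (reg-eq fr′ covers refl) (reg-eq fr covers refl))
          (trans (arr-eq fr′ table refl) (arr-eq fr table refl)) (trans (reg-eq fr′ class refl) xc) xd K≤Z))
      where
      env′ : Env n k M B memb size σ′
      env′ = env-frame fr (record { Env env })
      M≡ = env-classes env′
      outcome : ∀ {r r₀} → Searched (reg σ′ classes) (Bad K X c) (λ _ → 1) r r₀ → (BadRow c × r ≡ 1) ⊎ (¬ BadRow c × r ≡ r₀)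
      outcome (inj₁ (d , d< , b , e)) = inj₁ ((d , subst (d <_) M≡ d< , b) , e)
      outcome (inj₂ (none , e)) = inj₂ ((λ (d , d< , b) → none d (subst (d <_) (sym M≡) d<) b) , e)

  poly-increment : ∀ {X L σ} → arr σ table ≡ X → Bits (suc L) X → X L ≡ 0 → L ≤ P → L ≤ Z →
    Poly increment σ (λ σ′ → Bits (suc L) (arr σ′ table) × value (suc L) (arr σ′ table) ≡ suc (value (suc L) X))
  poly-increment {X} {L} {σ} refl bits XL≡0 L≤P L≤Z =
    poly-seq $ poly-assign $ poly-seq $ poly-weaken (λ _ → after)
      (poly-while {cell table (var class)} I (λ {σ′} → stop {σ′}) (λ _ → step) L L≤Z (refl , record { ones = λ () ; zeros = λ () ; above = λ _ → refl }))
    where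
    I : ℕ → State → Set
    I m σ′ = reg σ′ class + m ≡ L × Carry X (reg σ′ class) (arr σ′ table)
    stop : ∀ {σ′} → I 0 σ′ → arr σ′ table (reg σ′ class) ≡ 0
    stop {σ′} (eq , C) = trans (above C ≤-refl) (trans (cong X (trans (sym (+-identityʳ (reg σ′ class))) eq)) XL≡0)
    step : ∀ {m σ′} → I (suc m) σ′ → arr σ′ table (reg σ′ class) ≢ 0 →
      Poly (table ⟨ var class ⟩≔ lit 0 ⨾ class ≔ var class ⊕ lit 1) σ′ (I m)
    step {m} {σ′} (eq , C) ≢0 = poly-seq $ poly-store $
      poly-assign≤ (≤-trans (≤-reflexive (+-comm i 1)) (≤-trans i<L L≤P)) $
      trans (+-assoc i 1 m) eq , subst (λ i′ → Carry X i′ (arr σ′ table [ i ↦ 0 ])) (+-comm 1 i) next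
      where
      i = reg σ′ class
      i<L : i < L
      i<L = ≤-trans (m≤m+n (suc i) m) (≤-reflexive (trans (sym (+-suc i m)) eq))
      Xi : X i ≡ 1
      Xi with bits i (m<n⇒m<1+n i<L)
      ... | inj₁ ≡0 = ⊥-elim (≢0 (trans (above C ≤-refl) ≡0))
      ... | inj₂ ≡1 = ≡1
      next : Carry X (suc i) (arr σ′ table [ i ↦ 0 ])
      next = record
        { ones = λ j< → one (below-suc j<)
        ; zeros = λ j< → zero′ (below-suc j<)
        ; above = λ i<j → trans (update-other (arr σ′ table) 0 (<⇒≢ i<j)) (above C (<⇒≤ i<j)) }
        where
        one : ∀ {j} → j < i ⊎ j ≡ i → X j ≡ 1
        one (inj₁ j<) = ones C j<
        one (inj₂ refl) = Xi
        zero′ : ∀ {j} → j < i ⊎ j ≡ i → (arr σ′ table [ i ↦ 0 ]) j ≡ 0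
        zero′ (inj₁ j<) = trans (update-other (arr σ′ table) 0 (≢-sym (<⇒≢ j<))) (zeros C j<)
        zero′ (inj₂ refl) = update-same (arr σ′ table) i 0
    after : ∀ {σ′} → ∃[ m ] (I m σ′ × arr σ′ table (reg σ′ class) ≡ 0) →
      Poly (table ⟨ var class ⟩≔ lit 1) σ′ (λ σ″ → Bits (suc L) (arr σ″ table) × value (suc L) (arr σ″ table) ≡ suc (value (suc L) X))
    after {σ′} (m , (eq , C) , ≡0) = poly-store (bits′ , value-carry {X} {X′} {i} (ones C)
      (λ j< → trans (old (≢-sym (<⇒≢ j<))) (zeros C j<)) (trans (sym (above C ≤-refl)) ≡0) new
      (λ i<j → trans (old (<⇒≢ i<j)) (above C (<⇒≤ i<j))) (s≤s (≤-trans (m≤m+n i m) (≤-reflexive eq))))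
      where
      i = reg σ′ class
      X′ = arr σ′ table [ i ↦ 1 ]
      new : X′ i ≡ 1
      new = update-same (arr σ′ table) i 1
      old : ∀ {j} → i ≢ j → X′ j ≡ arr σ′ table j
      old = update-other (arr σ′ table) 1
      bits′ : Bits (suc L) X′
      bits′ j j< with <-cmp j i
      ... | tri< j<i _ _ = inj₁ (trans (old (≢-sym (<⇒≢ j<i))) (zeros C j<i))
      ... | tri≈ _ refl _ = inj₂ new
      ... | tri> _ _ i<j = subst (λ x → x ≡ 0 ⊎ x ≡ 1) (sym (trans (old (<⇒≢ i<j)) (above C (<⇒≤ i<j)))) (bits j j<)

  module _ {n k M : ℕ} {B memb size : ℕ → ℕ} where

    open Quotient n B M memb size

    -- All bit tables preceding the current one in the enumeration have been rejected.
    data SearchState (K L m : ℕ) (σ : State) : Set where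
      success : reg σ solved ≡ 1 → Good K (arr σ table) → SearchState K L m σ
      pending : reg σ solved ≡ 0 → value (suc L) (arr σ table) + m ≡ 2 ^ L →
        (∀ {Y} → Bits L Y → value L Y < value (suc L) (arr σ table) → ¬ Good K Y) → SearchState K L m σ

    NoTable : ℕ → Set
    NoTable K = ∀ Y → Bits (K * M) Y → ¬ Good K Y

    Outcome : ℕ → State → Set
    Outcome K σ = (reg σ solved ≡ 1 × Good K (arr σ table)) ⊎ (reg σ solved ≡ 0 × NoTable K)

    poly-searchLoop : ∀ {K σ} → Env n k M B memb size σ → reg σ covers ≡ K → reg σ tableSize ≡ K * M → reg σ solved ≡ 0 →
      (∀ {i} → i < suc (K * M) → arr σ table i ≡ 0) →
      K ≤ Z → M ≤ Z → K * M ≤ P → 2 ^ (K * M) ≤ Z → Poly searchLoop σ (Outcome K)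
    poly-searchLoop {K} {σ} env K≡ L≡ solved≡0 empty K≤Z M≤Z L≤P 2^L≤Z =
      poly-weaken finish (poly-while {(lit 1 ⊖ cell table (var tableSize)) ⊖ var solved} I stop step (2 ^ L) 2^L≤Z start)
      where
      L = K * M

      I : ℕ → State → Set
      I m σ′ = Bits (suc L) (arr σ′ table) × SearchState K L m σ′ × reg σ′ tableSize ≡ L

      condition-solved : ∀ {x s} → s ≡ 1 → (1 ∸ x) ∸ s ≡ 0
      condition-solved {x} refl = m≤n⇒m∸n≡0 (m∸n≤m 1 x)

      condition-1 : ∀ {x s} → x ≡ 1 → (1 ∸ x) ∸ s ≡ 0
      condition-1 {s = s} refl = 0∸n≡0 s

      start : I (2 ^ L) σ
      start = (λ _ i< → inj₁ (empty i<)) , pending solved≡0 (cong (_+ 2 ^ L) 0≡) (λ {Y} _ v< → ⊥-elim (n≮0 (subst (value L Y <_) 0≡ v<))) , L≡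
        where 0≡ = value-zero (suc L) {arr σ table} empty

      stop : ∀ {σ′} → I 0 σ′ → (1 ∸ arr σ′ table (reg σ′ tableSize)) ∸ reg σ′ solved ≡ 0
      stop {σ′} (bits , success s _ , _) = condition-solved {arr σ′ table (reg σ′ tableSize)} s
      stop {σ′} (bits , pending s v _ , l) with bits L (n<1+n L)
      ... | inj₂ ≡1 = condition-1 {s = reg σ′ solved} (trans (cong (arr σ′ table) l) ≡1)
      ... | inj₁ ≡0 = ⊥-elim (<⇒≢ (value<2^L L {arr σ′ table} (bits-pred bits))
        (trans (sym (value-0 L ≡0)) (trans (sym (+-identityʳ _)) v)))

      step : ∀ {m σ′} → Frame searchLoop σ σ′ → I (suc m) σ′ → (1 ∸ arr σ′ table (reg σ′ tableSize)) ∸ reg σ′ solved ≢ 0 →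
        Poly (checkTable ⨾ ifnz (var bad) increment (solved ≔ lit 1)) σ′ (I m)
      step {m} {σ′} fr (bits , success s _ , _) ≢0 = ⊥-elim (≢0 (condition-solved {arr σ′ table (reg σ′ tableSize)} s))
      step {m} {σ′} fr (bits , pending s v rejected , l) ≢0 with bits L (n<1+n L)
      ... | inj₂ ≡1 = ⊥-elim (≢0 (condition-1 {s = reg σ′ solved} (trans (cong (arr σ′ table) l) ≡1)))
      ... | inj₁ ≡0 = poly-seq $ poly-weaken checked
            (poly-checkTable (env-frame fr env) (trans (reg-eq fr covers refl) K≡) refl K≤Z M≤Z)
        where
        X = arr σ′ table
        checked : ∀ {σ″} → Frame checkTable σ′ σ″ →
          Searched M (λ c → ∃[ d ] (d < M × Bad K X c d)) (λ _ → 1) (reg σ″ bad) 0 →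
          Poly (ifnz (var bad) increment (solved ≔ lit 1)) σ″ (I m)
        checked {σ″} fr′ (inj₂ (good , bad≡0)) = poly-if (λ ≢0 → ⊥-elim (≢0 bad≡0)) (λ _ → poly-assign
          (subst (Bits (suc L)) (sym (arr-eq fr′ table refl)) bits ,
           success refl (subst (Good K) (sym (arr-eq fr′ table refl)) good) , trans (reg-eq fr′ tableSize refl) l))
        checked {σ″} fr′ (inj₁ (c , c< , b , bad≡1)) = poly-if
          (λ _ → poly-weaken (λ {σ‴} fr″ (bits′ , v′) → bits′ ,
              pending (trans (reg-eq fr″ solved refl) (trans (reg-eq fr′ solved refl) s))
                (trans (cong (_+ m) v′) (trans (sym (+-suc _ m)) v)) (reject σ‴ v′) ,
              trans (reg-eq fr″ tableSize refl) (trans (reg-eq fr′ tableSize refl) l))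
            (poly-increment {X} {L} (arr-eq fr′ table refl) bits ≡0 L≤P (≤-trans (a≤2^a L) 2^L≤Z)))
          (λ ≡0 → contradiction (trans (sym bad≡1) ≡0) λ ())
          where
          reject : ∀ σ‴ → value (suc L) (arr σ‴ table) ≡ suc (value (suc L) X) →
            ∀ {Y} → Bits L Y → value L Y < value (suc L) (arr σ‴ table) → ¬ Good K Y
          reject σ‴ v′ {Y} bY v< good with below-suc (subst (value L Y <_) v′ v<)
          ... | inj₁ v<X = rejected bY v<X good
          -- Y has the value of the table just checked, hence the same digits, and that table has a
          -- bad pair in row c.
          ... | inj₂ v≡X = good-ext (value-injective L bY (bits-pred bits) (trans v≡X (value-0 L ≡0))) good c c< b

      finish : ∀ {σ′} → _ → ∃[ m ] (I m σ′ × (1 ∸ arr σ′ table (reg σ′ tableSize)) ∸ reg σ′ solved ≡ 0) → Outcome K σ′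
      finish _ (m , (bits , success s good , _) , _) = inj₁ (s , good)
      finish {σ′} _ (m , (bits , pending s v rejected , l) , cond≡0) = inj₂ (s , λ Y bY → rejected bY (≤-trans (value<2^L L bY) full))
        where
        full : 2 ^ L ≤ value (suc L) (arr σ′ table)
        full with bits L (n<1+n L)
        ... | inj₂ ≡1 = ≤-trans (m≤n+m (2 ^ L) (value L (arr σ′ table))) (≤-reflexive (sym (value-1 L ≡1)))
        -- With overflow digit 0 and nothing solved, the loop condition would be 1.
        ... | inj₁ ≡0 with () ← trans (sym cond≡0) (cong₂ (λ x s → (1 ∸ x) ∸ s) (trans (cong (arr σ′ table) l) ≡0) s)

    poly-searchCover : ∀ {K σ} → Env n k M B memb size σ → reg σ covers ≡ K → reg σ solved ≡ 0 →
      K ≤ Z → M ≤ Z → suc (K * M) ≤ P → 2 ^ (K * M) ≤ Z → suc (K * M) ≤ Z → Poly searchCover σ (Outcome K)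
    poly-searchCover {K} {σ} env K≡ solved≡0 K≤Z M≤Z L<P 2^L≤Z L<Z =
      poly-seq $ poly-assign≤ (subst (_≤ P) (sym L≡) (<⇒≤ L<P)) $
      poly-seq $ poly-assign≤ (subst (λ l → l + 1 ≤ P) (sym L≡) (≤-trans (≤-reflexive (+-comm L 1)) L<P)) $
      poly-seq $ poly-weaken (λ { _ (fr , empty) → poly-searchLoop (env-frame fr (record { Env env }))
        (trans (reg-eq fr covers refl) K≡) (trans (reg-eq fr tableSize refl) L≡) (trans (reg-eq fr solved refl) solved≡0)
        (λ {i} i< → empty i (subst (i <_) (sym L+1≡) i<)) K≤Z M≤Z (<⇒≤ L<P) 2^L≤Z })
      (poly-for {class} {var limit} (λ i σ′ → ∀ j → j < i → arr σ′ table j ≡ 0) (subst (_≤ Z) (sym L+1≡) L<Z) (λ _ ())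
        (λ {i} {σ′} i< fr xi empty → poly-store (λ j j< → extend {σ′} xi empty j<)))
      where
      L = K * M
      L≡ : reg σ covers * reg σ classes ≡ L
      L≡ = cong₂ _*_ K≡ (env-classes env)
      L+1≡ : reg σ covers * reg σ classes + 1 ≡ suc L
      L+1≡ = trans (+-comm _ 1) (cong suc L≡)
      extend : ∀ {σ′ i x} → x ≡ i → (∀ j → j < i → arr σ′ table j ≡ 0) → ∀ {j} → j < suc i → (arr σ′ table [ x ↦ 0 ]) j ≡ 0
      extend {σ′} refl empty = extend-below (λ _ x → x ≡ 0) (arr σ′ table) 0 (empty _) refl

    Found : ℕ → State → Set
    Found s σ = reg σ solved ≡ 1 × reg σ covers ≤ k × reg σ covers ≤ s × Good (reg σ covers) (arr σ table)

    Impossible : State → Set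
    Impossible σ = reg σ solved ≡ 0 × (∀ K → K ≤ k → NoTable K)

    poly-findCover : ∀ {s Y σ} → Env n k M B memb size σ → (∀ L → Bits L Y) → Good s Y → M ≤ Z → suc k ≤ P →
      (∀ {K} → K ≤ k → suc (K * M) ≤ P) → suc s ≤ Z → 2 ^ (s * M) ≤ Z → suc (s * M) ≤ Z →
      Poly findCover σ (λ σ′ → Found s σ′ ⊎ Impossible σ′)
    poly-findCover {s} {Y} {σ} env bY goodY M≤Z k<P L<P s<Z 2^L≤Z L<Z =
      poly-seq $ poly-assign $ poly-seq $ poly-assign $ poly-weaken (λ _ → finish)
        (poly-while {(lit 1 ⊖ var solved) ⊗ ((var param ⊕ lit 1) ⊖ var covers)} I stop step (suc s) s<Z
          (inj₂ (refl , refl , z≤n , (λ _ ())) , record { Env env }))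
      where
      Pending : ℕ → State → Set
      Pending m σ′ = reg σ′ solved ≡ 0 × reg σ′ covers + m ≡ suc s × reg σ′ covers ≤ suc k ×
        (∀ K → K < reg σ′ covers → NoTable K)

      I : ℕ → State → Set
      I m σ′ = (Found s σ′ ⊎ Pending m σ′) × Env n k M B memb size σ′

      stop : ∀ {σ′} → I 0 σ′ → (1 ∸ reg σ′ solved) * ((reg σ′ param + 1) ∸ reg σ′ covers) ≡ 0
      stop {σ′} (inj₁ (eq , _) , _) = cong (λ x → (1 ∸ x) * ((reg σ′ param + 1) ∸ reg σ′ covers)) eq
      -- With no rounds left `covers` has passed s, although Y shows that s cliques suffice.
      stop {σ′} (inj₂ (_ , K≡ , _ , none) , _) =
        ⊥-elim (none s (≤-reflexive (trans (sym K≡) (+-identityʳ _))) Y (bY (s * M)) goodY)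

      body = searchCover ⨾ ifnz (var solved) skip (covers ≔ var covers ⊕ lit 1)

      step : ∀ {m σ′} → _ → I (suc m) σ′ → (1 ∸ reg σ′ solved) * ((reg σ′ param + 1) ∸ reg σ′ covers) ≢ 0 → Poly body σ′ (I m)
      step {m} {σ′} _ (inj₁ (eq , _) , _) ≢0 = ⊥-elim (≢0 (cong (λ x → (1 ∸ x) * ((reg σ′ param + 1) ∸ reg σ′ covers)) eq))
      step {m} {σ′} _ (inj₂ (eq , K+m , _ , none) , env′) ≢0 = poly-seq $ poly-weaken searched
          (poly-searchCover env′ refl eq (≤-trans K≤s (<⇒≤ s<Z)) M≤Z (L<P K≤k)
            (≤-trans (^-monoʳ-≤ 2 (*-monoˡ-≤ M K≤s)) 2^L≤Z) (≤-trans (s≤s (*-monoˡ-≤ M K≤s)) L<Z))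
        where
        K = reg σ′ covers
        K≤s : K ≤ s
        K≤s = s≤s⁻¹ (≤-trans (m≤m+n (suc K) m) (≤-reflexive (trans (sym (+-suc K m)) K+m)))
        K≤k : K ≤ k
        K≤k = s≤s⁻¹ (subst (K <_) (trans (+-comm _ 1) (cong suc (env-param env′)))
          (m∸n≢0⇒n<m (*-≢0ʳ (1 ∸ reg σ′ solved) ≢0)))
        searched : ∀ {σ″} → Frame searchCover σ′ σ″ → Outcome K σ″ → Poly (ifnz (var solved) skip (covers ≔ var covers ⊕ lit 1)) σ″ (I m)
        searched {σ″} fr (inj₁ (eq′ , good)) = poly-if
          (λ _ → poly-skip (inj₁ (eq′ , subst (_≤ k) (sym K≡) K≤k , subst (_≤ s) (sym K≡) K≤s , subst (λ K → Good K (arr σ″ table)) (sym K≡) good) , env-frame fr env′))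
          (λ ≡0 → contradiction (trans (sym eq′) ≡0) λ ())
          where K≡ = reg-eq fr covers refl
        searched {σ″} fr (inj₂ (eq′ , no-table)) = poly-if (λ ≢0 → ⊥-elim (≢0 eq′))
          (λ _ → poly-assign≤ (subst (_≤ P) (sym K+1≡) (≤-trans (s≤s K≤k) k<P))
            (inj₂ (eq′ , trans (cong (_+ m) K+1≡) (trans (sym (+-suc K m)) K+m) , subst (_≤ suc k) (sym K+1≡) (s≤s K≤k) ,
              (λ K′ K′< → none′ K′ (subst (K′ <_) K+1≡ K′<))) , record { Env (env-frame fr env′) }))
          where
          K+1≡ : reg σ″ covers + 1 ≡ suc K
          K+1≡ = trans (+-comm _ 1) (cong suc (reg-eq fr covers refl))
          none′ : ∀ K′ → K′ < suc K → NoTable K′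
          none′ K′ K′< with below-suc K′<
          ... | inj₁ K′<K = none K′ K′<K
          ... | inj₂ refl = no-table

      finish : ∀ {σ′} → ∃[ m ] (I m σ′ × (1 ∸ reg σ′ solved) * ((reg σ′ param + 1) ∸ reg σ′ covers) ≡ 0) → Found s σ′ ⊎ Impossible σ′
      finish (m , (inj₁ found , _) , _) = inj₁ found
      finish {σ′} (m , (inj₂ (eq , _ , _ , none) , env′) , ≡0) = inj₂ (eq , λ K K≤k → none K (≤-trans (s≤s K≤k) k<))
        where
        k< : suc k ≤ reg σ′ covers
        k< = subst (_≤ reg σ′ covers) (trans (+-comm _ 1) (cong suc (env-param env′)))
          (m∸n≡0⇒m≤n (trans (sym (+-identityʳ _)) (subst (λ x → (1 ∸ x) * ((reg σ′ param + 1) ∸ reg σ′ covers) ≡ 0) eq ≡0)))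

-- The rows of list before row a are complete; for row a the numbers below i have been considered.
record Filling (H : ℕ → ℕ → Set) (stride m a i : ℕ) (list count : ℕ → ℕ) : Set where
  field
    filled  : ∀ {o} → o < a → Selection (H o) m (count o) (λ j → list (o * stride + j))
    current : Selection (H a) i (count a) (λ j → list (a * stride + j))

open Filling

Filled : (H : ℕ → ℕ → Set) (stride m a : ℕ) (list count : ℕ → ℕ) → Set
Filled H stride m a list count = ∀ o → o < a → Selection (H o) m (count o) (λ j → list (o * stride + j))

module _ {H : ℕ → ℕ → Set} {stride m a : ℕ} {list count : ℕ → ℕ} where

  filling-start : Filled H stride m a list count → Filling H stride m a 0 list (count [ a ↦ 0 ])
  filling-start f = record
    { filled = λ {o} o< → subst (λ c → Selection _ m c _) (sym (update-other count 0 (≢-sym (<⇒≢ o<)))) (f o o<)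
    ; current = subst (λ c → Selection _ 0 c _) (sym (update-same count a 0)) selection-empty }

  filling-finish : Filling H stride m a m list count → Filled H stride m (suc a) list count
  filling-finish f o o< with below-suc o<
  ... | inj₁ o<a  = filled f o<a
  ... | inj₂ refl = current f

  filling-skip : ∀ {i} → Filling H stride m a i list count → ¬ H a i → Filling H stride m a (suc i) list count
  filling-skip f ¬h = record { filled = filled f ; current = selection-skip (current f) ¬h }

  filling-push : ∀ {i} → m ≤ stride → i < m → Filling H stride m a i list count → H a i →
    Filling H stride m a (suc i) (list [ a * stride + count a ↦ i ]) (count [ a ↦ suc (count a) ])
  filling-push {i} m≤ i< f h = record
    { filled = λ {o} o< → subst (λ c → Selection (H o) m c (row o)) (sym (update-other count _ (≢-sym (<⇒≢ o<))))
        (selection-ext (λ j< → update-otherRow list a (count a) o _ i l< (≤-trans j< (≤-trans (size≤ (filled f o<)) m≤)) (≢-sym (<⇒≢ o<))) (filled f o<))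
    ; current = subst (λ c → Selection (H a) (suc i) c (row a)) (sym (update-same count a _))
        (selection-push (current f) h
          (λ j< → update-otherCol list a (count a) a _ i l< (<-trans j< l<) (≢-sym (<⇒≢ j<)))
          (update-same list (a * stride + count a) i)) }
    where
    row : ℕ → ℕ → ℕ
    row o j = (list [ a * stride + count a ↦ i ]) (o * stride + j)
    l< : count a < stride
    l< = ≤-<-trans (size≤ (current f)) (≤-trans i< m≤)

-- Lists prepared for the queries

cliqueList cliqueSize nameList nameCount : ℕ
cliqueList = 7
cliqueSize = 8
nameList   = 9
nameCount  = 10

listClasses : Cmd
listClasses =
  for index (var covers)
    (cliqueSize ⟨ var index ⟩≔ lit 0 ⨾
     for class (var classes)
       (ifnz (cell table (var index ⊗ var classes ⊕ var class) ⊗ cell sizes (var class))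
         (cliqueList ⟨ var index ⊗ var order ⊕ cell cliqueSize (var index) ⟩≔ var class ⨾
          cliqueSize ⟨ var index ⟩≔ cell cliqueSize (var index) ⊕ lit 1)
         skip))

listNames : Cmd
listNames =
  for class (var classes)
    (nameCount ⟨ var class ⟩≔ lit 0 ⨾
     for index (var covers)
       (ifnz (cell table (var index ⊗ var classes ⊕ var class))
         (nameList ⟨ var class ⊗ var param ⊕ cell nameCount (var class) ⟩≔ var index ⨾
          nameCount ⟨ var class ⟩≔ cell nameCount (var class) ⊕ lit 1)
         skip))

solveCover : Cmd
solveCover = findCover ⨾ ifnz (var solved) (listClasses ⨾ listNames) skip ⨾ emit (var solved)

-- The factor `size c` keeps empty classes out of the lists: a query would spend time on them
-- without producing output.
InClique : ℕ → (X size : ℕ → ℕ) → ℕ → ℕ → Set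
InClique M X size i c = X (i * M + c) * size c ≢ 0

HasName : ℕ → (X : ℕ → ℕ) → ℕ → ℕ → Set
HasName M X c i = X (i * M + c) ≢ 0

data Answer {n} (k : ℕ) (G : Graph n) (M : ℕ) (σ : State) : Maybe (NamedFamily n) → Set where
  unsolvable : ¬ HasEdgeCliqueCover G k → Answer k G M σ nothing
  maintained : reg σ covers ≤ k →
    IsEdgeCliqueCover G (clique (family n (reg σ covers) M (arr σ table) (arr σ clsOf))) →
    Filled (InClique M (arr σ table) (arr σ sizes)) n M (reg σ covers) (arr σ cliqueList) (arr σ cliqueSize) →
    Filled (HasName M (arr σ table)) k (reg σ covers) M (arr σ nameList) (arr σ nameCount) →
    Answer k G M σ (just (family n (reg σ covers) M (arr σ table) (arr σ clsOf)))

answer-frame : ∀ {n k} {G : Graph n} {M p σ σ′ 𝒞} {h₁ : T (not (writesReg p covers))} {h₂ : T (not (writesArr p table))}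
  {h₃ : T (not (writesArr p clsOf))} {h₄ : T (not (writesArr p sizes))} {h₅ : T (not (writesArr p cliqueList))}
  {h₆ : T (not (writesArr p cliqueSize))} {h₇ : T (not (writesArr p nameList))} {h₈ : T (not (writesArr p nameCount))} →
  Frame p σ σ′ → Answer k G M σ 𝒞 → Answer k G M σ′ 𝒞
answer-frame fr (unsolvable h) = unsolvable h
answer-frame {h₁ = h₁} {h₂} {h₃} {h₄} {h₅} {h₆} {h₇} {h₈} fr (maintained a b c d)
  rewrite sym (reg-eq fr covers (not-T h₁)) | sym (arr-eq fr table (not-T h₂)) | sym (arr-eq fr clsOf (not-T h₃))
        | sym (arr-eq fr sizes (not-T h₄)) | sym (arr-eq fr cliqueList (not-T h₅)) | sym (arr-eq fr cliqueSize (not-T h₆))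
        | sym (arr-eq fr nameList (not-T h₇)) | sym (arr-eq fr nameCount (not-T h₈)) = maintained a b c d

module Listing (W P : ℕ) (2≤P : 2 ≤ P) (P^16<W : P ^ 16 < W) (Z : ℕ) (2≤Z : 2 ≤ Z) where

  open Run W P 2≤P P^16<W
  open Poly W P 2≤P P^16<W Z 2≤Z
  open Search W P 2≤P P^16<W Z 2≤Z

  poly-listClasses : ∀ {n M K X size σ} → reg σ order ≡ n → reg σ classes ≡ M → reg σ covers ≡ K → arr σ table ≡ X → arr σ sizes ≡ size →
    K ≤ Z → M ≤ Z → M ≤ n → n ≤ P →
    Poly listClasses σ (λ σ′ → Filled (InClique M X size) n M K (arr σ′ cliqueList) (arr σ′ cliqueSize))
  poly-listClasses {σ = σ} refl refl refl refl refl K≤Z M≤Z M≤n n≤P = poly-weaken (λ { _ (_ , f) → f })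
    (poly-for {index} {var covers} (λ a σ′ → Filled H n M a (arr σ′ cliqueList) (arr σ′ cliqueSize)) K≤Z (λ _ ()) row)
    where
    n = reg σ order
    M = reg σ classes
    H = InClique M (arr σ table) (arr σ sizes)
    test = cell table (var index ⊗ var classes ⊕ var class) ⊗ cell sizes (var class)
    inner = ifnz test
         (cliqueList ⟨ var index ⊗ var order ⊕ cell cliqueSize (var index) ⟩≔ var class ⨾
          cliqueSize ⟨ var index ⟩≔ cell cliqueSize (var index) ⊕ lit 1)
         skip
    outer = cliqueSize ⟨ var index ⟩≔ lit 0 ⨾ for class (var classes) inner
    row : ∀ {a σ′} → a < reg σ covers → Frame (for index (var covers) outer) σ σ′ → reg σ′ index ≡ a →
      Filled H n M a (arr σ′ cliqueList) (arr σ′ cliqueSize) →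
      Poly outer σ′ (λ σ″ → Filled H n M (suc a) (arr σ″ cliqueList) (arr σ″ cliqueSize))
    row {a} {σ′} a< fr refl f = poly-seq $ poly-store $ poly-weaken
      (λ { {σ″} _ (_ , g) → filling-finish (subst (λ m → Filling H n M a m (arr σ″ cliqueList) (arr σ″ cliqueSize)) M≡ g) })
      (poly-for {class} {var classes} (λ i σ″ → Filling H n M a i (arr σ″ cliqueList) (arr σ″ cliqueSize))
        (subst (_≤ Z) (sym M≡) M≤Z) (filling-start f) entry)
      where
      M≡ : reg σ′ classes ≡ M
      M≡ = reg-eq fr classes refl
      entry : ∀ {i σ″} → i < reg σ′ classes → Frame (for class (var classes) inner) (setCell σ′ cliqueSize a 0) σ″ → reg σ″ class ≡ i →
        Filling H n M a i (arr σ″ cliqueList) (arr σ″ cliqueSize) →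
        Poly inner σ″ (λ σ‴ → Filling H n M a (suc i) (arr σ‴ cliqueList) (arr σ‴ cliqueSize))
      entry {i} {σ″} i< fr′ refl g = poly-if
        (λ ≢0 → poly-seq $ poly-store $ poly-store≤ size-bound (push (≢0 ∘ trans test≡)))
        (λ ≡0 → poly-skip (filling-skip g (λ h → h (trans (sym test≡) ≡0))))
        where
        i<M : i < M
        i<M = subst (i <_) M≡ i<
        a≡ : reg σ″ index ≡ a
        a≡ = reg-eq fr′ index refl
        n≡ : reg σ″ order ≡ n
        n≡ = trans (reg-eq fr′ order refl) (reg-eq fr order refl)
        count = arr σ″ cliqueSize
        test≡ : ⟦ test ⟧ σ″ ≡ arr σ table (a * M + i) * arr σ sizes i
        test≡ rewrite arr-eq fr′ table refl | arr-eq fr table refl | arr-eq fr′ sizes refl | arr-eq fr sizes refl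
          | a≡ | reg-eq fr′ classes refl | M≡ = refl
        size-bound : count (reg σ″ index) + 1 ≤ P
        size-bound rewrite a≡ | +-comm (count a) 1 = ≤-trans (≤-<-trans (size≤ (current g)) i<M) (≤-trans M≤n n≤P)
        push : H a i → Filling H n M a (suc i) (arr σ″ cliqueList [ reg σ″ index * reg σ″ order + count (reg σ″ index) ↦ i ])
          (count [ reg σ″ index ↦ count (reg σ″ index) + 1 ])
        push h rewrite a≡ | n≡ | +-comm (count a) 1 = filling-push M≤n i<M g h

  poly-listNames : ∀ {k M K X σ} → reg σ param ≡ k → reg σ classes ≡ M → reg σ covers ≡ K → arr σ table ≡ X →
    K ≤ Z → M ≤ Z → K ≤ k → k ≤ P →
    Poly listNames σ (λ σ′ → Filled (HasName M X) k K M (arr σ′ nameList) (arr σ′ nameCount))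
  poly-listNames {σ = σ} refl refl refl refl K≤Z M≤Z K≤k k≤P = poly-weaken (λ { _ (_ , f) → f })
    (poly-for {class} {var classes} (λ a σ′ → Filled H k K a (arr σ′ nameList) (arr σ′ nameCount)) M≤Z (λ _ ()) row)
    where
    k = reg σ param
    M = reg σ classes
    K = reg σ covers
    H = HasName M (arr σ table)
    test = cell table (var index ⊗ var classes ⊕ var class)
    inner = ifnz test
         (nameList ⟨ var class ⊗ var param ⊕ cell nameCount (var class) ⟩≔ var index ⨾
          nameCount ⟨ var class ⟩≔ cell nameCount (var class) ⊕ lit 1)
         skip
    outer = nameCount ⟨ var class ⟩≔ lit 0 ⨾ for index (var covers) inner
    row : ∀ {a σ′} → a < M → Frame (for class (var classes) outer) σ σ′ → reg σ′ class ≡ a →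
      Filled H k K a (arr σ′ nameList) (arr σ′ nameCount) →
      Poly outer σ′ (λ σ″ → Filled H k K (suc a) (arr σ″ nameList) (arr σ″ nameCount))
    row {a} {σ′} a< fr refl f = poly-seq $ poly-store $ poly-weaken
      (λ { {σ″} _ (_ , g) → filling-finish (subst (λ m → Filling H k K a m (arr σ″ nameList) (arr σ″ nameCount)) K≡ g) })
      (poly-for {index} {var covers} (λ i σ″ → Filling H k K a i (arr σ″ nameList) (arr σ″ nameCount))
        (subst (_≤ Z) (sym K≡) K≤Z) (filling-start f) entry)
      where
      K≡ : reg σ′ covers ≡ K
      K≡ = reg-eq fr covers refl
      entry : ∀ {i σ″} → i < reg σ′ covers → Frame (for index (var covers) inner) (setCell σ′ nameCount a 0) σ″ → reg σ″ index ≡ i →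
        Filling H k K a i (arr σ″ nameList) (arr σ″ nameCount) →
        Poly inner σ″ (λ σ‴ → Filling H k K a (suc i) (arr σ‴ nameList) (arr σ‴ nameCount))
      entry {i} {σ″} i< fr′ refl g = poly-if
        (λ ≢0 → poly-seq $ poly-store $ poly-store≤ size-bound (push (≢0 ∘ trans test≡)))
        (λ ≡0 → poly-skip (filling-skip g (λ h → h (trans (sym test≡) ≡0))))
        where
        i<K : i < K
        i<K = subst (i <_) K≡ i<
        a≡ : reg σ″ class ≡ a
        a≡ = reg-eq fr′ class refl
        k≡ : reg σ″ param ≡ k
        k≡ = trans (reg-eq fr′ param refl) (reg-eq fr param refl)
        count = arr σ″ nameCount
        test≡ : ⟦ test ⟧ σ″ ≡ arr σ table (i * M + a)
        test≡ rewrite arr-eq fr′ table refl | arr-eq fr table refl | a≡ | reg-eq fr′ classes refl | reg-eq fr classes refl = refl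
        size-bound : count (reg σ″ class) + 1 ≤ P
        size-bound rewrite a≡ | +-comm (count a) 1 = ≤-trans (≤-<-trans (size≤ (current g)) i<K) (≤-trans K≤k k≤P)
        push : H a i → Filling H k K a (suc i) (arr σ″ nameList [ reg σ″ class * reg σ″ param + count (reg σ″ class) ↦ i ])
          (count [ reg σ″ class ↦ count (reg σ″ class) + 1 ])
        push h rewrite a≡ | k≡ | +-comm (count a) 1 = filling-push K≤k i<K g h

  store⇒env : ∀ {n k M B S σ} → Store n k M B S σ → Env n k M B (arr σ members) (arr σ sizes) σ
  store⇒env st = record
    { env-order = order≡ st ; env-param = param≡ st ; env-classes = classes≡ st ; env-matrix = matrix≡ st
    ; env-members = refl ; env-sizes = refl }

  -- The promise enters through the good table Y of s′ ≤ s cliques, whose existence ends the search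
  -- at K = s′ at the latest. A negative answer is justified in the same way: a cover of size at
  -- most k would yield a good table of a size already excluded.
  poly-solve : ∀ {n k M B s} {G : Graph n} {σ} → Store n k M B (_< n) σ → Matrix G B (_< n) → HasEdgeCliqueCover G s →
    out σ ≡ [] → M ≤ Z → M ≤ n → n ≤ P → suc k ≤ P → (∀ {K} → K ≤ k → suc (K * M) ≤ P) →
    suc s ≤ Z → 2 ^ (s * M) ≤ Z → suc (s * M) ≤ Z →
    Poly solveCover σ (λ σ′ → ∃[ 𝒞 ] (out σ′ ≡ report 𝒞 × Store n k M B (_< n) σ′ × Answer k G M σ′ 𝒞))
  poly-solve {n} {k} {M} {B} {s} {G} {σ} st mx cover out≡ M≤Z M≤n n≤P k<P L<P s<Z 2^L≤Z L<Z
    with cover⇒factor mx cover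
  ... | s′ , s′≤s , x , factor with CoverQuotient.factor⇒good mx (partition st) factor
  ... | Y , bY , goodY = poly-seq $ poly-weaken found?
        (poly-findCover (store⇒env st) bY goodY M≤Z k<P L<P (≤-trans (s≤s s′≤s) s<Z)
          (≤-trans (^-monoʳ-≤ 2 (*-monoˡ-≤ M s′≤s)) 2^L≤Z) (≤-trans (s≤s (*-monoˡ-≤ M s′≤s)) L<Z))
    where
    Post : State → Set
    Post σ′ = ∃[ 𝒞 ] (out σ′ ≡ report 𝒞 × Store n k M B (_< n) σ′ × Answer k G M σ′ 𝒞)
    open Quotient n B M (arr σ members) (arr σ sizes)
    finish : ∀ {σ′} 𝒞 → out σ′ ≡ [] → report 𝒞 ≡ [ reg σ′ solved ] → Store n k M B (_< n) σ′ → Answer k G M σ′ 𝒞 →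
      Poly (emit (var solved)) σ′ Post
    finish {σ′} 𝒞 o r st′ an = poly-emit (𝒞 , trans (cong (_∷ʳ reg σ′ solved) o) (sym r) , record { Store st′ } , re an)
      where
      re : ∀ {𝒞} → Answer k G M σ′ 𝒞 → Answer k G M (record σ′ { out = out σ′ ∷ʳ reg σ′ solved }) 𝒞
      re (unsolvable h) = unsolvable h
      re (maintained a b c d) = maintained a b c d
    found? : ∀ {σ′} → Frame findCover σ σ′ → Found {n} {k} {M} {B} {arr σ members} {arr σ sizes} s′ σ′ ⊎ Impossible {n} {k} {M} {B} {arr σ members} {arr σ sizes} σ′ →
      Poly (ifnz (var solved) (listClasses ⨾ listNames) skip ⨾ emit (var solved)) σ′ Post
    found? {σ′} fr (inj₂ (eq , no-table)) = poly-seq $ poly-if (λ ≢0 → ⊥-elim (≢0 eq)) λ _ → poly-skip $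
      finish nothing (trans (out-eq fr refl) out≡) (cong [_] (sym eq)) (store-frame fr st) (unsolvable λ cover′ →
        let (K , K≤k , _ , factor′) = cover⇒factor mx cover′
            (Y′ , bY′ , goodY′) = CoverQuotient.factor⇒good mx (partition st) factor′
        in no-table K K≤k Y′ (bY′ (K * M)) goodY′)
    found? {σ′} fr (inj₁ (eq , K≤k , K≤s′ , good)) = poly-seq $ poly-if
      (λ _ → poly-seq $ poly-weaken
        (λ {σ₁} fr₁ cl → poly-weaken
          (λ {σ₂} fr₂ nm → finish (just (family n (reg σ₂ covers) M (arr σ₂ table) (arr σ₂ clsOf)))
            (trans (out-eq fr₂ refl) (trans (out-eq fr₁ refl) (trans (out-eq fr refl) out≡)))
            (cong [_] (sym (trans (reg-eq fr₂ solved refl) (trans (reg-eq fr₁ solved refl) eq))))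
            (store-frame fr₂ (store-frame fr₁ st′)) (answer fr₁ fr₂ cl nm))
          (poly-listNames (trans (reg-eq fr₁ param refl) (param≡ st′)) (trans (reg-eq fr₁ classes refl) (classes≡ st′))
            (reg-eq fr₁ covers refl) (arr-eq fr₁ table refl) K≤Z M≤Z K≤k (<⇒≤ k<P)))
        (poly-listClasses (order≡ st′) (classes≡ st′) refl refl refl K≤Z M≤Z M≤n n≤P))
      (λ ≡0 → contradiction (trans (sym eq) ≡0) λ ())
      where
      st′ = store-frame fr st
      K = reg σ′ covers
      K≤Z : K ≤ Z
      K≤Z = ≤-trans K≤s′ (≤-trans s′≤s (<⇒≤ s<Z))
      good′ : Quotient.Good n B M (arr σ′ members) (arr σ′ sizes) K (arr σ′ table)
      good′ rewrite arr-eq fr members refl | arr-eq fr sizes refl = good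
      answer : ∀ {σ₁ σ₂} → Frame listClasses σ′ σ₁ → Frame listNames σ₁ σ₂ →
        Filled (InClique M (arr σ′ table) (arr σ′ sizes)) n M K (arr σ₁ cliqueList) (arr σ₁ cliqueSize) →
        Filled (HasName M (arr σ′ table)) k K M (arr σ₂ nameList) (arr σ₂ nameCount) →
        Answer k G M σ₂ (just (family n (reg σ₂ covers) M (arr σ₂ table) (arr σ₂ clsOf)))
      answer {σ₁} {σ₂} fr₁ fr₂ cl nm = maintained (subst (_≤ k) (sym K≡) K≤k) cover″ cl′ nm′
        where
        K≡ = trans (reg-eq fr₂ covers refl) (reg-eq fr₁ covers refl)
        X≡ = trans (arr-eq fr₂ table refl) (arr-eq fr₁ table refl)
        cls≡ = trans (arr-eq fr₂ clsOf refl) (arr-eq fr₁ clsOf refl)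
        sizes≡ = trans (arr-eq fr₂ sizes refl) (arr-eq fr₁ sizes refl)
        cover″ : IsEdgeCliqueCover G (clique (family n (reg σ₂ covers) M (arr σ₂ table) (arr σ₂ clsOf)))
        cover″ rewrite K≡ | X≡ | cls≡ = CoverQuotient.good⇒cover mx (partition st′) {K} {arr σ′ table} good′
        cl′ : Filled (InClique M (arr σ₂ table) (arr σ₂ sizes)) n M (reg σ₂ covers) (arr σ₂ cliqueList) (arr σ₂ cliqueSize)
        cl′ rewrite K≡ | X≡ | sizes≡ | arr-eq fr₂ cliqueList refl | arr-eq fr₂ cliqueSize refl = cl
        nm′ : Filled (HasName M (arr σ₂ table)) k (reg σ₂ covers) M (arr σ₂ nameList) (arr σ₂ nameCount)
        nm′ rewrite K≡ | X≡ = nm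

-- Queries and their exact running times

enumerates-[] : ∀ {Q : ℕ → Set} → (∀ x → ¬ Q x) → Enumerates [] Q
enumerates-[] none = [] , λ x → mk⇔ (λ ()) (λ q → ⊥-elim (none x q))

enumerates-cong : ∀ {xs} {Q R : ℕ → Set} → (∀ x → Q x → R x) → (∀ x → R x → Q x) → Enumerates xs Q → Enumerates xs R
enumerates-cong to from (unique , mem) = unique , λ x →
  mk⇔ (to x ∘ Equivalence.to (mem x)) (Equivalence.from (mem x) ∘ from x)

enumerates-snoc : ∀ {xs y} {Q R : ℕ → Set} → ¬ Q y → (∀ {x} → Q x → R x) → R y → (∀ {x} → R x → Q x ⊎ x ≡ y) →
  Enumerates xs Q → Enumerates (xs ∷ʳ y) R
enumerates-snoc {xs} {y} {Q} {R} fresh old new from (unique , mem) =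
  Unique.++⁺ unique (All.[] ∷ []) (λ { {x} (x∈ , here refl) → fresh (Equivalence.to (mem x) x∈) }) ,
  λ x → mk⇔ (λ x∈ → to (∈-++⁻ xs x∈)) (λ r → back (from r))
  where
  to : ∀ {x} → x List.∈ xs ⊎ x List.∈ [ y ] → R x
  to {x} (inj₁ x∈) = old (Equivalence.to (mem x) x∈)
  to (inj₂ (here refl)) = new
  back : ∀ {x} → Q x ⊎ x ≡ y → x List.∈ (xs ∷ʳ y)
  back {x} (inj₁ q) = ∈-++⁺ˡ (Equivalence.from (mem x) q)
  back (inj₂ refl) = ∈-++⁺ʳ xs (here refl)

length-snoc : ∀ (xs : List ℕ) {y} → length (xs ∷ʳ y) ≡ suc (length xs)
length-snoc xs = trans (length-++ xs) (+-comm (length xs) 1)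

-- Turns a time bound in the length of the output into one in the size of the clique. Removing from
-- p the vertex listed first lowers its size, and the others stay in p because the list has no
-- repetitions.
length≤∣p∣ : ∀ {n} (p : Subset n) {xs} → Unique xs → (∀ {x} → x List.∈ xs → ∃[ v ] (v ∈ p × x ≡ toℕ v)) → length xs ≤ ∣ p ∣
length≤∣p∣ p {[]} u h = z≤n
length≤∣p∣ p {x ∷ xs} (x∉ ∷ u) h with h (here refl)
... | v , v∈ , refl = ≤-<-trans
  (length≤∣p∣ (p - v) u λ y∈ → let (w , w∈ , y≡) = h (there y∈) in
    w , x∈p∧x≢y⇒x∈p-y w∈ (λ w≡v → All.lookup x∉ y∈ (sym (trans y≡ (cong toℕ w≡v)))) , y≡)
  (x∈p⇒∣p-x∣<∣p∣ v∈)

queryClique : Cmd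
queryClique =
  for index (cell cliqueSize (var 0))
    (class ≔ cell cliqueList (var 0 ⊗ var order ⊕ var index) ⨾
     for other (cell sizes (var class)) (emit (cell members (var class ⊗ var order ⊕ var other))))

queryVertex : Cmd
queryVertex =
  class ≔ cell clsOf (var 0) ⨾
  for index (cell nameCount (var class)) (emit (cell nameList (var class ⊗ var param ⊕ var index)))

module Queries (W P : ℕ) (2≤P : 2 ≤ P) (P^16<W : P ^ 16 < W) where

  open Run W P 2≤P P^16<W
  open For W P 2≤P P^16<W

  run-queryVertex : ∀ {k K M X cls σ} → reg σ param ≡ k → arr σ clsOf ≡ cls → out σ ≡ [] → cls (reg σ 0) < M →
    Filled (HasName M X) k K M (arr σ nameList) (arr σ nameCount) →
    Run queryVertex σ (λ σ′ t → t ≤ 41 * suc (length (out σ′)) ×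
      Enumerates (out σ′) (λ x → x < K × X (x * M + cls (reg σ 0)) ≢ 0))
  run-queryVertex {k} {K} {M} {X} {σ = σ} refl refl out≡ c< lists =
    run-seq $ run-assign $ run-weaken (λ { {σ′} _ (_ , t , (e , t≤) , s≤) → time {σ′} t≤ s≤ , enumerates-cong to from e })
      (run-for {index} {cell nameCount (var class)} I (subst (λ xs → Enumerates xs (Q 0)) (sym out≡) (enumerates-[] λ { _ (_ , () , _) }) , z≤n) step)
    where
    c = arr σ clsOf (reg σ 0)
    seg : ℕ → ℕ
    seg j = arr σ nameList (c * reg σ param + j)
    sz = arr σ nameCount c
    sel : Selection (HasName M X c) K sz seg
    sel = lists c c<
    Q : ℕ → ℕ → Set
    Q j x = ∃[ j′ ] (j′ < j × x ≡ seg j′)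
    I : ℕ → State → ℕ → Set
    I j σ′ t = Enumerates (out σ′) (Q j) × t ≤ 16 * length (out σ′)
    body = emit (cell nameList (var class ⊗ var param ⊕ var index))
    step : ∀ {j σ′ t} → j < sz → Frame (for index (cell nameCount (var class)) body) (setReg σ class c) σ′ → reg σ′ index ≡ j → I j σ′ t →
      Run body σ′ (λ σ″ s → I (suc j) (setReg σ″ index (suc j)) (t + (9 + s)))
    step {j} {σ′} {t} j< fr xi (e , t≤) = run-emit (snoc ,
      ≤-trans (+-monoˡ-≤ 16 t≤) (≤-reflexive (trans (trans (+-comm _ 16) (sym (*-suc 16 _))) (cong (16 *_) (sym (length-snoc (out σ′)))))))
      where
      value≡ : ⟦ cell nameList (var class ⊗ var param ⊕ var index) ⟧ σ′ ≡ seg j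
      value≡ = eval-at {index} fr xi (cell nameList (var class ⊗ var param ⊕ var index))
      snoc : Enumerates (out σ′ ∷ʳ ⟦ cell nameList (var class ⊗ var param ⊕ var index) ⟧ σ′) (Q (suc j))
      snoc rewrite value≡ = enumerates-snoc
        (λ (j′ , j′< , eq) → <⇒≢ j′< (sym (injective sel j< (<-trans j′< j<) eq)))
        (λ (j′ , j′< , eq) → j′ , m<n⇒m<1+n j′< , eq) (j , n<1+n j , refl)
        (λ (j′ , j′< , eq) → split j′< eq) e
        where
        split : ∀ {x j′} → j′ < suc j → x ≡ seg j′ → Q j x ⊎ x ≡ seg j
        split {j′ = j′} j′< eq with below-suc j′<
        ... | inj₁ lt = inj₁ (j′ , lt , eq)
        ... | inj₂ refl = inj₂ eq
    -- Each name costs 16 units, and there are 12 units besides; 41 is the constant required by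
    -- `run-queryClique`.
    time : ∀ {σ′ s t} → t ≤ 16 * length (out σ′) → s ≤ t + 9 → 3 + s ≤ 41 * suc (length (out σ′))
    time {σ′} {s} {t} t≤ s≤ = begin
      3 + s                   ≤⟨ +-monoʳ-≤ 3 (≤-trans s≤ (+-monoˡ-≤ 9 t≤)) ⟩
      3 + (16 * len + 9)      ≤⟨ m≤m+n _ (29 + 25 * len) ⟩
      3 + (16 * len + 9) + (29 + 25 * len) ≡⟨ solve 1 (λ l → con 3 :+ (con 16 :* l :+ con 9) :+ (con 29 :+ con 25 :* l) := con 41 :* (con 1 :+ l)) refl len ⟩
      41 * suc len            ∎
      where
      open ≤-Reasoning
      len = length (out σ′)
    to : ∀ x → Q sz x → x < K × X (x * M + c) ≢ 0
    to x (j , j< , refl) = entry< sel j< , selected sel j<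
    from : ∀ x → x < K × X (x * M + c) ≢ 0 → Q sz x
    from x (x< , ≢0) = let (j , j< , eq) = complete sel x< ≢0 in j , j< , sym eq

  -- Each vertex costs 16 units. Each listed class costs 9 + 7 + 9 = 25 more, for the outer loop,
  -- the assignment and the end of the inner loop. As listed classes are non-empty, this is charged
  -- to one of their vertices, which gives 16 + 25 = 41 per vertex.
  run-queryClique : ∀ {n k K M B X q σ} → Store n k M B (_< n) σ → reg σ 0 ≡ q → out σ ≡ [] → q < K →
    Filled (InClique M X (arr σ sizes)) n M K (arr σ cliqueList) (arr σ cliqueSize) →
    Run queryClique σ (λ σ′ t → t ≤ 41 * suc (length (out σ′)) ×
      Enumerates (out σ′) (λ x → x < n × X (q * M + arr σ clsOf x) ≢ 0))
  run-queryClique {n} {k} {K} {M} {B} {X} {q} {σ} record { order≡ = refl ; partition = C } refl out≡ q< lists =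
    run-weaken (λ { {σ′} _ (_ , t , (e , t≤) , s≤) → time {σ′} t≤ s≤ , enumerates-cong to from e })
      (run-for {index} {cell cliqueSize (var 0)} I (subst (λ xs → Enumerates xs (Q 0)) (sym out≡) (enumerates-[] λ { _ (_ , _ , () , _) }) , z≤n) step)
    where
    cls = arr σ clsOf
    memb = arr σ members
    card = arr σ sizes
    seg : ℕ → ℕ
    seg j = arr σ cliqueList (q * n + j)
    sz = arr σ cliqueSize q
    sel : Selection (InClique M X card q) M sz seg
    sel = lists q q<
    Q : ℕ → ℕ → Set
    Q j x = x < n × ∃[ j′ ] (j′ < j × seg j′ ≡ cls x)
    I : ℕ → State → ℕ → Set
    I j σ′ t = Enumerates (out σ′) (Q j) × t ≤ 41 * length (out σ′)
    inner = for other (cell sizes (var class)) (emit (cell members (var class ⊗ var order ⊕ var other)))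
    outer = class ≔ cell cliqueList (var 0 ⊗ var order ⊕ var index) ⨾ inner
    step : ∀ {j σ′ t} → j < sz → Frame (for index (cell cliqueSize (var 0)) outer) σ σ′ → reg σ′ index ≡ j → I j σ′ t →
      Run outer σ′ (λ σ″ s → I (suc j) (setReg σ″ index (suc j)) (t + (9 + s)))
    step {j} {σ′} {t} j< fr xi (e , t≤) = run-seq $ run-assign $ run-weaken
        (λ { {σ″} _ (_ , u , (e′ , len , u≤) , s≤) → enumerates-cong to′ from′ (subst (λ m → Enumerates (out σ″) (R m)) size≡ e′) ,
          time′ (length (out σ′)) (length (out σ″)) (trans len (cong (length (out σ′) +_) size≡)) t≤ (≤-trans u≤ (≤-reflexive (cong (16 *_) size≡))) s≤ })
        (run-for {other} {cell sizes (var class)} J (enumerates-cong (λ _ → inj₁) (λ { _ (inj₁ h) → h ; _ (inj₂ (_ , () , _)) }) e , sym (+-identityʳ _) , z≤n) step′)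
      where
      c = seg j
      c< : c < M
      c< = entry< sel j<
      class≡ : ⟦ cell cliqueList (var 0 ⊗ var order ⊕ var index) ⟧ σ′ ≡ c
      class≡ = eval-at {index} fr xi (cell cliqueList (var 0 ⊗ var order ⊕ var index))
      σ₁ = setReg σ′ class (⟦ cell cliqueList (var 0 ⊗ var order ⊕ var index) ⟧ σ′)
      size≡ : ⟦ cell sizes (var class) ⟧ σ₁ ≡ card c
      size≡ = cong₂ (λ a i → a i) (arr-eq fr sizes refl) class≡
      size>0 : 0 < card c
      size>0 = n≢0⇒n>0 (*-≢0ʳ (X (q * M + c)) (selected sel j<))
      R : ℕ → ℕ → Set
      R l x = Q j x ⊎ (∃[ l′ ] (l′ < l × x ≡ memb (c * n + l′)))
      J : ℕ → State → ℕ → Set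
      J l σ″ u = Enumerates (out σ″) (R l) × length (out σ″) ≡ length (out σ′) + l × u ≤ 16 * l
      step′ : ∀ {l σ″ u} → l < ⟦ cell sizes (var class) ⟧ σ₁ → Frame inner σ₁ σ″ → reg σ″ other ≡ l → J l σ″ u →
        Run (emit (cell members (var class ⊗ var order ⊕ var other))) σ″ (λ σ‴ s → J (suc l) (setReg σ‴ other (suc l)) (u + (9 + s)))
      step′ {l} {σ″} {u} l< fr′ xl (e′ , len , u≤) = run-emit (snoc , trans (length-snoc (out σ″)) (trans (cong suc len) (sym (+-suc _ l))) ,
        ≤-trans (+-monoˡ-≤ 16 u≤) (≤-reflexive (trans (+-comm _ 16) (sym (*-suc 16 l)))))
        where
        l<size : l < card c
        l<size = subst (l <_) size≡ l<
        value≡ : ⟦ cell members (var class ⊗ var order ⊕ var other) ⟧ σ″ ≡ memb (c * n + l)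
        value≡ = trans (eval-at {other} fr′ xl (cell members (var class ⊗ var order ⊕ var other)))
          (cong₂ (λ a i → a i) (arr-eq fr members refl) (cong₂ (λ c n → c * n + l) class≡ (reg-eq fr order refl)))
        snoc : Enumerates (out σ″ ∷ʳ ⟦ cell members (var class ⊗ var order ⊕ var other) ⟧ σ″) (R (suc l))
        snoc rewrite value≡ = enumerates-snoc
          (λ { (inj₁ (_ , j′ , j′< , eq)) → <⇒≢ j′< (injective sel (<-trans j′< j<) j< (trans eq (cls-memb C c< l<size)))
             ; (inj₂ (l′ , l′< , eq)) → <⇒≢ l′< (memb-injective C c< (<-trans l′< l<size) l<size (sym eq)) })
          (λ { (inj₁ h) → inj₁ h ; (inj₂ (l′ , l′< , eq)) → inj₂ (l′ , m<n⇒m<1+n l′< , eq) })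
          (inj₂ (l , n<1+n l , refl))
          (λ { (inj₁ h) → inj₁ (inj₁ h) ; (inj₂ (l′ , l′< , eq)) → split l′< eq }) e′
          where
          split : ∀ {x l′} → l′ < suc l → x ≡ memb (c * n + l′) → R l x ⊎ x ≡ memb (c * n + l)
          split {l′ = l′} l′< eq with below-suc l′<
          ... | inj₁ lt = inj₁ (inj₂ (l′ , lt , eq))
          ... | inj₂ refl = inj₂ eq
      to′ : ∀ x → R (card c) x → Q (suc j) x
      to′ x (inj₁ (x< , j′ , j′< , eq)) = x< , j′ , m<n⇒m<1+n j′< , eq
      to′ x (inj₂ (l , l< , refl)) = vertex< C (placed C c< l<) , j , n<1+n j , sym (cls-memb C c< l<)
      from′ : ∀ x → Q (suc j) x → R (card c) x
      from′ x (x< , j′ , j′< , eq) with below-suc j′<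
      ... | inj₁ lt = inj₁ (x< , j′ , lt , eq)
      ... | inj₂ refl = inj₂ (arr σ posOf x , subst (λ c → arr σ posOf x < card c) (sym eq) (pos< C x<) , sym (trans (cong (λ c → memb (c * n + arr σ posOf x)) eq) (memb-pos C x<)))
      time′ : ∀ l₁ l₂ {u s} → l₂ ≡ l₁ + card c → t ≤ 41 * l₁ → u ≤ 16 * card c → s ≤ u + 9 → t + (9 + (7 + s)) ≤ 41 * l₂
      time′ l₁ l₂ {u} {s} refl t≤ u≤ s≤ = begin
        t + (9 + (7 + s))                          ≤⟨ +-mono-≤ t≤ (+-monoʳ-≤ 16 (≤-trans s≤ (+-monoˡ-≤ 9 u≤))) ⟩
        41 * l₁ + (16 + (16 * card c + 9))         ≡⟨ solve 2 (λ l z → con 41 :* l :+ (con 16 :+ (con 16 :* z :+ con 9)) := con 41 :* l :+ (con 16 :* z :+ con 25 :* con 1)) refl l₁ (card c) ⟩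
        41 * l₁ + (16 * card c + 25 * 1)           ≤⟨ +-monoʳ-≤ (41 * l₁) (+-monoʳ-≤ (16 * card c) (*-monoʳ-≤ 25 size>0)) ⟩
        41 * l₁ + (16 * card c + 25 * card c)      ≡⟨ solve 2 (λ l z → con 41 :* l :+ (con 16 :* z :+ con 25 :* z) := con 41 :* (l :+ z)) refl l₁ (card c) ⟩
        41 * (l₁ + card c)                         ∎
        where open ≤-Reasoning
    time : ∀ {σ′ s t} → t ≤ 41 * length (out σ′) → s ≤ t + 9 → s ≤ 41 * suc (length (out σ′))
    time {σ′} {s} {t} t≤ s≤ = begin
      s              ≤⟨ ≤-trans s≤ (+-mono-≤ t≤ (≤ᵇ⇒≤ 9 41 tt)) ⟩
      41 * len + 41  ≡⟨ trans (+-comm _ 41) (sym (*-suc 41 len)) ⟩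
      41 * suc len   ∎
      where
      open ≤-Reasoning
      len = length (out σ′)
    to : ∀ x → Q sz x → x < n × X (q * M + cls x) ≢ 0
    to x (x< , j , j< , eq) = x< , subst (λ c → X (q * M + c) ≢ 0) eq (*-≢0ˡ (selected sel j<))
    from : ∀ x → x < n × X (q * M + cls x) ≢ 0 → Q sz x
    from x (x< , ≢0) = x< , complete sel (cls< C x<) (*-≢0 ≢0 (nonempty C x<))

matrix-weaken : ∀ {n} {G : Graph n} {B D D′} → (∀ {x} → D′ x → D x) → Matrix G B D → Matrix G B D′
matrix-weaken sub mx = record { off-diagonal = off-diagonal mx ; diagonal = λ u → diagonal mx u ∘ sub }

-- The scan sees only the listed columns. It is enough that, whenever w has a neighbour, some column
-- other than w has a non-zero entry; conversely, as entry (w , w) has been cleared, every hit is a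
-- neighbour of w.
matrix-setDiagonal : ∀ {n} {G : Graph n} {B D} {col : ℕ → ℕ} {L b} (w : Fin n) → Matrix G B D → (∀ {j} → j < L → col j < n) →
  (∀ z → Adj G w z → ∃[ j ] (j < L × col j ≢ toℕ w × B (toℕ w * n + col j) ≢ 0)) →
  let i = toℕ w * n + toℕ w ; B₀ = B [ i ↦ 0 ] in
  ((∃[ j ] (j < L × B₀ (toℕ w * n + col j) ≢ 0)) × b ≡ 1) ⊎ ((∀ j → j < L → ¬ (B₀ (toℕ w * n + col j) ≢ 0)) × b ≡ 0) →
  Matrix G (B₀ [ i ↦ b ]) (λ x → D x ⊎ x ≡ toℕ w)
matrix-setDiagonal {n} {G} {B} {D} {col} {L} {b} w mx col< detect outcome = record
  { off-diagonal = λ u v u≢v → trans (same (u≢v ∘ both u v)) (off-diagonal mx u v u≢v)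
  ; diagonal = diagonal′ }
  where
  i = toℕ w * n + toℕ w
  B₀ = B [ i ↦ 0 ]
  same₀ : ∀ {q} → i ≢ q → B₀ q ≡ B q
  same₀ = update-other B 0
  same : ∀ {q} → i ≢ q → (B₀ [ i ↦ b ]) q ≡ B q
  same i≢ = trans (update-other B₀ b i≢) (same₀ i≢)
  both : ∀ (u v : Fin n) → i ≡ toℕ u * n + toℕ v → u ≡ v
  both u v eq = let (p , q) = flat-injective (toℕ w) (toℕ w) (toℕ u) (toℕ v) (Fin.toℕ<n w) (Fin.toℕ<n v) eq
    in Fin.toℕ-injective (trans (sym p) q)
  diagonal-w : _ → (b ≡ 1 × ∃[ v ] Adj G w v) ⊎ (b ≡ 0 × (∀ v → ¬ Adj G w v))
  diagonal-w (inj₁ ((j , j< , ≢0) , b≡)) = inj₁ (b≡ , r , bit≢0 (λ eq → ≢0 (trans (same₀ apart) (trans (cong (λ c → B (toℕ w * n + c)) (sym r≡)) (trans (off-diagonal mx w r w≢r) eq)))))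
    where
    r = fromℕ< (col< j<)
    r≡ : toℕ r ≡ col j
    r≡ = Fin.toℕ-fromℕ< (col< j<)
    w≢r : w ≢ r
    w≢r eq = ≢0 (trans (cong (λ c → B₀ (toℕ w * n + c)) (trans (sym r≡) (cong toℕ (sym eq)))) (update-same B i 0))
    apart : i ≢ toℕ w * n + col j
    apart eq = w≢r (Fin.toℕ-injective (trans (+-cancelˡ-≡ (toℕ w * n) _ _ eq) (sym r≡)))
  diagonal-w (inj₂ (none , b≡)) = inj₂ (b≡ , λ z a → let (j , j< , j≢ , ≢0) = detect z a in
    none j j< (≢0 ∘ trans (sym (same₀ (λ eq → j≢ (sym (+-cancelˡ-≡ (toℕ w * n) _ _ eq)))))))
  diagonal′ : ∀ u → D (toℕ u) ⊎ toℕ u ≡ toℕ w →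
    ((B₀ [ i ↦ b ]) (toℕ u * n + toℕ u) ≡ 1 × ∃[ v ] Adj G u v) ⊎ ((B₀ [ i ↦ b ]) (toℕ u * n + toℕ u) ≡ 0 × (∀ v → ¬ Adj G u v))
  diagonal′ u d with w Fin.≟ u
  ... | yes refl rewrite update-same B₀ i b = diagonal-w outcome
  diagonal′ u (inj₂ eq) | no w≢u = ⊥-elim (w≢u (Fin.toℕ-injective (sym eq)))
  diagonal′ u (inj₁ d) | no w≢u rewrite same (λ eq → w≢u (Fin.toℕ-injective (proj₁
    (flat-injective (toℕ w) (toℕ w) (toℕ u) (toℕ u) (Fin.toℕ<n w) (Fin.toℕ<n u) eq)))) = diagonal mx u d

-- The complete programs for initialisation and updates

edge : ℕ
edge = 19

-- The columns are built while only the other vertices are classified, so the representatives have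
-- rows that the update leaves alone. Both diagonal entries are settled before either end point is
-- placed, so that rows are compared in the finished matrix.
updateEdge : Cmd
updateEdge =
  vertex ≔ var 0 ⨾ removeVertex ⨾
  vertex ≔ var 1 ⨾ removeVertex ⨾
  matrix ⟨ var 0 ⊗ var order ⊕ var 1 ⟩≔ var edge ⨾
  matrix ⟨ var 1 ⊗ var order ⊕ var 0 ⟩≔ var edge ⨾
  buildColumns ⨾
  vertex ≔ var 0 ⨾ setDiagonal ⨾
  vertex ≔ var 1 ⨾ setDiagonal ⨾
  vertex ≔ var 0 ⨾ placeVertex ⨾
  vertex ≔ var 1 ⨾ placeVertex ⨾
  solveCover

insertCmd deleteCmd initialiseCmd : Cmd
insertCmd = edge ≔ lit 1 ⨾ updateEdge
deleteCmd = edge ≔ lit 0 ⨾ updateEdge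
initialiseCmd =
  order ≔ var 0 ⨾ param ≔ var 1 ⨾ columns ≔ var 0 ⨾ classes ≔ lit 0 ⨾
  for vertex (var order) (cols ⟨ var vertex ⟩≔ var vertex) ⨾
  for vertex (var order) setDiagonal ⨾
  for vertex (var order) placeVertex ⨾
  solveCover

Served : ∀ {n} → ℕ → ℕ → Graph n → State → Maybe (NamedFamily n) → Set
Served {n} k β G σ 𝒞 = ∃[ M ] ∃[ B ] (M ≤ β × Store n k M B (_< n) σ × Matrix G B (_< n) × Answer k G M σ 𝒞)

Done : ∀ {n} → ℕ → ℕ → Graph n → State → Set
Done k β G σ = ∃[ 𝒞 ] (out σ ≡ report 𝒞 × Served k β G σ 𝒞)

-- Z and β are separate parameters because initialisation has loops of length n and uses a larger Z,
-- whereas the bound β on the number of classes is an invariant shared with the updates.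
module Updates (W P : ℕ) (2≤P : 2 ≤ P) (P^16<W : P ^ 16 < W) (Z : ℕ) (2≤Z : 2 ≤ Z)
  (n k s β : ℕ) (β≤n : β ≤ n) (n+2≤P : n + 2 ≤ P) (k<P : suc k ≤ P) (kn<P : suc (k * n) ≤ P)
  (β≤Z : β ≤ Z) (s<Z : suc s ≤ Z) (2^L≤Z : 2 ^ (s * β) ≤ Z) (L<Z : suc (s * β) ≤ Z) (n⊓2^s≤β : ∀ {m} → m ≤ n → m ≤ 2 ^ s → m ≤ β) where

  open Run W P 2≤P P^16<W
  open Poly W P 2≤P P^16<W Z 2≤Z
  open Procedures W P 2≤P P^16<W Z 2≤Z
  open Placing W P 2≤P P^16<W Z 2≤Z
  open Listing W P 2≤P P^16<W Z 2≤Z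

  n≤P : n ≤ P
  n≤P = ≤-trans (m≤m+n n 2) n+2≤P

  β≤P : β ≤ P
  β≤P = ≤-trans β≤n n≤P

  poly-solveDone : ∀ {G : Graph n} {M B σ} → M ≤ β → Store n k M B (_< n) σ → Matrix G B (_< n) → HasEdgeCliqueCover G s →
    out σ ≡ [] → Poly solveCover σ (Done k β G)
  poly-solveDone {M = M} {B} M≤β st mx cover out≡ = poly-weaken
    (λ { _ (𝒞 , o , st′ , an) → 𝒞 , o , M , B , M≤β , st′ , mx , an })
    (poly-solve st mx cover out≡ (≤-trans M≤β β≤Z) M≤n n≤P k<P (λ K≤k → ≤-trans (s≤s (*-mono-≤ K≤k M≤n)) kn<P)
      s<Z (≤-trans (^-monoʳ-≤ 2 (*-monoʳ-≤ s M≤β)) 2^L≤Z) (≤-trans (s≤s (*-monoʳ-≤ s M≤β)) L<Z))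
    where M≤n = ≤-trans M≤β β≤n

  module _ {G : Graph n} {B : ℕ → ℕ} (mx : Matrix G B (_< n)) (cover : HasEdgeCliqueCover G s) where

    open FullMatrix mx

    rows≤β : ∀ {m} (f : ℕ → ℕ) → (∀ {c} → c < m → f c < n) → (∀ {c d} → c < m → d < m → Row n B (f c) (f d) → c ≡ d) → m ≤ β
    rows≤β {m} f f< inj with cover⇒factor mx cover
    -- Different rows belong to different vertices, hence at most n; the factorisation gives the
    -- bound 2 ^ s.
    ... | s′ , s′≤s , x , factor = n⊓2^s≤β
      (bounded-injection f f< (λ {c} {d} c< d< eq → inj c< d< (λ {z} _ → cong (λ y → B (y * n + z)) eq)))
      (≤-trans (rows≤2^s f entry factor f< inj) (^-monoʳ-≤ 2 s′≤s))

    -- By symmetry the column of z is its row, hence equal to the column of any vertex with the same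
    -- row as z. If every vertex has the row of some listed column, agreement in the listed columns
    -- is agreement everywhere.
    determined : ∀ {col : ℕ → ℕ} {L} → (∀ {z} → z < n → ∃[ j ] (j < L × col j < n × Row n B z (col j))) →
      ∀ {x y} → x < n → y < n → (∀ {j} → j < L → B (x * n + col j) ≡ B (y * n + col j)) → Row n B x y
    determined {col} reps {x} {y} x< y< agree {z} z< with reps z<
    ... | j , j< , c< , r = trans (via x<) (trans (agree j<) (sym (via y<)))
      where
      via : ∀ {x} → x < n → B (x * n + z) ≡ B (x * n + col j)
      via x< = trans (symmetric x< z<) (trans (r x<) (symmetric c< x<))

    poly-place : ∀ {M S} {col : ℕ → ℕ} {L u σ} → (∀ {z} → z < n → ∃[ j ] (j < L × col j < n × Row n B z (col j))) →
      (∀ {j} → j < L → col j < n) → L ≤ Z → M ≤ β →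
      u < n → ¬ S u → Store n k M B S σ → arr σ cols ≡ col → reg σ columns ≡ L → reg σ vertex ≡ u →
      Poly placeVertex σ (λ σ′ → ∃[ M′ ] (M′ ≤ β × Store n k M′ B (λ x → S x ⊎ x ≡ u) σ′))
    poly-place reps col< L≤Z M≤β u< ¬Su =
      poly-placeVertex u< ¬Su L≤Z β≤Z β≤P n≤P M≤β col< (determined reps) rows≤β

  -- All vertices serve as columns.
  module Initialise {G : Graph n} (cover : HasEdgeCliqueCover G s) (n≤Z : n ≤ Z) where

    poly-columns : ∀ {σ} → reg σ order ≡ n → Poly (for vertex (var order) (cols ⟨ var vertex ⟩≔ var vertex)) σ
      (λ σ′ → ∀ j → j < n → arr σ′ cols j ≡ j)
    poly-columns {σ} refl = poly-weaken (λ { _ (_ , h) → h })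
      (poly-for {vertex} {var order} (λ i σ′ → ∀ j → j < i → arr σ′ cols j ≡ j) n≤Z (λ _ ())
        (λ { {i} {σ′} _ _ refl h → poly-store (λ j → extend-below (λ j x → x ≡ j) (arr σ′ cols) i (h _) refl) }))

    poly-diagonals : ∀ {σ} → reg σ order ≡ n → reg σ columns ≡ n → (∀ j → j < n → arr σ cols j ≡ j) →
      Matrix G (arr σ matrix) (_< 0) →
      Poly (for vertex (var order) setDiagonal) σ (λ σ′ → Matrix G (arr σ′ matrix) (_< n))
    poly-diagonals {σ} n≡ L≡ col≡ mx₀ = poly-weaken (λ { {σ′} _ (_ , mx) → subst (λ m → Matrix G (arr σ′ matrix) (_< m)) n≡ mx })
      (poly-for {vertex} {var order} (λ i σ′ → Matrix G (arr σ′ matrix) (_< i)) (subst (_≤ Z) (sym n≡) n≤Z) mx₀ step)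
      where
      col = arr σ cols
      step : ∀ {i σ′} → i < reg σ order → Frame (for vertex (var order) setDiagonal) σ σ′ → reg σ′ vertex ≡ i →
        Matrix G (arr σ′ matrix) (_< i) → Poly setDiagonal σ′ (λ σ″ → Matrix G (arr σ″ matrix) (_< suc i))
      step {i} {σ′} i< fr xi mx = poly-weaken
        (λ { _ (b , eq , outcome) → subst (λ A → Matrix G A (_< suc i)) (sym eq)
          (matrix-weaken (λ x< → subst (λ w → _ ⊎ _ ≡ w) (sym w≡) (below-suc x<))
            (matrix-setDiagonal w mx (λ {j} j< → subst (_< n) (sym (col≡ j j<)) j<) (detect mx) outcome)) })
        (poly-setDiagonal {L = n} {u = toℕ w} (trans (reg-eq fr order refl) n≡) refl (arr-eq fr cols refl) (trans (reg-eq fr columns refl) L≡)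
          (trans xi (sym w≡)) n≤Z)
        where
        i<n = subst (i <_) n≡ i<
        w = fromℕ< i<n
        w≡ : toℕ w ≡ i
        w≡ = Fin.toℕ-fromℕ< i<n
        detect : ∀ {B D} → Matrix G B D → ∀ z → Adj G w z → ∃[ j ] (j < n × col j ≢ toℕ w × B (toℕ w * n + col j) ≢ 0)
        detect {B} mx z a = toℕ z , Fin.toℕ<n z , (λ eq → adj⇒≢ G a (Fin.toℕ-injective (sym (trans (sym z≡) eq)))) ,
          λ eq → contradiction (trans (sym eq) (trans (cong (λ c → B (toℕ w * n + c)) z≡) (trans (off-diagonal mx w z (adj⇒≢ G a)) (cong bit a)))) λ ()
          where z≡ = col≡ (toℕ z) (Fin.toℕ<n z)

    poly-placeAll : ∀ {B σ} → reg σ order ≡ n → reg σ param ≡ k → reg σ classes ≡ 0 → reg σ columns ≡ n →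
      (∀ j → j < n → arr σ cols j ≡ j) → arr σ matrix ≡ B → Matrix G B (_< n) →
      Poly (for vertex (var order) placeVertex) σ (λ σ′ → ∃[ M ] (M ≤ β × Store n k M B (_< n) σ′))
    poly-placeAll {B} {σ} n≡ k≡ M≡ L≡ col≡ B≡ mx = poly-weaken
      (λ { {σ′} _ (_ , M , M≤ , st) → M , M≤ , subst (λ m → Store n k M B (_< m) σ′) n≡ st })
      (poly-for {vertex} {var order} (λ i σ′ → ∃[ M ] (M ≤ β × Store n k M B (_< i) σ′)) (subst (_≤ Z) (sym n≡) n≤Z)
        (0 , z≤n , record
          { order≡ = n≡ ; param≡ = k≡ ; classes≡ = M≡ ; matrix≡ = B≡
          ; partition = record
            { vertex< = λ () ; cls< = λ () ; pos< = λ () ; memb-pos = λ () ; placed = λ () ; cls-memb = λ () ; pos-memb = λ ()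
            ; same-row = λ () ; same-cls = λ () } })
        (λ { {i} {σ′} i< fr xi (M , M≤ , st) → poly-weaken
          (λ { _ (M′ , M′≤ , st′) → M′ , M′≤ , record { Store st′ ; partition = classes-set
            (λ { (inj₁ x<) → m<n⇒m<1+n x< ; (inj₂ refl) → n<1+n i }) below-suc (partition st′) } })
          (poly-place mx cover (λ {z} z< → z , z< , subst (_< n) (sym (col≡ z z<)) z< , λ {y} _ → cong (λ c → B (c * n + y)) (sym (col≡ z z<)))
            (λ {j} j< → subst (_< n) (sym (col≡ j j<)) j<) n≤Z M≤ (subst (i <_) n≡ i<) (<-irrefl refl) st
            (arr-eq fr cols refl) (trans (reg-eq fr columns refl) L≡) xi) }))

    poly-initialise : ∀ {σ} → reg σ 0 ≡ n → reg σ 1 ≡ k → out σ ≡ [] →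
      (∀ u v → arr σ matrix (toℕ u * n + toℕ v) ≡ bit (adj G u v)) → Poly initialiseCmd σ (Done k β G)
    poly-initialise {σ} n≡ k≡ out≡ input =
      poly-seq $ poly-assign $ poly-seq $ poly-assign $ poly-seq $ poly-assign $ poly-seq $ poly-assign $
      poly-seq $ poly-weaken (λ fr₁ col≡ → poly-seq $ poly-weaken (λ fr₂ mx → poly-seq $ poly-weaken
        (λ { fr₃ (M , M≤ , st) → poly-solveDone M≤ st mx cover
          (trans (out-eq fr₃ refl) (trans (out-eq fr₂ refl) (trans (out-eq fr₁ refl) out≡))) })
        (poly-placeAll (trans (reg-eq fr₂ order refl) (trans (reg-eq fr₁ order refl) n≡))
          (trans (reg-eq fr₂ param refl) (trans (reg-eq fr₁ param refl) k≡))
          (trans (reg-eq fr₂ classes refl) (reg-eq fr₁ classes refl))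
          (trans (reg-eq fr₂ columns refl) (trans (reg-eq fr₁ columns refl) n≡))
          (λ j j< → trans (cong (λ a → a j) (arr-eq fr₂ cols refl)) (col≡ j j<)) refl mx))
        (poly-diagonals (trans (reg-eq fr₁ order refl) n≡) (trans (reg-eq fr₁ columns refl) n≡) col≡
          (record { off-diagonal = λ u v _ → trans (cong (λ a → a (toℕ u * n + toℕ v)) (arr-eq fr₁ matrix refl)) (input u v)
                  ; diagonal = λ _ () })))
      (poly-columns n≡)

  -- Insertion and deletion are treated at once, through the agreement of G and G′ away from the
  -- pair uv and the new entry ε.
  module Update {G G′ : Graph n} (u v : Fin n) (u≢v : u ≢ v)
    (others : ∀ x y → ¬ ((x ≡ u × y ≡ v) ⊎ (x ≡ v × y ≡ u)) → adj G′ x y ≡ adj G x y)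
    (cover : HasEdgeCliqueCover G′ s) (β+2≤Z : β + 2 ≤ Z) where

    U V : ℕ
    U = toℕ u
    V = toℕ v

    U≢V : U ≢ V
    U≢V = u≢v ∘ Fin.toℕ-injective

    Rest : ℕ → Set
    Rest x = (x < n × x ≢ U) × x ≢ V

    ε : ℕ
    ε = bit (adj G′ u v)

    setEdge : (ℕ → ℕ) → ℕ → ℕ
    setEdge B = B [ U * n + V ↦ ε ] [ V * n + U ↦ ε ]

    setEdge-row : ∀ B {x z} → Rest x → z < n → setEdge B (x * n + z) ≡ B (x * n + z)
    setEdge-row B {x} {z} ((_ , x≢U) , x≢V) z< = trans
      (update-otherRow (B [ U * n + V ↦ ε ]) V U x z ε (Fin.toℕ<n u) z< (≢-sym x≢V)) (update-otherRow B U V x z ε (Fin.toℕ<n v) z< (≢-sym x≢U))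

    matrix-setEdge : ∀ {B} → Matrix G B (_< n) → Matrix G′ (setEdge B) Rest
    matrix-setEdge {B} mx = record { off-diagonal = off ; diagonal = dia }
      where
      B₁ = B [ U * n + V ↦ ε ]
      index≢ : ∀ (a b x y : Fin n) → ¬ (x ≡ a × y ≡ b) → toℕ a * n + toℕ b ≢ toℕ x * n + toℕ y
      index≢ a b x y ≢ eq = let (p , q) = flat-injective (toℕ a) (toℕ b) (toℕ x) (toℕ y) (Fin.toℕ<n b) (Fin.toℕ<n y) eq
        in ≢ (Fin.toℕ-injective (sym p) , Fin.toℕ-injective (sym q))
      off : ∀ x y → x ≢ y → setEdge B (toℕ x * n + toℕ y) ≡ bit (adj G′ x y)
      off x y x≢y with (x Fin.≟ u) ×-dec (y Fin.≟ v) | (x Fin.≟ v) ×-dec (y Fin.≟ u)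
      ... | _ | yes (refl , refl) = trans (update-same B₁ (V * n + U) ε) (cong bit (Graph.sym G′ u v))
      ... | yes (refl , refl) | no ≢vu = trans (update-other B₁ ε (index≢ v u u v ≢vu)) (update-same B (U * n + V) ε)
      ... | no ≢uv | no ≢vu = trans (update-other B₁ ε (index≢ v u x y ≢vu)) (trans (update-other B ε (index≢ u v x y ≢uv))
        (trans (off-diagonal mx x y x≢y) (cong bit (sym (others x y λ { (inj₁ e) → ≢uv e ; (inj₂ e) → ≢vu e })))))
      dia : ∀ x → Rest (toℕ x) → (setEdge B (toℕ x * n + toℕ x) ≡ 1 × ∃[ z ] Adj G′ x z) ⊎ (setEdge B (toℕ x * n + toℕ x) ≡ 0 × (∀ z → ¬ Adj G′ x z))
      dia x rest@((x< , x≢U) , x≢V) with diagonal mx x x<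
      ... | inj₁ (b , z , a) = inj₁ (trans (setEdge-row B rest x<) b , z , trans (same z) a)
        where
        same : ∀ z → adj G′ x z ≡ adj G x z
        same z = others x z λ { (inj₁ (e , _)) → x≢U (cong toℕ e) ; (inj₂ (e , _)) → x≢V (cong toℕ e) }
      ... | inj₂ (b , none) = inj₂ (trans (setEdge-row B rest x<) b , λ z a → none z (trans (sym (same z)) a))
        where
        same : ∀ z → adj G′ x z ≡ adj G x z
        same z = others x z λ { (inj₁ (e , _)) → x≢U (cong toℕ e) ; (inj₂ (e , _)) → x≢V (cong toℕ e) }

    -- The end points u and v are columns themselves; any other vertex is represented by a column
    -- with the same row. That this column lies in `Rest` makes it differ from the vertex whose
    -- diagonal is being set, and keeps its row fixed while the rows of u and v change.
    record Columns (L : ℕ) (B col : ℕ → ℕ) : Set where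
      field
        col<    : ∀ {j} → j < L → col j < n
        listed  : ∀ {z} → z < n → Rest z ⊎ (∃[ j ] (j < L × col j ≡ z))
        related : ∀ {z} → Rest z → ∃[ j ] (j < L × Rest (col j) × Row n B z (col j))

    open Columns

    columns-rows : ∀ {L B B′ col} → (∀ {x z} → Rest x → z < n → B′ (x * n + z) ≡ B (x * n + z)) → Columns L B col → Columns L B′ col
    columns-rows {L} {B} {B′} {col} rows cs = record
      { col< = col< cs ; listed = listed cs
      ; related = λ rz → let (j , j< , rc , row) = related cs rz in j , j< , rc , λ z< → trans (rows rz z<) (trans (row z<) (sym (rows rc z<))) }

    -- D grows from `Rest` to all vertices as the two diagonal entries are settled.
    record Stage (M L : ℕ) (B col : ℕ → ℕ) (D : ℕ → Set) (σ : State) : Set where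
      field
        stored   : Store n k M B Rest σ
        mx       : Matrix G′ B D
        cs       : Columns L B col
        cols≡    : arr σ cols ≡ col
        columns≡ : reg σ columns ≡ L
        arg₀     : reg σ 0 ≡ U
        arg₁     : reg σ 1 ≡ V
        out≡     : out σ ≡ []

    open Stage

    poly-stageDiagonal : ∀ {M L B col D σ} (w : Fin n) → ¬ Rest (toℕ w) → L ≤ Z → Stage M L B col D σ → reg σ vertex ≡ toℕ w →
      Poly setDiagonal σ (λ σ′ → ∃[ B′ ] Stage M L B′ col (λ x → D x ⊎ x ≡ toℕ w) σ′)
    poly-stageDiagonal {M} {L} {B} {col} {D} {σ} w ¬rest L≤Z stage w≡ = poly-weaken
      (λ { fr (b , eq , outcome) → _ , record
        { stored = store-matrix fr eq (rows b) (stored stage)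
        ; mx = matrix-setDiagonal w (mx stage) (col< (cs stage)) detect outcome
        ; cs = columns-rows (rows b) (cs stage)
        ; cols≡ = trans (arr-eq fr cols refl) (cols≡ stage)
        ; columns≡ = trans (reg-eq fr columns refl) (columns≡ stage)
        ; arg₀ = trans (reg-eq fr 0 refl) (arg₀ stage)
        ; arg₁ = trans (reg-eq fr 1 refl) (arg₁ stage)
        ; out≡ = trans (out-eq fr refl) (out≡ stage) } })
      (poly-setDiagonal (order≡ (stored stage)) (matrix≡ (stored stage)) (cols≡ stage) (columns≡ stage) w≡ L≤Z)
      where
      i = toℕ w * n + toℕ w
      rows : ∀ b {x z} → Rest x → z < n → (B [ i ↦ 0 ] [ i ↦ b ]) (x * n + z) ≡ B (x * n + z)
      rows b {x} {z} rx z< = trans (update-otherRow (B [ i ↦ 0 ]) (toℕ w) (toℕ w) x z b (Fin.toℕ<n w) z< w≢x)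
        (update-otherRow B (toℕ w) (toℕ w) x z 0 (Fin.toℕ<n w) z< w≢x)
        where
        w≢x : toℕ w ≢ x
        w≢x eq = ¬rest (subst Rest (sym eq) rx)
      adjacent : ∀ z → Adj G′ w z → B (toℕ w * n + toℕ z) ≢ 0
      adjacent z a eq = contradiction (trans (sym eq) (trans (off-diagonal (mx stage) w z (adj⇒≢ G′ a)) (cong bit a))) λ ()
      detect : ∀ z → Adj G′ w z → ∃[ j ] (j < L × col j ≢ toℕ w × B (toℕ w * n + col j) ≢ 0)
      detect z a with listed (cs stage) (Fin.toℕ<n z)
      ... | inj₂ (j , j< , eq) = j , j< , (λ e → adj⇒≢ G′ a (Fin.toℕ-injective (sym (trans (sym eq) e)))) ,
            subst (λ c → B (toℕ w * n + c) ≢ 0) (sym eq) (adjacent z a)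
      -- A neighbour z in `Rest` is replaced by its representative r: since z and r have equal rows,
      -- r is adjacent to w as well.
      ... | inj₁ rz with related (cs stage) rz
      ...   | j , j< , rc , row = j , j< , (λ e → ¬rest (subst Rest e rc)) , subst (λ c → B (toℕ w * n + c) ≢ 0) r≡ (adjacent r w~r)
        where
        r = fromℕ< (col< (cs stage) j<)
        r≡ : toℕ r ≡ col j
        r≡ = Fin.toℕ-fromℕ< (col< (cs stage) j<)
        r≢w : r ≢ w
        r≢w e = ¬rest (subst Rest (trans (sym r≡) (cong toℕ e)) rc)
        w~r : Adj G′ w r
        w~r = trans (Graph.sym G′ w r) (bit≢0 λ eq → contradiction
          (trans (sym eq) (trans (sym (off-diagonal (mx stage) r w r≢w)) (trans (cong (λ c → B (c * n + toℕ w)) r≡)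
            (trans (sym (row (Fin.toℕ<n w))) (trans (off-diagonal (mx stage) z w (≢-sym (adj⇒≢ G′ a))) (cong bit (trans (Graph.sym G′ z w) a)))))))
          λ ())

    All : ℕ → Set
    All x = (Rest x ⊎ x ≡ U) ⊎ x ≡ V

    all : ∀ {x} → x < n → All x
    all {x} x< with x ≟ U | x ≟ V
    ... | yes eq | _      = inj₁ (inj₂ eq)
    ... | no _   | yes eq = inj₂ eq
    ... | no ≢U  | no ≢V  = inj₁ (inj₁ ((x< , ≢U) , ≢V))

    below : ∀ {x} → All x → x < n
    below (inj₁ (inj₁ ((x< , _) , _))) = x<
    below (inj₁ (inj₂ refl)) = Fin.toℕ<n u
    below (inj₂ refl) = Fin.toℕ<n v

    poly-placeBoth : ∀ {M L B col σ} → Stage M L B col All σ → L ≤ Z → M ≤ β →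
      Poly (vertex ≔ var 0 ⨾ placeVertex ⨾ vertex ≔ var 1 ⨾ placeVertex ⨾ solveCover) σ (Done k β G′)
    poly-placeBoth {M} {L} {B} {col} {σ} stage L≤Z M≤β =
      poly-seq $ poly-assign $ poly-seq $ poly-weaken
        (λ { fr₁ (M₁ , M₁≤ , st₁) → poly-seq $ poly-assign $ poly-seq $ poly-weaken
          (λ { fr₂ (M₂ , M₂≤ , st₂) → poly-solveDone M₂≤
            (record { Store st₂ ; partition = classes-set below all (partition st₂) }) full cover
            (trans (out-eq fr₂ refl) (trans (out-eq fr₁ refl) (out≡ stage))) })
          (poly-place full cover reps (col< (cs stage)) L≤Z M₁≤ (Fin.toℕ<n v) ¬V (record { Store st₁ })
            (trans (arr-eq fr₁ cols refl) (cols≡ stage)) (trans (reg-eq fr₁ columns refl) (columns≡ stage))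
            (trans (reg-eq fr₁ 1 refl) (arg₁ stage))) })
        (poly-place full cover reps (col< (cs stage)) L≤Z M≤β (Fin.toℕ<n u) (λ ((_ , ≢U) , _) → ≢U refl) (record { Store (stored stage) })
          (cols≡ stage) (columns≡ stage) (arg₀ stage))
      where
      full : Matrix G′ B (_< n)
      full = matrix-weaken all (mx stage)
      ¬V : ¬ (Rest V ⊎ V ≡ U)
      ¬V (inj₁ (_ , ≢V)) = ≢V refl
      ¬V (inj₂ eq) = U≢V (sym eq)
      reps : ∀ {z} → z < n → ∃[ j ] (j < L × col j < n × Row n B z (col j))
      reps {z} z< with listed (cs stage) z<
      ... | inj₁ rz = let (j , j< , rc , row) = related (cs stage) rz in j , j< , col< (cs stage) j< , row
      ... | inj₂ (j , j< , refl) = j , j< , z< , row-refl {n} {B} {z}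

    poly-setDiagonals : ∀ {M L B col σ} → Stage M L B col Rest σ → L ≤ Z → M ≤ β →
      Poly (vertex ≔ var 0 ⨾ setDiagonal ⨾ vertex ≔ var 1 ⨾ setDiagonal ⨾
            vertex ≔ var 0 ⨾ placeVertex ⨾ vertex ≔ var 1 ⨾ placeVertex ⨾ solveCover) σ (Done k β G′)
    poly-setDiagonals stage L≤Z M≤β = poly-seq $ poly-assign $ poly-seq $ poly-weaken
      (λ { _ (B₁ , stage₁) → poly-seq $ poly-assign $ poly-seq $ poly-weaken
        (λ { _ (B₂ , stage₂) → poly-placeBoth stage₂ L≤Z M≤β })
        (poly-stageDiagonal v (λ (_ , ≢V) → ≢V refl) L≤Z (keep stage₁) (arg₁ stage₁)) })
      (poly-stageDiagonal u (λ ((_ , ≢U) , _) → ≢U refl) L≤Z (keep stage) (arg₀ stage))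
      where
      keep : ∀ {M L B col D σ x} → Stage M L B col D σ → Stage M L B col D (setReg σ vertex x)
      keep st = record { Stage st ; stored = record { Store (stored st) } }

    columns-built : ∀ {M B cls pos memb size} {col : ℕ → ℕ} → Classes n B Rest M cls pos memb size →
      (∀ c → c < M → size c ≢ 0 → col c ≡ memb (c * n)) → (∀ c → c < M → size c ≡ 0 → col c ≡ U) →
      col M ≡ U → col (M + 1) ≡ V → Columns (M + 2) B col
    columns-built {M} {B} {cls} {pos} {memb} {size} {col} C full empty at-M at-M+1 = record
      { col< = λ {j} j< → col<′ (below-suc (subst (j <_) (+-comm M 2) j<)) ; listed = listed′ ∘ all ; related = related′ }
      where
      M<  : M < M + 2
      M<  = m<m+n M (s≤s z≤n)
      M+1< : M + 1 < M + 2
      M+1< = +-monoʳ-< M (n<1+n 1)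
      col<′ : ∀ {j} → j < suc M ⊎ j ≡ suc M → col j < n
      col<′ (inj₂ refl) = subst (_< n) (sym (trans (cong col (+-comm 1 M)) at-M+1)) (Fin.toℕ<n v)
      col<′ {j} (inj₁ j<) with below-suc j<
      ... | inj₂ refl = subst (_< n) (sym at-M) (Fin.toℕ<n u)
      ... | inj₁ j<M with size j ≟ 0
      ...   | yes ≡0 = subst (_< n) (sym (empty j j<M ≡0)) (Fin.toℕ<n u)
      ...   | no ≢0  = subst (_< n) (sym (full j j<M ≢0)) (rep< C j<M ≢0)
      listed′ : ∀ {z} → All z → Rest z ⊎ (∃[ j ] (j < M + 2 × col j ≡ z))
      listed′ (inj₁ (inj₁ rz)) = inj₁ rz
      listed′ (inj₁ (inj₂ refl)) = inj₂ (M , M< , at-M)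
      listed′ (inj₂ refl) = inj₂ (M + 1 , M+1< , at-M+1)
      related′ : ∀ {z} → Rest z → ∃[ j ] (j < M + 2 × Rest (col j) × Row n B z (col j))
      related′ {z} rz =
        cls z , <-trans (cls< C rz) M< , subst Rest (sym eq) (rep-placed C (cls< C rz) (nonempty C rz)) ,
        subst (Row n B z) (sym eq) (row-rep C rz)
        where eq = full (cls z) (cls< C rz) (nonempty C rz)

    poly-updateEdge : ∀ {M B σ} → M ≤ β → Store n k M B (_< n) σ → Matrix G B (_< n) → reg σ 0 ≡ U → reg σ 1 ≡ V →
      reg σ edge ≡ bit (adj G′ u v) → out σ ≡ [] → Poly updateEdge σ (Done k β G′)
    poly-updateEdge {M} {B} {σ} M≤β st mx₀ a₀ a₁ e≡ o≡ =
      poly-seq $ poly-assign $ poly-seq $ poly-weaken afterFirst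
        (poly-removeVertex (record { Store st }) (subst (_< n) (sym a₀) (Fin.toℕ<n u)))
      where
      L≤Z : M + 2 ≤ Z
      L≤Z = ≤-trans (+-monoˡ-≤ 2 M≤β) β+2≤Z
      rest₃ = buildColumns ⨾ vertex ≔ var 0 ⨾ setDiagonal ⨾ vertex ≔ var 1 ⨾ setDiagonal ⨾
            vertex ≔ var 0 ⨾ placeVertex ⨾ vertex ≔ var 1 ⨾ placeVertex ⨾ solveCover
      rest₂ = matrix ⟨ var 0 ⊗ var order ⊕ var 1 ⟩≔ var edge ⨾ matrix ⟨ var 1 ⊗ var order ⊕ var 0 ⟩≔ var edge ⨾ rest₃
      rest₁ = vertex ≔ var 1 ⨾ removeVertex ⨾ rest₂

      afterEdge : ∀ {σ′} → Store n k M (setEdge B) Rest σ′ → reg σ′ 0 ≡ U → reg σ′ 1 ≡ V → out σ′ ≡ [] → Poly rest₃ σ′ (Done k β G′)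
      afterEdge {σ′} st′ a₀ a₁ o≡ = poly-seq $ poly-weaken
        (λ { fr (full , empty , at-M , at-M+1 , L≡) → poly-setDiagonals (record
          { stored = store-frame fr st′
          ; mx = matrix-setEdge mx₀
          ; cs = columns-built (partition st′) full (λ c c< ≡0 → trans (empty c c< ≡0) a₀) (trans at-M a₀) (trans at-M+1 a₁)
          ; cols≡ = refl ; columns≡ = L≡
          ; arg₀ = trans (reg-eq fr 0 refl) a₀ ; arg₁ = trans (reg-eq fr 1 refl) a₁
          ; out≡ = trans (out-eq fr refl) o≡ }) L≤Z M≤β })
        (poly-buildColumns st′ (≤-trans M≤β β≤Z) (≤-trans (+-monoˡ-≤ 2 (≤-trans M≤β β≤n)) n+2≤P))

      afterSecond : ∀ {σ′} → Store n k M B Rest σ′ → reg σ′ 0 ≡ U → reg σ′ 1 ≡ V → reg σ′ edge ≡ bit (adj G′ u v) → out σ′ ≡ [] →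
        Poly rest₂ σ′ (Done k β G′)
      afterSecond {σ′} st′ a₀ a₁ e≡ o≡ = poly-seq $ poly-store $ poly-seq $ poly-store $
        afterEdge (record { Store st′ ; matrix≡ = eq ; partition = classes-rows (setEdge-row B) (partition st′) }) a₀ a₁ o≡
        where
        eq : arr σ′ matrix [ reg σ′ 0 * reg σ′ order + reg σ′ 1 ↦ reg σ′ edge ] [ reg σ′ 1 * reg σ′ order + reg σ′ 0 ↦ reg σ′ edge ] ≡ setEdge B
        eq rewrite a₀ | a₁ | e≡ | order≡ st′ | matrix≡ st′ = refl

      afterFirst : ∀ {σ′} → Frame removeVertex (setReg σ vertex (reg σ 0)) σ′ →
        Store n k M B (λ x → x < n × x ≢ reg σ 0) σ′ → Poly rest₁ σ′ (Done k β G′)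
      afterFirst {σ′} fr st′ = poly-seq $ poly-assign $ poly-seq $ poly-weaken
        (λ fr′ st″ → afterSecond (record { Store st″ ; partition = classes-set to from (partition st″) })
          (trans (reg-eq fr′ 0 refl) (trans (reg-eq fr 0 refl) a₀)) (trans (reg-eq fr′ 1 refl) a₁′)
          (trans (reg-eq fr′ edge refl) (trans (reg-eq fr edge refl) e≡)) (trans (out-eq fr′ refl) (trans (out-eq fr refl) o≡)))
        (poly-removeVertex (record { Store st′ }) (subst (_< n) (sym a₁′) (Fin.toℕ<n v) , λ eq → U≢V (trans (sym a₀) (trans (sym eq) a₁′))))
        where
        a₁′ : reg σ′ 1 ≡ V
        a₁′ = trans (reg-eq fr 1 refl) a₁
        to : ∀ {x} → (x < n × x ≢ reg σ 0) × x ≢ reg σ′ 1 → Rest x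
        to ((x< , ≢U) , ≢V) = (x< , λ e → ≢U (trans e (sym a₀))) , λ e → ≢V (trans e (sym a₁′))
        from : ∀ {x} → Rest x → (x < n × x ≢ reg σ 0) × x ≢ reg σ′ 1
        from ((x< , ≢U) , ≢V) = (x< , λ e → ≢U (trans e a₀)) , λ e → ≢V (trans e a₁′)

-- There are 2 ^ (s * β) tables of s cliques against β ≤ 2 ^ s classes.
module Bounds (s : ℕ) where

  Z : ℕ
  -- From s ≤ 2 ^ s and β ≤ 2 ^ s the number s * β of table entries is at most 2 ^ (s + s).
  Z = 2 ^ (2 ^ (s + s))

  2≤Z : 2 ≤ Z
  2≤Z = ^-monoʳ-≤ 2 {1} (m^n>0 2 (s + s))

  square : 2 ^ s * 2 ^ s ≡ 2 ^ (s + s)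
  square = sym (^-distribˡ-+-* 2 s s)

  2^s≤Z : 2 ^ s ≤ Z
  2^s≤Z = ≤-trans (^-monoʳ-≤ 2 (m≤m+n s s)) (a≤2^a _)

  s<Z : suc s ≤ Z
  s<Z = ≤-trans (a<2^a s) 2^s≤Z

  module _ {β} (β≤ : β ≤ 2 ^ s) where

    2^L≤Z : 2 ^ (s * β) ≤ Z
    2^L≤Z = ^-monoʳ-≤ 2 (≤-trans (*-mono-≤ (a≤2^a s) β≤) (≤-reflexive square))

    L<Z : suc (s * β) ≤ Z
    L<Z = ≤-trans (a<2^a (s * β)) 2^L≤Z

    β+2≤Z : 1 ≤ s → β + 2 ≤ Z
    β+2≤Z 1≤s = begin
      β + 2           ≤⟨ +-mono-≤ β≤ 2≤ ⟩
      2 ^ s + 2 ^ s   ≡⟨ double s ⟩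
      2 * 2 ^ s       ≤⟨ *-monoˡ-≤ (2 ^ s) 2≤ ⟩
      2 ^ s * 2 ^ s   ≡⟨ square ⟩
      2 ^ (s + s)     ≤⟨ a≤2^a _ ⟩
      Z               ∎
      where
      open ≤-Reasoning
      2≤ : 2 ≤ 2 ^ s
      2≤ = ^-monoʳ-≤ 2 1≤s

  -- The factor e is absorbed into the inner exponent by e ≤ 2 ^ e, and the resulting summand e into
  -- a multiple of s by s ≥ 1.
  Z^e≤ : 1 ≤ s → ∀ e → Z ^ e ≤ 2 ^ (2 ^ ((2 + e) * s))
  Z^e≤ 1≤s e = begin
    Z ^ e                       ≡⟨ ^-*-assoc 2 (2 ^ (s + s)) e ⟩
    2 ^ (2 ^ (s + s) * e)       ≤⟨ ^-monoʳ-≤ 2 (*-monoʳ-≤ (2 ^ (s + s)) (a≤2^a e)) ⟩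
    2 ^ (2 ^ (s + s) * 2 ^ e)   ≡⟨ cong (2 ^_) (sym (^-distribˡ-+-* 2 (s + s) e)) ⟩
    2 ^ (2 ^ (s + s + e))       ≤⟨ ^-monoʳ-≤ 2 (^-monoʳ-≤ 2 larger) ⟩
    2 ^ (2 ^ ((2 + e) * s))     ∎
    where
    open ≤-Reasoning
    larger : s + s + e ≤ (2 + e) * s
    larger = ≤-trans (≤-reflexive (+-assoc s s e))
      (+-monoʳ-≤ s (+-monoʳ-≤ s (≤-trans (≤-reflexive (sym (*-identityʳ e))) (*-monoʳ-≤ e 1≤s))))

-- For s = 0 the time bound would be 2 ^ (2 ^ 0) = 2. But every update involves a graph with an
-- edge, before or after, and the promise for that graph excludes s = 0.
edge⇒1≤s : ∀ {n s} {G : Graph n} {u v} → Adj G u v → HasEdgeCliqueCover G s → 1 ≤ s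
edge⇒1≤s {u = u} {v} a (s′ , C , s′≤s , _ , cover) =
  ≤-trans (s≤s z≤n) (≤-trans (Fin.toℕ<n (proj₁ (cover u v a))) s′≤s)

answer-call : ∀ {n k} {G : Graph n} {M σ x 𝒞} → Answer k G M σ 𝒞 → Answer k G M (call₁ x σ) 𝒞
answer-call (unsolvable h) = unsolvable h
answer-call (maintained a b c d) = maintained a b c d

-- Assembling the algorithm and its guarantees

algorithm : Algorithm
algorithm = record
  { initialise  = initialiseCmd
  ; insertEdge  = insertCmd
  ; deleteEdge  = deleteCmd
  ; listClique  = queryClique
  ; listCliques = queryVertex
  }

module Correctness (k n W s P : ℕ) (2≤P : 2 ≤ P) (P^16<W : P ^ 16 < W)
  (n+2≤P : n + 2 ≤ P) (k<P : suc k ≤ P) (kn<P : suc (k * n) ≤ P) where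

  open Run W P 2≤P P^16<W
  open Bounds s

  -- The bound n keeps class numbers and table sizes within words; the bound 2 ^ s keeps the loops
  -- of an update short.
  β : ℕ
  β = n ⊓ 2 ^ s

  β≤n : β ≤ n
  β≤n = m⊓n≤m n (2 ^ s)

  β≤2^s : β ≤ 2 ^ s
  β≤2^s = m⊓n≤n n (2 ^ s)

  Serves : Graph n → Maybe (NamedFamily n) → State → Set
  Serves G 𝒞 σ = Bounded P σ × HasEdgeCliqueCover G s × Served k β G σ 𝒞

  correct : ∀ {G 𝒞 σ} → Serves G 𝒞 σ → Correct W k G 𝒞
  correct (_ , _ , _ , _ , _ , _ , _ , unsolvable h) = h
  correct (_ , _ , _ , _ , _ , _ , _ , maintained K≤k cover _ _) =
    K≤k , cover , Fin.toℕ-injective , λ i → <-≤-trans (Fin.toℕ<n i) (≤-trans K≤k (<⇒≤ (<-trans (≤-trans k<P P≤P^16) P^16<W)))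
    where
    open Powers P 2≤P using (nonZero)
    P≤P^16 : P ≤ P ^ 16
    P≤P^16 = m≤m*n P (P ^ 15) {{m^n≢0 P 15}}

  on-initialise : ∀ {G σ} → HasEdgeCliqueCover G s → IsInput G k σ →
    Terminates W initialiseCmd σ λ σ′ _ → ∃[ 𝒞 ] (out σ′ ≡ report 𝒞 × Serves G 𝒞 σ′)
  on-initialise {G} {σ} cover input =
    let (σ′ , t , ex , bd , _ , 𝒞 , o , served) = poly-initialise vertices parameter no-output input-matrix bounded
    in σ′ , t , ex , 𝒞 , o , bd , cover , served
    where
    open IsInput input renaming (matrix to input-matrix)
    open Updates W P 2≤P P^16<W (Z + n) (≤-trans 2≤Z (m≤m+n Z n)) n k s β β≤n n+2≤P k<P kn<P
      (≤-trans β≤n (m≤n+m n Z)) (≤-trans s<Z (m≤m+n Z n)) (≤-trans (2^L≤Z β≤2^s) (m≤m+n Z n)) (≤-trans (L<Z β≤2^s) (m≤m+n Z n)) ⊓-glb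
    open Initialise cover (m≤n+m n Z)
    bit≤1 : ∀ b → bit b ≤ 1
    bit≤1 true = s≤s z≤n
    bit≤1 false = z≤n
    registers : ∀ x → reg σ x ≤ P
    registers zero = ≤-trans (≤-reflexive vertices) (≤-trans (m≤m+n n 2) n+2≤P)
    registers (suc zero) = ≤-trans (≤-reflexive parameter) (<⇒≤ k<P)
    registers (suc (suc x)) = ≤-trans (≤-reflexive (zero-reg (2 + x) (s≤s (s≤s z≤n)))) z≤n
    entries : ∀ {i} → i < n * n → arr σ 0 i ≤ 1
    entries = flat-surjective (λ i → arr σ 0 i ≤ 1) (below₂ (λ u v → arr σ 0 (u * n + v) ≤ 1)
      (λ u v → ≤-trans (≤-reflexive (input-matrix u v)) (bit≤1 (adj G u v))))
    arrays : ∀ a i → arr σ a i ≤ P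
    arrays (suc a) i = ≤-trans (≤-reflexive (zero-arr (suc a) i (s≤s z≤n))) z≤n
    arrays zero i with i <? n * n
    ... | yes i< = ≤-trans (entries i<) (<⇒≤ 2≤P)
    ... | no i≮  = ≤-trans (≤-reflexive (zero-matrix i (≮⇒≥ i≮))) z≤n
    bounded : Bounded P σ
    bounded = registers , arrays

  module _ (1≤s : 1 ≤ s) where

    open Poly W P 2≤P P^16<W Z 2≤Z
    open Updates W P 2≤P P^16<W Z 2≤Z n k s β β≤n n+2≤P k<P kn<P
      (≤-trans β≤2^s 2^s≤Z) s<Z (2^L≤Z β≤2^s) (L<Z β≤2^s) ⊓-glb

    on-update : ∀ {G G′ : Graph n} {𝒞 σ} (b : ℕ) {h : T (admissible (lit b))} → Serves G 𝒞 σ → ∀ u v → u ≢ v →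
      (∀ x y → ¬ ((x ≡ u × y ≡ v) ⊎ (x ≡ v × y ≡ u)) → adj G′ x y ≡ adj G x y) → b ≡ bit (adj G′ u v) → HasEdgeCliqueCover G′ s →
      Terminates W (edge ≔ lit b ⨾ updateEdge) (call₂ (toℕ u) (toℕ v) σ) λ σ′ t →
        t ≤ 2 ^ (2 ^ ((2 + exponent insertCmd) * s)) × ∃[ 𝒞′ ] (out σ′ ≡ report 𝒞′ × Serves G′ 𝒞′ σ′)
    on-update {G} {G′} {𝒞} {σ} b {h} (bd , _ , M , B , M≤ , st , mx , _) u v u≢v others b≡ cover =
      let (σ′ , t , ex , bd′ , t≤ , 𝒞′ , o , served) = run bounded
      -- `exponent` does not depend on the literal b, so insertion and deletion share one bound.
      in σ′ , t , ex , ≤-trans t≤ (Z^e≤ 1≤s (exponent insertCmd)) , 𝒞′ , o , bd′ , cover , served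
      where
      open Update {G} {G′} u v u≢v others cover (β+2≤Z β≤2^s 1≤s)
      run : Poly (edge ≔ lit b ⨾ updateEdge) (call₂ (toℕ u) (toℕ v) σ) (Done k β G′)
      run = poly-seq $ poly-assign {h = h} $ poly-updateEdge M≤ (record { Store st }) mx refl refl b≡ refl
      bounded : Bounded P (call₂ (toℕ u) (toℕ v) σ)
      bounded = bounded-setReg {setReg σ 0 (toℕ u)} {1} (≤-trans (<⇒≤ (Fin.toℕ<n v)) n≤P)
        (bounded-setReg {σ} {0} (≤-trans (<⇒≤ (Fin.toℕ<n u)) n≤P) bd)

  bounded-call : ∀ {σ x} → x ≤ P → Bounded P σ → Bounded P (call₁ x σ)
  bounded-call {σ} x≤ bd = bounded-setReg {σ} {0} x≤ bd

  n≤P : n ≤ P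
  n≤P = ≤-trans (m≤m+n n 2) n+2≤P

  open Queries W P 2≤P P^16<W

  on-listClique : ∀ {G 𝒞 σ} → Serves G (just 𝒞) σ → ∀ i →
    Terminates W queryClique (call₁ (name 𝒞 i) σ) λ σ′ t →
      t ≤ 41 * suc ∣ clique 𝒞 i ∣ ×
      Enumerates (out σ′) (λ x → ∃[ v ] (v ∈ clique 𝒞 i × x ≡ toℕ v)) ×
      Serves G (just 𝒞) σ′
  on-listClique {G} {σ = σ} (bd , cover , M , B , M≤ , st , mx , an@(maintained K≤k ecc cl nm)) i =
    let (σ′ , t , ex , bd′ , fr , t≤ , e) = run-weaken _,_
          (run-queryClique {K = reg σ covers} {X = arr σ table} (record { Store st }) refl refl (Fin.toℕ<n i) cl)
          (bounded-call {σ} (≤-trans (<⇒≤ (Fin.toℕ<n i)) (≤-trans K≤k (<⇒≤ k<P))) bd)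
        e′ = enumerates-cong to from e
    in σ′ , t , ex ,
       ≤-trans t≤ (*-monoʳ-≤ 41 (s≤s (length≤∣p∣ (clique 𝒞 i) (proj₁ e′) λ {x} → Equivalence.to (proj₂ e′ x)))) , e′ ,
       bd′ , cover , M , B , M≤ , store-frame fr (record { Store st }) , mx , answer-frame fr (answer-call an)
    where
    𝒞 = family n (reg σ covers) M (arr σ table) (arr σ clsOf)
    open Membership n (reg σ covers) M (arr σ table) (arr σ clsOf)
    to : ∀ x → x < n × arr σ table (toℕ i * M + arr σ clsOf x) ≢ 0 → ∃[ v ] (v ∈ clique 𝒞 i × x ≡ toℕ v)
    to x (x< , ≢0) = fromℕ< x< , ∈-family i (fromℕ< x<) (subst (λ x → arr σ table (toℕ i * M + arr σ clsOf x) ≢ 0) (sym x≡) ≢0) , sym x≡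
      where x≡ = Fin.toℕ-fromℕ< x<
    from : ∀ x → ∃[ v ] (v ∈ clique 𝒞 i × x ≡ toℕ v) → x < n × arr σ table (toℕ i * M + arr σ clsOf x) ≢ 0
    from x (v , v∈ , refl) = Fin.toℕ<n v , family-∈ i v v∈

  on-listCliques : ∀ {G 𝒞 σ} → Serves G (just 𝒞) σ → ∀ v →
    Terminates W queryVertex (call₁ (toℕ v) σ) λ σ′ t →
      t ≤ 41 * suc (length (out σ′)) ×
      Enumerates (out σ′) (λ x → ∃[ i ] (v ∈ clique 𝒞 i × x ≡ name 𝒞 i)) ×
      Serves G (just 𝒞) σ′
  on-listCliques {G} {σ = σ} (bd , cover , M , B , M≤ , st , mx , an@(maintained K≤k ecc cl nm)) v =
    let (σ′ , t , ex , bd′ , fr , t≤ , e) = run-weaken _,_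
          (run-queryVertex {K = reg σ covers} {X = arr σ table} (param≡ st) refl refl (cls< (partition st) (Fin.toℕ<n v)) nm)
          (bounded-call {σ} (≤-trans (<⇒≤ (Fin.toℕ<n v)) n≤P) bd)
    in σ′ , t , ex , t≤ , enumerates-cong to from e ,
       bd′ , cover , M , B , M≤ , store-frame fr (record { Store st }) , mx , answer-frame fr (answer-call an)
    where
    𝒞 = family n (reg σ covers) M (arr σ table) (arr σ clsOf)
    open Membership n (reg σ covers) M (arr σ table) (arr σ clsOf)
    to : ∀ x → x < reg σ covers × arr σ table (x * M + arr σ clsOf (toℕ v)) ≢ 0 → ∃[ i ] (v ∈ clique 𝒞 i × x ≡ toℕ i)
    to x (x< , ≢0) = fromℕ< x< , ∈-family (fromℕ< x<) v (subst (λ x → arr σ table (x * M + arr σ clsOf (toℕ v)) ≢ 0) (sym x≡) ≢0) , sym x≡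
      where x≡ = Fin.toℕ-fromℕ< x<
    from : ∀ x → ∃[ i ] (v ∈ clique 𝒞 i × x ≡ toℕ i) → x < reg σ covers × arr σ table (x * M + arr σ clsOf (toℕ v)) ≢ 0
    from x (i , v∈ , refl) = Fin.toℕ<n i , family-∈ i v v∈

  maintains : ∀ {G σ} → HasEdgeCliqueCover G s → IsInput G k σ →
    Maintains algorithm W k s (2 ^ (2 ^ ((2 + exponent insertCmd) * s))) 41 G σ
  maintains cover input = record
    { Serves = Serves
    ; correct = correct
    ; on-initialise = on-initialise cover input
    ; on-insert = λ serves u v G′ ins cover′ → let open Inserted ins in
        on-update (edge⇒1≤s {G = G′} present cover′) 1 serves u v (adj⇒≢ G′ present) others (cong bit (sym present)) cover′
    -- The deleted edge lies in the graph before the update, so s ≥ 1 comes from the promise for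
    -- that graph, which is carried along in `Serves`.
    ; on-delete = λ {G} serves u v G′ del cover′ → let open Inserted del in
        on-update (edge⇒1≤s {G = G} present (proj₁ (proj₂ serves))) 0 serves u v (adj⇒≢ G present)
          (λ x y h → sym (others x y h)) (cong bit (sym absent)) cover′
    ; on-listClique = on-listClique
    ; on-listCliques = on-listCliques
    }

-- Explains the exponent 33 = 2 * 16 + 1 of the word size: with N = 2 + n + k the stored numbers,
-- among them table sizes up to k * n, are at most P = N * N, and words have to exceed P ^ 16 = N ^
-- 32.
square^16<W : ∀ {N W} → 2 ≤ N → N ^ 33 ≤ W → (N * N) ^ 16 < W
square^16<W {N} 2≤N = <-≤-trans (subst (_< N ^ 33) (sym eq) (^-monoʳ-< N 2≤N (n<1+n 32)))
  where
  eq : (N * N) ^ 16 ≡ N ^ 32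
  eq = trans (cong (_^ 16) (cong (N *_) (sym (*-identityʳ N)))) (^-*-assoc N 2 16)

theorem6 : (g : ℕ → ℕ) → Computable g →
    ∃[ A ] ∃[ a ] ∃[ b ] ∃[ c ]
    (∀ (k n W : ℕ) → (2 + n + k) ^ a ≤ W →
    (G : Graph n) → HasEdgeCliqueCover G (g k) →
    (σ : State) → IsInput G k σ →
    Maintains A W k (g k) (2 ^ (2 ^ (b * g k))) c G σ)
theorem6 g _ = algorithm , 33 , 2 + exponent insertCmd , 41 ,
  λ k n W W-large G cover σ input →
    let N    = 2 + n + k
        N≤N² = m≤m*n N N
        n+2≤ = ≤-trans (≤-reflexive (+-comm n 2)) (m≤m+n (2 + n) k)
        k<   = s≤s (≤-trans (m≤n+m k n) (n≤1+n (n + k)))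
    in Correctness.maintains k n W (g k) (N * N) (≤-trans (m≤m+n 2 (n + k)) N≤N²) (square^16<W {N} (m≤m+n 2 (n + k)) W-large)
         (≤-trans n+2≤ N≤N²) (≤-trans k< N≤N²) (*-mono-< k< (<-≤-trans (m<m+n n (s≤s z≤n)) n+2≤)) cover input
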